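{- For all integers $t,\delta\geq1$ there exists an integer $\sigma=\sigma(t,\delta)\geq1$ with the following property. Let $G$ be a (theta, prism)-free graph with no clique of cardinality $t$, let $a\in V(G)$, let $T$ be a smooth tree of maximum degree $\delta$, and let $\zeta$ be a rich $(T,a)$-strip-structure in $G$ such that $V(G)\setminus(\zeta^+(T)\cup\mathcal{J}_\zeta)$ is anticomplete to $\zeta^+(T)$. Then for every vertex $x\in V(G)\setminus N_G[a]$ there exists a set $S_x\subseteq V(G)\setminus\{a,x\}$ with $|S_x|<\sigma$ such that $S_x$ separates $a$ and $x$ in $G$.
   Context: Graphs finite simple; "path" = induced path. A set $M\subseteq V(G)\setminus\{x,y\}$ separates $x$ and $y$ in $G$ if there is a partition $(L,M,R)$ of $V(G)$ with $x\in L$, $y\in R$ and no edges between $L$ and $R$. Theta: two non-adjacent vertices joined by three internally disjoint paths of length $\ge2$ with pairwise anticomplete interiors. Prism: two disjoint triangles $\{a_1,a_2,a_3\},\{b_1,b_2,b_3\}$, disjoint paths $P_i$ from $a_i$ to $b_i$, with $a_ia_j,b_ib_j$ the only edges between $P_i,P_j$. Pyramid: apex $a$, base triangle $\{b_1,b_2,b_3\}$, paths $P_i$ from $a$ to $b_i$ of length $\ge1$, otherwise disjoint, $b_ib_j$ the only edge between $P_i\setminus\{a\}$, $P_j\setminus\{a\}$, at most one $P_i$ of length one. A vertex $p\notin\Sigma$ is a jewel for pyramid $\Sigma$ at $b_i$ if $p$ is anticomplete to $P_i$ and $N_{P_j}(p)=N_{P_j}[b_j]$ for $j\ne i$. A tree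 is smooth if it has $\ge3$ vertices and each vertex is a leaf or has degree $>2$ (branch vertex). For $\zeta: V(T)\cup E(T)\cup(E(T)\times V(T))\to 2^{V(G)\setminus\{a\}}$, $S\subseteq V(T)$: $\zeta(S)=\bigcup_{v\in S}\zeta(v)\cup\bigcup_{e\in E(T[S])}\zeta(e)$, $\zeta(T)=\zeta(V(T))$, $\zeta^+(T)=\zeta(T)\cup\{a\}$, $B(v)=\bigcup_{e\ni v}\zeta(e,v)$, $\zeta^\circ(e)=\zeta(e)\setminus(\zeta(e,u)\cup\zeta(e,v))$ for $e=uv$. $\zeta$ is a $(T,a)$-strip-structure if (S1) the sets $\zeta(o)$, $o\in V(T)\cup E(T)$, are pairwise disjoint; (S2) $\zeta(l)=\emptyset$ for leaves; (S3) $\zeta(e,v)\subseteq\zeta(e)$, nonempty iff $e$ incident with $v$; (S4) for distinct $e,f$ and every $v$, $\zeta(e,v)$ complete to $\zeta(f,v)$, no other edges between $\zeta(e),\zeta(f)$; (S5) for $e=uv$, every $x\in\zeta(e)$ has a path in $G[\zeta(e)]$ to $\zeta(e,u)$ with interior in $\zeta^\circ(e)$, and likewise to $\zeta(e,v)$; (S6) $\zeta(v)$ anticomplete to $\zeta(e)\setminus\zeta(e,v)$; (S7) every component of $G[\zeta(v)]$ has a neighbor in $B(v)$; (S8) for each leaf $l$ with edge $e$, $a$ complete to $\zeta(e,l)$, no other neighbors of $a$ in $\zeta(T)$. A $\zeta(e)$-rung ($e=uv$) is a path $P$ in $G[\zeta(e)]$ with either $|P|=1$, $P\subseteq\zeta(e,u)\cap\zeta(e,v)$,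 or an end in $\zeta(e,u)\setminus\zeta(e,v)$, an end in $\zeta(e,v)\setminus\zeta(e,u)$, interior in $\zeta^\circ(e)$; long if $|P|\ge2$. $\zeta$ is rich if $a$ is trapped in $\zeta^+(T)$ (all vertices at distance $\le2$ from $a$ lie in $\zeta^+(T)$, every neighbor of $a$ has degree two in $G[\zeta^+(T)]$) and $|\zeta(e,l)|=1$ for each leaf $l$ with edge $e$. A $\zeta$-pyramid at claw $(v,e_1,e_2,e_3)$ (distinct edges at $v$) is a pyramid with apex $a$, base $b_1b_2b_3$, paths $P_i$ with $b_i\in\zeta(e_i,v)$ and a leaf $l_i$ in the component of $T-e_i$ not containing $v$ such that, for $\Lambda_i$ the $T$-path from $v$ to $l_i$, $P_i=\Gamma_i\cup\{a\}$, $\Gamma_i$ a path in $\bigcup_{e\in E(\Lambda_i)}\zeta(e)$, $\Gamma_i\cap\zeta(e_i)$ a long $\zeta(e_i)$-rung and $\Gamma_i\cap\zeta(e)$ a $\zeta(e)$-rung for other $e\in E(\Lambda_i)$. A vertex $p\in V(G)\setminus\zeta^+(T)$ is a jewel for $\zeta$ at seagull $(v,e_1,e_2)$ (distinct edges at $v$) if for some $e_3\notin\{e_1,e_2\}$ at $v$ there is a $\zeta$-pyramid at $(v,e_1,e_2,e_3)$ with $b_i\in\zeta(e_i,v)$ such that $p$ is a jewel for it at $b_3$. $\mathcal{J}_\zeta$ is the set of all jewels for $\zeta$ at seagulls at branch vertices. -}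

module Defs where

open import Data.Nat using (ℕ; zero; suc; _+_; _<_; _≤_; _>_)
open import Data.Fin using (Fin; toℕ; fromℕ) renaming (zero to fz; suc to fs)
open import Data.Fin.Subset as Sub using (Subset; ∣_∣)
open import Data.List using (List; length; filter)
open import Data.List.Base using ()
open import Data.Fin.Base using ()
open import Data.Fin using (_≟_)
open import Data.List using (allFin) renaming ()
open import Data.Product using (Σ; ∃; ∃-syntax; _×_; _,_)
open import Data.Sum using (_⊎_)
open import Data.Empty using (⊥)
open import Relation.Nullary using (¬_; Dec)
open import Relation.Binary.PropositionalEquality using (_≡_; _≢_)
open import Function.Bundles using (_⇔_)

-- Finite simple graphs on vertex set Fin n.  Adjacency is decidable
-- (harmless for finite graphs); it is symmetric and irreflexive.

record Graph (n : ℕ) : Set₁ where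
  field
    Adj    : Fin n → Fin n → Set
    adj?   : ∀ u v → Dec (Adj u v)
    sym    : ∀ {u v} → Adj u v → Adj v u
    irrefl : ∀ {v} → ¬ Adj v v

open Graph public

VSet : ℕ → Set₁
VSet n = Fin n → Set

module _ {n : ℕ} where
  Disjoint : VSet n → VSet n → Set
  Disjoint A B = ∀ x → A x → B x → ⊥

  _⊆_ : VSet n → VSet n → Set
  A ⊆ B = ∀ x → A x → B x

  Nonempty : VSet n → Set
  Nonempty A = ∃[ x ] A x

module _ {n : ℕ} (G : Graph n) where

  Complete : VSet n → VSet n → Set
  Complete A B = ∀ x y → A x → B y → Adj G x y

  Anticomplete : VSet n → VSet n → Set
  Anticomplete A B = ∀ x y → A x → B y → ¬ Adj G x y

  deg : Fin n → ℕ
  deg v = length (filter (adj? G v) (allFin n))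

  IsLeaf : Fin n → Set
  IsLeaf v = deg v ≡ 1

  IsBranch : Fin n → Set
  IsBranch v = deg v > 2

  -- Induced paths: an injective sequence p_0,…,p_len such that p_i p_j is
  -- an edge iff |i - j| = 1.  The length is the number of edges (len);
  -- |P| (number of vertices) is suc len.

  record Path : Set where
    field
      len    : ℕ
      vert   : Fin (suc len) → Fin n
      inj    : ∀ i j → vert i ≡ vert j → i ≡ j
      adjIff : ∀ i j → Adj G (vert i) (vert j) ⇔
                        (toℕ j ≡ suc (toℕ i) ⊎ toℕ i ≡ suc (toℕ j))

    first : Fin n
    first = vert fz

    last : Fin n
    last = vert (fromℕ len)

    on : VSet n
    on x = ∃[ i ] vert i ≡ x

    interior : VSet n
    interior x = ∃[ i ] (vert i ≡ x × 0 < toℕ i × toℕ i < len)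

  open Path public

  Spans : Path → VSet n → Set
  Spans P X = ∀ x → (on P x → X x) × (X x → on P x)

  HasClique : ℕ → Set
  HasClique t = Σ (Fin t → Fin n) λ f →
    (∀ i j → f i ≡ f j → i ≡ j) × (∀ i j → i ≢ j → Adj G (f i) (f j))

  HasTheta : Set
  HasTheta = Σ (Fin n) λ s → Σ (Fin n) λ t → Σ (Fin 3 → Path) λ P →
      s ≢ t × ¬ Adj G s t
    × (∀ i → first (P i) ≡ s × last (P i) ≡ t × 2 ≤ len (P i))
    × (∀ i j → i ≢ j → ∀ x y → interior (P i) x → interior (P j) y →
          x ≢ y × ¬ Adj G x y)

  HasPrism : Set
  HasPrism = Σ (Fin 3 → Path) λ P →
      (∀ i → 1 ≤ len (P i))
    × (∀ i j → i ≢ j → ∀ x y → on (P i) x → on (P j) y →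
          x ≢ y × (Adj G x y ⇔
             ((x ≡ first (P i) × y ≡ first (P j))
              ⊎ (x ≡ last (P i) × y ≡ last (P j)))))

  ThetaPrismFree : Set
  ThetaPrismFree = ¬ HasTheta × ¬ HasPrism

  record Pyramid : Set where
    field
      apex  : Fin n
      paths : Fin 3 → Path
      fromApex : ∀ i → first (paths i) ≡ apex
      lenPos   : ∀ i → 1 ≤ len (paths i)
      sepIff : ∀ i j → i ≢ j → ∀ x y →
                 on (paths i) x → x ≢ apex → on (paths j) y → y ≢ apex →
                 x ≢ y × (Adj G x y ⇔ (x ≡ last (paths i) × y ≡ last (paths j)))
      atMostOneShort : ∀ i j → i ≢ j → len (paths i) ≡ 1 → len (paths j) ≡ 1 → ⊥

    base : Fin 3 → Fin n
    base i = last (paths i)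

    onPyr : VSet n
    onPyr x = ∃[ i ] on (paths i) x

  open Pyramid public

  JewelAt : Pyramid → Fin 3 → Fin n → Set
  JewelAt Σp k p =
      ¬ onPyr Σp p
    × (∀ y → on (paths Σp k) y → ¬ Adj G p y)
    × (∀ j → j ≢ k → ∀ y → on (paths Σp j) y →
          Adj G p y ⇔ (y ≡ base Σp j ⊎ Adj G y (base Σp j)))

  Separates : Subset n → Fin n → Fin n → Set₁
  Separates M x y =
      ¬ (x Sub.∈ M) × ¬ (y Sub.∈ M)
    × Σ (VSet n) λ L → Σ (VSet n) λ R →
        (∀ v → L v ⊎ (v Sub.∈ M) ⊎ R v)
      × Disjoint L (λ v → v Sub.∈ M) × Disjoint L R × Disjoint (λ v → v Sub.∈ M) R
      × L x × R y × Anticomplete L R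

module _ {m : ℕ} (T : Graph m) where

  HasCycle : Set
  HasCycle = Σ ℕ λ k → Σ (Fin (3 + k) → Fin m) λ c →
      (∀ i j → c i ≡ c j → i ≡ j)
    × (∀ (i : Fin (2 + k)) → Adj T (c (Data.Fin.inject₁ i)) (c (fs i)))
    × Adj T (c (fromℕ (2 + k))) (c fz)

  Connected : Set
  Connected = ∀ u v → Σ (Path T) λ P → first P ≡ u × last P ≡ v

  IsTree : Set
  IsTree = Connected × ¬ HasCycle

  IsSmoothTree : Set
  IsSmoothTree = IsTree × 3 ≤ m × (∀ v → IsLeaf T v ⊎ IsBranch T v)

  MaxDegree : ℕ → Set
  MaxDegree δ = (∀ v → deg T v ≤ δ) × (∃[ v ] deg T v ≡ δ)

-- (T, a)-strip-structures.
-- An edge e = uw of T is represented by the ordered pair (u, w); the data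
-- is required to be symmetric in (u, w).
--   ζV v        = ζ(v)
--   ζE u w      = ζ(uw)
--   ζEV u w v   = ζ(uw, v)

record ZetaData (n m : ℕ) : Set₁ where
  field
    ζV  : Fin m → VSet n
    ζE  : Fin m → Fin m → VSet n
    ζEV : Fin m → Fin m → Fin m → VSet n

open ZetaData public

module _ {n m : ℕ} (G : Graph n) (a : Fin n) (T : Graph m) (ζ : ZetaData n m) where

  private
    AdjT = Adj T
    AdjG = Adj G

  DistinctEdges : Fin m → Fin m → Fin m → Fin m → Set
  DistinctEdges u w u' w' = ¬ ((u ≡ u' × w ≡ w') ⊎ (u ≡ w' × w ≡ u'))

  ζT : VSet n
  ζT x = (∃[ v ] ζV ζ v x) ⊎ (∃[ u ] ∃[ w ] (AdjT u w × ζE ζ u w x))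

  ζT⁺ : VSet n
  ζT⁺ x = ζT x ⊎ x ≡ a

  Bv : Fin m → VSet n
  Bv v x = ∃[ w ] (AdjT v w × ζEV ζ v w v x)

  ζ° : Fin m → Fin m → VSet n
  ζ° u w x = ζE ζ u w x × ¬ ζEV ζ u w u x × ¬ ζEV ζ u w w x

  record IsStripStructure : Set where
    field
      symE  : ∀ u w → AdjT u w → ∀ x → (ζE ζ u w x → ζE ζ w u x)
      symEV : ∀ u w → AdjT u w → ∀ v x → (ζEV ζ u w v x → ζEV ζ w u v x)
      noAV : ∀ v → ¬ ζV ζ v a
      noAE : ∀ u w → AdjT u w → ¬ ζE ζ u w a
      S1vv : ∀ u v → u ≢ v → Disjoint (ζV ζ u) (ζV ζ v)
      S1ve : ∀ v u w → AdjT u w → Disjoint (ζV ζ v) (ζE ζ u w)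
      S1ee : ∀ u w u' w' → AdjT u w → AdjT u' w' → DistinctEdges u w u' w' →
               Disjoint (ζE ζ u w) (ζE ζ u' w')
      S2 : ∀ l → IsLeaf T l → ∀ x → ¬ ζV ζ l x
      S3sub : ∀ u w → AdjT u w → ∀ v → ζEV ζ u w v ⊆ ζE ζ u w
      S3ne  : ∀ u w → AdjT u w → ∀ v →
                Nonempty (ζEV ζ u w v) ⇔ (v ≡ u ⊎ v ≡ w)
      S4complete : ∀ u w u' w' → AdjT u w → AdjT u' w' → DistinctEdges u w u' w' →
                     ∀ v → Complete G (ζEV ζ u w v) (ζEV ζ u' w' v)
      S4only : ∀ u w u' w' → AdjT u w → AdjT u' w' → DistinctEdges u w u' w' →
                 ∀ x y → ζE ζ u w x → ζE ζ u' w' y → AdjG x y →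
                 ∃[ v ] (ζEV ζ u w v x × ζEV ζ u' w' v y)
      -- (S5) (applied to both orientations (u,w) and (w,u), this covers
      -- both ends of the edge)
      S5 : ∀ u w → AdjT u w → ∀ x → ζE ζ u w x →
             Σ (Path G) λ P → first P ≡ x × ζEV ζ u w u (last P)
               × (on P ⊆ ζE ζ u w) × (interior P ⊆ ζ° u w)
      S6 : ∀ v u w → AdjT u w →
             Anticomplete G (ζV ζ v) (λ x → ζE ζ u w x × ¬ ζEV ζ u w v x)
      -- (S7) every component of G[ζ(v)] has a neighbour in B(v):
      -- every x ∈ ζ(v) is joined inside G[ζ(v)] to a vertex with a
      -- neighbour in B(v)
      S7 : ∀ v x → ζV ζ v x →
             Σ (Path G) λ P → first P ≡ x × (on P ⊆ ζV ζ v)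
               × ∃[ z ] (Bv v z × AdjG (last P) z)
      S8complete : ∀ l w → IsLeaf T l → AdjT l w → ∀ x → ζEV ζ l w l x → AdjG a x
      S8only : ∀ x → ζT x → AdjG a x →
                 ∃[ l ] ∃[ w ] (IsLeaf T l × AdjT l w × ζEV ζ l w l x)

  Trapped : Set
  Trapped =
      (∀ x → (x ≡ a ⊎ AdjG a x ⊎ (∃[ y ] (AdjG a y × AdjG y x))) → ζT⁺ x)
    × (∀ x → AdjG a x → ∃[ y₁ ] ∃[ y₂ ] (y₁ ≢ y₂
          × ζT⁺ y₁ × AdjG x y₁ × ζT⁺ y₂ × AdjG x y₂
          × (∀ y → ζT⁺ y → AdjG x y → y ≡ y₁ ⊎ y ≡ y₂)))

  IsRich : Set
  IsRich = Trapped
         × (∀ l w → IsLeaf T l → AdjT l w →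
              ∃[ x ] (∀ y → ζEV ζ l w l y ⇔ y ≡ x))

  RungPath : Fin m → Fin m → Path G → Set
  RungPath u w P = (on P ⊆ ζE ζ u w) ×
    ( (len P ≡ 0 × ζEV ζ u w u (first P) × ζEV ζ u w w (first P))
    ⊎ (ζEV ζ u w u (first P) × ¬ ζEV ζ u w w (first P)
       × ζEV ζ u w w (last P) × ¬ ζEV ζ u w u (last P)
       × (interior P ⊆ ζ° u w)))

  IsRung : Fin m → Fin m → VSet n → Set
  IsRung u w X = Σ (Path G) λ P → Spans G P X × RungPath u w P

  IsLongRung : Fin m → Fin m → VSet n → Set
  IsLongRung u w X = Σ (Path G) λ P → Spans G P X × RungPath u w P × 1 ≤ len P

  OnPathEdge : Path T → Fin m → Fin m → Set
  OnPathEdge Λ u w = Σ (Fin (len Λ)) λ k →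
    vert Λ (Data.Fin.inject₁ k) ≡ u × vert Λ (fs k) ≡ w

  IsζPyramid : Fin m → (Fin 3 → Fin m) → Pyramid G → Set
  IsζPyramid v w Σp =
      apex Σp ≡ a
    × (∀ i → AdjT v (w i))
    × (∀ i j → i ≢ j → w i ≢ w j)
    × (∀ i → ζEV ζ v (w i) v (base Σp i)
        × Σ (Fin m) λ l → Σ (Path T) λ Λ →
            IsLeaf T l × first Λ ≡ v × last Λ ≡ l
          × (∃[ k ] (toℕ k ≡ 1 × vert Λ k ≡ w i))
            -- the leaf l lies in the component of T - vw_i not containing v
          × let Γ : VSet n
                Γ x = on (paths Σp i) x × x ≢ a
            in (Γ ⊆ (λ x → ∃[ u ] ∃[ u' ] (OnPathEdge Λ u u' × ζE ζ u u' x)))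
             × IsLongRung v (w i) (λ x → Γ x × ζE ζ v (w i) x)
             × (∀ u u' → OnPathEdge Λ u u' → DistinctEdges u u' v (w i) →
                  IsRung u u' (λ x → Γ x × ζE ζ u u' x)))

  Jζ : VSet n
  Jζ p = ¬ ζT⁺ p × Σ (Fin m) λ v → Σ (Fin 3 → Fin m) λ w → Σ (Pyramid G) λ Σp →
           IsBranch T v × IsζPyramid v w Σp × JewelAt G Σp (fs (fs fz)) p

module Submission where

{-
Call ⋃ ζ(e) the frame. Fix a branch vertex v of T and consider the components of the frame minus
B(v) that meet N(a). Enlarge them, keeping them connected, pairwise anticomplete and attached to
their original vertices β of B(v), to a maximal family of classes. Since G is theta-free, no
vertex sees more than two classes, and by maximality any two vertices that see a single class, not
the same one, are adjacent. Vertices seeing two classes i, j are adjacent to the first two vertices of fixed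
paths from B(v) to a through i and j (this uses the absence of prisms), so no three of them are
stable. With a Ramsey argument and K₂,₃ ⊄ G this gives a set K of bounded size, each of whose
vertices has a neighbour in B(v), such that G - a - K has no path between distinct classes.

If x ∉ K, then x is separated by K from all neighbours of a but those beyond one edge at v; follow
this edge. If x ∈ K, branch into all edges at v. The latter cannot happen at seven consecutive
vertices of a path of T, as the first, fourth and seventh would give three exits from x to a that
form a theta. So the search stops after collecting boundedly many sets K.
-}

open import Defs
open import Data.Nat using (ℕ; zero; suc; _+_; _*_; _∸_; _<_; _≤_; z≤n; s≤s; _≤?_)
open import Data.Nat.Properties
open import Data.Nat.Induction using (Acc; acc; <-wellFounded)
open import Data.Bool using (true; false)
open import Data.Fin using (Fin; toℕ; fromℕ; fromℕ<; inject₁) renaming (zero to fz; suc to fs)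
import Data.Fin.Properties as Fin
open import Data.Fin.Subset using (Subset; ∣_∣; _∈_; _∉_; ⁅_⁆) renaming (_∪_ to _∪ˢ_; ⊥ to ∅)
import Data.Fin.Subset.Properties as Subset
open import Data.List using (List; []; _∷_; _++_; length; filter; allFin; lookup)
import Data.List.Properties as List
open import Data.List.Membership.Propositional using () renaming (_∈_ to _∈ˡ_; _∉_ to _∉ˡ_)
open import Data.List.Membership.Propositional.Properties
  using (∈-filter⁺; ∈-filter⁻; ∈-allFin; ∈-++⁺ˡ; ∈-++⁺ʳ; ∈-++⁻; ∈-lookup)
open import Data.List.Relation.Unary.Any as Any using (here; there)
open import Data.List.Relation.Unary.All as All using (All; []; _∷_)
import Data.List.Relation.Unary.All.Properties as All
open import Data.List.Relation.Unary.AllPairs using (AllPairs; []; _∷_)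
open import Data.List.Relation.Unary.Unique.Propositional using (Unique)
import Data.List.Relation.Unary.Unique.Propositional.Properties as Unique
open import Data.Maybe using (Maybe; just; nothing)
import Data.Maybe.Properties as Maybe
open import Data.Vec using ([]; _∷_)
open import Data.Product using (Σ; ∃-syntax; _×_; _,_; proj₁; proj₂)
open import Data.Sum using (_⊎_; inj₁; inj₂; [_,_]′)
open import Data.Unit using (⊤)
open import Data.Empty using (⊥; ⊥-elim)
open import Effect.Monad using (RawMonad)
open import Function using (_∘_)
open import Function.Bundles using (_⇔_; mk⇔; Equivalence)
open import Relation.Nullary using (¬_; Dec; yes; no)
open import Relation.Nullary.Decidable
  using (_⊎-dec_; _×-dec_; _→-dec_; map′; ¬?; decidable-stable; ¬¬-excluded-middle)
open import Relation.Nullary.Negation using (¬¬-Monad)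
open import Relation.Unary using (Decidable; _∪_)
open import Relation.Binary.Definitions using (tri<; tri≈; tri>)
open import Relation.Binary.PropositionalEquality
  using (_≡_; _≢_; refl; cong; subst; subst₂; trans) renaming (sym to ≡sym)

-- Walks and induced paths

-- The classes lie in the frame only at the start, whereas the cut must stop walks through all of G
-- - a. Enlarging the classes absorbs every vertex that can join one harmlessly. A vertex left next
-- to a class sees two classes or is tied to the other classes through B(v), and thetas and prisms
-- control both kinds. One class may keep many attached vertices; K ignores them, as a walk between
-- two classes can be read from the end in the other class.
--
-- Neighbours of `a` have degree two, so paths inside a class can avoid N(a). This lets `a` be an
-- inner vertex of a path of a prism.
--
-- The obstacle is that K may contain x, which must not be deleted. Then x has an exit to `a`
-- through v, but it may start in the strip of an edge of the walk in T. So the exits at w₁, w₄, w₇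
-- occupy w₁w₂, w₃w₄w₅, w₆w₇ with the subtrees attached there, and these are disjoint.
--
-- Following an edge does not accumulate cost: K together with a set that shuts this one edge
-- already separates x from `a`, and whatever was collected before is dropped.

pick : ∀ {ℓ} {A : Set ℓ} → A → A → A → Fin 3 → A
pick x y z fz           = x
pick x y z (fs fz)      = y
pick x y z (fs (fs fz)) = z

all3 : ∀ {ℓ} {P : Fin 3 → Set ℓ} → P fz → P (fs fz) → P (fs (fs fz)) → ∀ i → P i
all3 p q r fz           = p
all3 p q r (fs fz)      = q
all3 p q r (fs (fs fz)) = r

pairs3 : ∀ {ℓ} {P : Fin 3 → Fin 3 → Set ℓ} → (∀ {i j} → P i j → P j i) →
         P fz (fs fz) → P fz (fs (fs fz)) → P (fs fz) (fs (fs fz)) →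
         ∀ i j → i ≢ j → P i j
pairs3 s p q r fz           fz           ne = ⊥-elim (ne refl)
pairs3 s p q r fz           (fs fz)      ne = p
pairs3 s p q r fz           (fs (fs fz)) ne = q
pairs3 s p q r (fs fz)      fz           ne = s p
pairs3 s p q r (fs fz)      (fs fz)      ne = ⊥-elim (ne refl)
pairs3 s p q r (fs fz)      (fs (fs fz)) ne = r
pairs3 s p q r (fs (fs fz)) fz           ne = s q
pairs3 s p q r (fs (fs fz)) (fs fz)      ne = s r
pairs3 s p q r (fs (fs fz)) (fs (fs fz)) ne = ⊥-elim (ne refl)

greatest≤ : ∀ {Q : ℕ → Set} → Decidable Q → ∀ r k → k ≤ r → Q k →
            ∃[ j ] (k ≤ j × j ≤ r × Q j × (∀ l → j < l → l ≤ r → ¬ Q l))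
greatest≤ Q? r k k≤r qk with Q? r
... | yes qr = r , k≤r , ≤-refl , qr , λ l r<l l≤r _ → <-irrefl refl (<-≤-trans r<l l≤r)
greatest≤ Q? zero    .zero z≤n qk | no ¬q = ⊥-elim (¬q qk)
greatest≤ {Q} Q? (suc r) k k≤r qk | no ¬q with m≤n⇒m<n∨m≡n k≤r
... | inj₂ refl = ⊥-elim (¬q qk)
... | inj₁ (s≤s k≤r′) with greatest≤ Q? r k k≤r′ qk
...   | j , k≤j , j≤r , qj , max = j , k≤j , m≤n⇒m≤1+n j≤r , qj , max′
  where
  max′ : ∀ l → j < l → l ≤ suc r → ¬ Q l
  max′ l j<l l≤ ql with m≤n⇒m<n∨m≡n l≤
  ... | inj₂ refl = ¬q ql
  ... | inj₁ (s≤s l≤r) = max l j<l l≤r ql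

least≤ : ∀ {Q : ℕ → Set} → Decidable Q → ∀ k → Q k →
         ∃[ j ] (j ≤ k × Q j × (∀ l → l < j → ¬ Q l))
least≤ Q? k qk with Q? 0
... | yes q0 = 0 , z≤n , q0 , λ l ()
least≤ Q? zero    qk | no ¬q0 = ⊥-elim (¬q0 qk)
least≤ Q? (suc k) qk | no ¬q0 with least≤ (λ i → Q? (suc i)) k qk
... | j , j≤k , qj , min =
  suc j , s≤s j≤k , qj , λ { zero _ q0 → ¬q0 q0 ; (suc l) (s≤s lt) → min l lt }

module Walks {n : ℕ} (G : Graph n) where

  infixr 5 _∷⟨_⟩_
  data Walk (X : VSet n) : Fin n → Fin n → Set where
    stop   : ∀ {u} → X u → Walk X u u
    _∷⟨_⟩_ : ∀ {u v w} → X u → Adj G u v → Walk X v w → Walk X u w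

  module _ {X : VSet n} where

    head∈ : ∀ {u v} → Walk X u v → X u
    head∈ (stop x)     = x
    head∈ (x ∷⟨ _ ⟩ _) = x

    last∈ : ∀ {u v} → Walk X u v → X v
    last∈ (stop x)     = x
    last∈ (_ ∷⟨ _ ⟩ p) = last∈ p

    _++ʷ_ : ∀ {u v w} → Walk X u v → Walk X v w → Walk X u w
    stop _       ++ʷ q = q
    (x ∷⟨ e ⟩ p) ++ʷ q = x ∷⟨ e ⟩ (p ++ʷ q)

    bridge : ∀ {u v w z} → Walk X u v → Adj G v w → Walk X w z → Walk X u z
    bridge p e q = p ++ʷ (last∈ p ∷⟨ e ⟩ q)

    reverse : ∀ {u v} → Walk X u v → Walk X v u
    reverse (stop x)     = stop x
    reverse (x ∷⟨ e ⟩ p) = bridge (reverse p) (Graph.sym G e) (stop x)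

  mapʷ : ∀ {X Y : VSet n} → (∀ z → X z → Y z) → ∀ {u v} → Walk X u v → Walk Y u v
  mapʷ f (stop x)     = stop (f _ x)
  mapʷ f (x ∷⟨ e ⟩ p) = f _ x ∷⟨ e ⟩ mapʷ f p

  module _ {X Y : VSet n} (Y? : Decidable Y) where

    lastIn : ∀ {u v} → Walk X u v → Y u → ¬ Y v →
             ∃[ b ] ∃[ c ] (X b × Y b × Adj G b c × Walk (λ z → X z × ¬ Y z) c v)
    lastIn p yu ¬yv with lastOr p
      where
      lastOr : ∀ {u v} → Walk X u v →
               (∃[ b ] ∃[ c ] (X b × Y b × Adj G b c × Walk (λ z → X z × ¬ Y z) c v))
               ⊎ Y v ⊎ Walk (λ z → X z × ¬ Y z) u v
      lastOr {u} (stop x) with Y? u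
      ... | yes y = inj₂ (inj₁ y)
      ... | no ¬y = inj₂ (inj₂ (stop (x , ¬y)))
      lastOr {u} (x ∷⟨ e ⟩ p) with lastOr p
      ... | inj₁ r        = inj₁ r
      ... | inj₂ (inj₁ y) = inj₂ (inj₁ y)
      ... | inj₂ (inj₂ q) with Y? u
      ...   | yes y = inj₁ (u , _ , x , y , e , q)
      ...   | no ¬y = inj₂ (inj₂ ((x , ¬y) ∷⟨ e ⟩ q))
    ... | inj₁ r        = r
    ... | inj₂ (inj₁ y) = ⊥-elim (¬yv y)
    ... | inj₂ (inj₂ q) = ⊥-elim (proj₂ (head∈ q) yu)

    firstIn : ∀ {u v} → Walk X u v → ¬ Y u → Y v →
              ∃[ c ] ∃[ b ] (Walk (λ z → X z × ¬ Y z) u c × Adj G c b × X b × Y b)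
    firstIn (stop x) ¬yu yv = ⊥-elim (¬yu yv)
    firstIn (_∷⟨_⟩_ {v = v} x e p) ¬yu yz with Y? v
    ... | yes y = _ , v , stop (x , ¬yu) , e , head∈ p , y
    ... | no ¬y with firstIn p ¬y yz
    ...   | c , b , q , e′ , xb , yb = c , b , ((x , ¬yu) ∷⟨ e ⟩ q) , e′ , xb , yb

  -- Indexed by ℕ, with meaningless values beyond `r`, so that shifting and cutting a path needs no
  -- arithmetic in `Fin`. The field `far` combines injectivity with the absence of chords.
  record IPath (X : VSet n) (u v : Fin n) : Set where
    field
      r     : ℕ
      w     : ℕ → Fin n
      start : w 0 ≡ u
      end   : w r ≡ v
      inside : ∀ k → k ≤ r → X (w k)
      next  : ∀ k → k < r → Adj G (w k) (w (suc k))
      far   : ∀ k l → k < l → l ≤ r → w k ≢ w l × (Adj G (w k) (w l) → l ≡ suc k)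

    segment : ∀ i d → i + d ≤ r → Walk (λ z → ∃[ k ] (i ≤ k × k ≤ i + d × z ≡ w k)) (w i) (w (i + d))
    segment i zero le = subst (λ m → Walk (λ z → ∃[ k ] (i ≤ k × k ≤ m × z ≡ w k)) (w i) (w m))
                              (≡sym (+-identityʳ i)) (stop (i , ≤-refl , ≤-refl , refl))
    segment i (suc d) le =
      subst (λ m → Walk (λ z → ∃[ k ] (i ≤ k × k ≤ m × z ≡ w k)) (w i) (w m)) (≡sym (+-suc i d))
        (bridge (mapʷ (λ { z (k , a , b , e) → k , a , m≤n⇒m≤1+n b , e }) (segment i d (≤-trans (n≤1+n _) le′)))
                (next (i + d) le′)
                (stop (suc (i + d) , m≤n⇒m≤1+n (m≤m+n i d) , ≤-refl , refl)))
      where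
      le′ : suc (i + d) ≤ r
      le′ = subst (_≤ r) (+-suc i d) le

    between : ∀ i j → i ≤ j → j ≤ r → Walk (λ z → ∃[ k ] (i ≤ k × k ≤ j × z ≡ w k)) (w i) (w j)
    between i j i≤j j≤r =
      subst (λ m → Walk (λ z → ∃[ k ] (i ≤ k × k ≤ m × z ≡ w k)) (w i) (w m)) (m+[n∸m]≡n i≤j)
        (segment i (j ∸ i) (subst (_≤ r) (≡sym (m+[n∸m]≡n i≤j)) j≤r))

    toPath : Path G
    toPath = record
      { len = r
      ; vert = λ i → w (toℕ i)
      ; inj = λ i j e → Fin.toℕ-injective (inj′ (toℕ i) (toℕ j) (bd i) (bd j) e)
      ; adjIff = λ i j → mk⇔ (to (toℕ i) (toℕ j) (bd i) (bd j)) (from (toℕ i) (toℕ j) (bd i) (bd j))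
      }
      where
      bd : (i : Fin (suc r)) → toℕ i ≤ r
      bd i = ≤-pred (Fin.toℕ<n i)
      inj′ : ∀ k l → k ≤ r → l ≤ r → w k ≡ w l → k ≡ l
      inj′ k l kr lr e with <-cmp k l
      ... | tri< lt _ _ = ⊥-elim (proj₁ (far k l lt lr) e)
      ... | tri≈ _ eq _ = eq
      ... | tri> _ _ gt = ⊥-elim (proj₁ (far l k gt kr) (≡sym e))
      to : ∀ k l → k ≤ r → l ≤ r → Adj G (w k) (w l) → l ≡ suc k ⊎ k ≡ suc l
      to k l kr lr e with <-cmp k l
      ... | tri< lt _ _ = inj₁ (proj₂ (far k l lt lr) e)
      ... | tri≈ _ refl _ = ⊥-elim (irrefl G e)
      ... | tri> _ _ gt = inj₂ (proj₂ (far l k gt kr) (Graph.sym G e))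
      from : ∀ k l → k ≤ r → l ≤ r → l ≡ suc k ⊎ k ≡ suc l → Adj G (w k) (w l)
      from k l kr lr (inj₁ refl) = next k lr
      from k l kr lr (inj₂ refl) = Graph.sym G (next l kr)

    toPath-last : last toPath ≡ v
    toPath-last = trans (cong w (Fin.toℕ-fromℕ r)) end

    toPath-on : ∀ z → on toPath z → X z
    toPath-on z (i , refl) = inside (toℕ i) (≤-pred (Fin.toℕ<n i))

  open IPath

  shift : ∀ {X u v} (P : IPath X u v) k → k ≤ r P → IPath X (w P k) v
  shift P k k≤r = record
    { r = r P ∸ k ; w = λ i → w P (i + k) ; start = refl
    ; end = trans (cong (w P) (m∸n+n≡m k≤r)) (end P)
    ; inside = λ i le → inside P (i + k) (bd le)
    ; next = λ i lt → next P (i + k) (bd lt)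
    ; far = λ i j lt le → let (a , b) = far P (i + k) (j + k) (+-monoˡ-< k lt) (bd le)
                          in a , λ e → +-cancelʳ-≡ k j (suc i) (b e) }
    where
    bd : ∀ {i} → i ≤ r P ∸ k → i + k ≤ r P
    bd le = subst (_ ≤_) (m∸n+n≡m k≤r) (+-monoˡ-≤ k le)

  consPath : ∀ {X u v z} → X u → (P : IPath X v z) → Adj G u v →
             (∀ k → k ≤ r P → u ≢ w P k × (Adj G u (w P k) → k ≡ 0)) → IPath X u z
  consPath {X} {u} xu P e sep = record
    { r = suc (r P) ; w = w′ ; start = refl ; end = end P
    ; inside = λ { zero _ → xu ; (suc k) (s≤s le) → inside P k le }
    ; next = λ { zero _ → subst (Adj G u) (≡sym (start P)) e ; (suc k) (s≤s lt) → next P k lt }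
    ; far = far′ }
    where
    w′ : ℕ → Fin n
    w′ zero    = u
    w′ (suc k) = w P k
    far′ : ∀ k l → k < l → l ≤ suc (r P) → w′ k ≢ w′ l × (Adj G (w′ k) (w′ l) → l ≡ suc k)
    far′ zero    (suc l) _ (s≤s le) = proj₁ (sep l le) , λ a → cong suc (proj₂ (sep l le) a)
    far′ (suc k) (suc l) (s≤s lt) (s≤s le) = let (a , b) = far P k l lt le in a , λ e → cong suc (b e)

  -- Shortcut at the last vertex of the remaining path that equals u or is adjacent to it.
  induce : ∀ {X u v} → Walk X u v → IPath X u v
  induce {X} {u} (stop x) = record
    { r = 0 ; w = λ _ → u ; start = refl ; end = refl ; inside = λ _ _ → x
    ; next = λ _ () ; far = λ { zero .zero () z≤n } }
  induce {X} {u} {v} (x ∷⟨ e ⟩ p) with induce p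
  ... | P with greatest≤ (λ k → (u Fin.≟ w P k) ⊎-dec adj? G u (w P k)) (r P) 0 z≤n
                 (inj₂ (subst (Adj G u) (≡sym (start P)) e))
  ...   | k , _ , k≤r , inj₁ eq , max = subst (λ z → IPath X z v) (≡sym eq) (shift P k k≤r)
  ...   | k , _ , k≤r , inj₂ a  , max = consPath x (shift P k k≤r) a sep
    where
    sep : ∀ i → i ≤ r P ∸ k → u ≢ w P (i + k) × (Adj G u (w P (i + k)) → i ≡ 0)
    sep zero    _  = (λ eq → irrefl G (subst (Adj G u) (≡sym eq) a)) , λ _ → refl
    sep (suc i) le = (λ eq → max _ lt le′ (inj₁ eq)) , λ a′ → ⊥-elim (max _ lt le′ (inj₂ a′))
      where
      lt : k < suc i + k
      lt = s≤s (m≤n+m k i)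
      le′ : suc i + k ≤ r P
      le′ = subst (_ ≤_) (m∸n+n≡m k≤r) (+-monoˡ-≤ k le)

  Apart : VSet n → VSet n → Set
  Apart X Y = ∀ x y → X x → Y y → x ≢ y × ¬ Adj G x y

  apart-sym : ∀ {X Y} → Apart X Y → Apart Y X
  apart-sym h x y p q = let (a , b) = h y x q p in (λ e → a (≡sym e)) , λ e → b (Graph.sym G e)

  Exit : Fin n → Fin n → VSet n → Set
  Exit c a X = ∃[ u ] ∃[ z ] (Adj G c u × Walk X u z × Adj G z a)

  module _ (c a : Fin n) (c≢a : c ≢ a) (c≁a : ¬ Adj G c a) where

    private
      Leg : VSet n → Set
      Leg X = Σ (Path G) λ P → (first P ≡ c × last P ≡ a × 2 ≤ len P) × (∀ x → interior P x → X x)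

      leg : ∀ {X} → Exit c a X → Leg X
      leg {X} (u , z , cu , p , za) = toPath P , (start P , toPath-last P , long (r P) refl) , int
        where
        Y : VSet n
        Y y = y ≡ c ⊎ y ≡ a ⊎ X y
        P : IPath Y c a
        P = induce (inj₁ refl ∷⟨ cu ⟩ bridge (mapʷ (λ _ x → inj₂ (inj₂ x)) p) za (stop (inj₂ (inj₁ refl))))
        long : ∀ m → r P ≡ m → 2 ≤ m
        long 0 eq = ⊥-elim (c≢a (trans (≡sym (start P)) (trans (cong (w P) (≡sym eq)) (end P))))
        long 1 eq = ⊥-elim (c≁a (subst₂ (Adj G) (start P) (trans (cong (w P) (≡sym eq)) (end P))
                                  (next P 0 (subst (0 <_) (≡sym eq) (s≤s z≤n)))))
        long (suc (suc m)) eq = s≤s (s≤s z≤n)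
        int : ∀ x → interior (toPath P) x → X x
        int x (i , refl , 0<i , i<r) with inside P (toℕ i) (<⇒≤ i<r)
        ... | inj₁ eq        = ⊥-elim (proj₁ (far P 0 (toℕ i) 0<i (<⇒≤ i<r)) (trans (start P) (≡sym eq)))
        ... | inj₂ (inj₁ eq) = ⊥-elim (proj₁ (far P (toℕ i) (r P) i<r ≤-refl) (trans eq (≡sym (end P))))
        ... | inj₂ (inj₂ x)  = x

    -- Shortening a walk to an induced path keeps its interior in the same set, so three walks in
    -- disjoint, pairwise anticomplete sets suffice. The paths have length at least two because `c`
    -- and `a` are distinct and non-adjacent.
    theta : ∀ {X Y Z} → Exit c a X → Exit c a Y → Exit c a Z →
            Apart X Y → Apart X Z → Apart Y Z → HasTheta G
    theta {X} {Y} {Z} ex ey ez xy xz yz with leg ex | leg ey | leg ez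
    ... | P , pP , iP | Q , pQ , iQ | R , pR , iR =
      c , a , pick P Q R , c≢a , c≁a , all3 pP pQ pR ,
      pairs3 {P = λ i j → Apart (interior (pick P Q R i)) (interior (pick P Q R j))} apart-sym
        (λ x y p q → xy x y (iP x p) (iQ y q))
        (λ x y p q → xz x y (iP x p) (iR y q))
        (λ x y p q → yz x y (iQ x p) (iR y q))

  K23⇒theta : ∀ {s t x y z} → s ≢ t → ¬ Adj G s t → x ≢ y → x ≢ z → y ≢ z →
              ¬ Adj G x y → ¬ Adj G x z → ¬ Adj G y z →
              Adj G s x → Adj G s y → Adj G s z → Adj G x t → Adj G y t → Adj G z t → HasTheta G
  K23⇒theta {s} {t} {x} {y} {z} s≢t s≁t x≢y x≢z y≢z xy xz yz sx sy sz xt yt zt =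
    theta s t s≢t s≁t (exit sx xt) (exit sy yt) (exit sz zt)
      (single x≢y xy) (single x≢z xz) (single y≢z yz)
    where
    exit : ∀ {v} → Adj G s v → Adj G v t → Exit s t (_≡ v)
    exit p q = _ , _ , p , stop refl , q
    single : ∀ {u v} → u ≢ v → ¬ Adj G u v → Apart (_≡ u) (_≡ v)
    single ne na _ _ refl refl = ne , na

  Joined : (X Y : VSet n) (t₁ t₂ s₁ s₂ : Fin n) → Set
  Joined X Y t₁ t₂ s₁ s₂ = ∀ x y → X x → Y y →
    x ≢ y × (Adj G x y → (x ≡ t₁ × y ≡ t₂) ⊎ (x ≡ s₁ × y ≡ s₂))

  -- `Joined` passes to subsets, and shortening a walk keeps its ends; so walks suffice here as
  -- well.
  prism : ∀ {X Y Z t₁ t₂ t₃ s₁ s₂ s₃} →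
          Walk X t₁ s₁ → Walk Y t₂ s₂ → Walk Z t₃ s₃ → t₁ ≢ s₁ → t₂ ≢ s₂ → t₃ ≢ s₃ →
          Adj G t₁ t₂ → Adj G t₁ t₃ → Adj G t₂ t₃ → Adj G s₁ s₂ → Adj G s₁ s₃ → Adj G s₂ s₃ →
          Joined X Y t₁ t₂ s₁ s₂ → Joined X Z t₁ t₃ s₁ s₃ → Joined Y Z t₂ t₃ s₂ s₃ → HasPrism G
  prism {X} {Y} {Z} p q r n₁ n₂ n₃ t12 t13 t23 s12 s13 s23 j12 j13 j23 =
    pick P Q R , all3 (long p n₁) (long q n₂) (long r n₃) ,
    pairs3 {P = λ i j → ∀ x y → on (pick P Q R i) x → on (pick P Q R j) y →
              x ≢ y × (Adj G x y ⇔ ((x ≡ first (pick P Q R i) × y ≡ first (pick P Q R j))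
                                    ⊎ (x ≡ last (pick P Q R i) × y ≡ last (pick P Q R j))))}
      (λ h x y a b → let (e , f) = h y x b a in (λ eq → e (≡sym eq)) , mk⇔
        (λ ad → swap (Equivalence.to f (Graph.sym G ad)))
        (λ c → Graph.sym G (Equivalence.from f (swap c))))
      (pair p q t12 s12 j12) (pair p r t13 s13 j13) (pair q r t23 s23 j23)
    where
    swap : ∀ {A B C D : Set} → (A × B) ⊎ (C × D) → (B × A) ⊎ (D × C)
    swap (inj₁ (a , b)) = inj₁ (b , a)
    swap (inj₂ (c , d)) = inj₂ (d , c)
    P Q R : Path G
    P = toPath (induce p)
    Q = toPath (induce q)
    R = toPath (induce r)
    long : ∀ {X t s} (p : Walk X t s) → t ≢ s → 1 ≤ IPath.r (induce p)
    long p ne with IPath.r (induce p) in eq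
    ... | zero  = ⊥-elim (ne (trans (≡sym (start (induce p)))
                    (trans (cong (w (induce p)) (≡sym eq)) (end (induce p)))))
    ... | suc _ = s≤s z≤n
    pair : ∀ {X Y t₁ t₂ s₁ s₂} (p : Walk X t₁ s₁) (q : Walk Y t₂ s₂) →
           Adj G t₁ t₂ → Adj G s₁ s₂ → Joined X Y t₁ t₂ s₁ s₂ →
           ∀ x y → on (toPath (induce p)) x → on (toPath (induce q)) y →
           x ≢ y × (Adj G x y ⇔ ((x ≡ first (toPath (induce p)) × y ≡ first (toPath (induce q)))
                                 ⊎ (x ≡ last (toPath (induce p)) × y ≡ last (toPath (induce q)))))
    pair p q t s j x y ox oy
      rewrite start (induce p) | start (induce q) | toPath-last (induce p) | toPath-last (induce q)
      with j x y (toPath-on (induce p) x ox) (toPath-on (induce q) y oy)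
    ... | ne , f = ne , mk⇔ f λ { (inj₁ (refl , refl)) → t ; (inj₂ (refl , refl)) → s }

-- Counting, reachability and a Ramsey bound

module _ {A : Set} {P Q : A → Set} (P? : Decidable P) (Q? : Decidable Q) (P⊆Q : ∀ x → P x → Q x) where

  filter-length-mono : ∀ xs → length (filter P? xs) ≤ length (filter Q? xs)
  filter-length-mono [] = z≤n
  filter-length-mono (x ∷ xs) with P? x | Q? x
  ... | yes p | yes q = s≤s (filter-length-mono xs)
  ... | yes p | no ¬q = ⊥-elim (¬q (P⊆Q x p))
  ... | no ¬p | yes q = m≤n⇒m≤1+n (filter-length-mono xs)
  ... | no ¬p | no ¬q = filter-length-mono xs

  filter-length-strict : ∀ xs {x} → x ∈ˡ xs → Q x → ¬ P x → length (filter P? xs) < length (filter Q? xs)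
  filter-length-strict (y ∷ xs) (here refl) q ¬p with P? y | Q? y
  ... | yes p | _     = ⊥-elim (¬p p)
  ... | no _  | yes _ = s≤s (filter-length-mono xs)
  ... | no _  | no ¬q = ⊥-elim (¬q q)
  filter-length-strict (y ∷ xs) (there m) q ¬p with P? y | Q? y
  ... | yes p | yes _ = s≤s (filter-length-strict xs m q ¬p)
  ... | yes p | no ¬q = ⊥-elim (¬q (P⊆Q y p))
  ... | no _  | yes _ = m≤n⇒m≤1+n (filter-length-strict xs m q ¬p)
  ... | no _  | no _  = filter-length-strict xs m q ¬p

count : ∀ {n} {P : Fin n → Set} → Decidable P → ℕ
count {n} P? = length (filter P? (allFin n))

module _ {A C : Set} (Φ : A → List C → Set) (Q : C → Set)
         (mono : ∀ i {S S′} → (∀ c → c ∈ˡ S → c ∈ˡ S′) → Φ i S → Φ i S′) (b : ℕ) where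

  -- Here `Φ i S` means that `S` settles task `i`, which adding vertices does not spoil. The tasks
  -- will be the pairs of classes of a star and the edges at a vertex of the tree.
  unions : ∀ L → (∀ i → i ∈ˡ L → ∃[ S ] (length S ≤ b × (∀ c → c ∈ˡ S → Q c) × Φ i S)) →
           ∃[ S ] (length S ≤ length L * b × (∀ c → c ∈ˡ S → Q c) × (∀ i → i ∈ˡ L → Φ i S))
  unions [] f = [] , z≤n , (λ _ ()) , λ _ ()
  unions (x ∷ L) f with f x (here refl) | unions L (λ i m → f i (there m))
  ... | S , sb , sq , sφ | S′ , sb′ , sq′ , sφ′ =
    S ++ S′ , subst (_≤ _) (≡sym (List.length-++ S)) (+-mono-≤ sb sb′)
    , (λ c m → All.lookup (All.++⁺ (All.tabulate (λ {c} → sq c)) (All.tabulate (λ {c} → sq′ c))) m)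
    , λ { i (here refl) → mono i (λ c → ∈-++⁺ˡ) sφ ; i (there m) → mono i (λ c → ∈-++⁺ʳ S) (sφ′ i m) }

module Finite {n : ℕ} (G : Graph n) where
  open Walks G
  open IPath

  IPath-short : ∀ {X u v} (P : IPath X u v) → r P < n
  IPath-short P = Fin.injective⇒≤ {f = Path.vert (toPath P)} (λ {i} {j} → Path.inj (toPath P) i j)

  data Within (X : VSet n) (v : Fin n) : ℕ → Fin n → Set where
    done : ∀ {k} → X v → Within X v k v
    more : ∀ {k u w} → X u → Adj G u w → Within X v k w → Within X v (suc k) u

  within? : ∀ {X} → Decidable X → ∀ k u v → Dec (Within X v k u)
  within? X? k u v with u Fin.≟ v | X? u
  ... | _ | no ¬x = no λ { (done x) → ¬x x ; (more x _ _) → ¬x x }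
  ... | yes refl | yes x = yes (done x)
  within? X? zero u v | no ne | yes x = no λ { (done _) → ne refl }
  within? X? (suc k) u v | no ne | yes x with Fin.any? (λ w → adj? G u w ×-dec within? X? k w v)
  ... | yes (w , e , p) = yes (more x e p)
  ... | no ¬p = no λ { (done _) → ne refl ; (more _ e p) → ¬p (_ , e , p) }

  within⇒walk : ∀ {X k u v} → Within X v k u → Walk X u v
  within⇒walk (done x)     = stop x
  within⇒walk (more x e p) = x ∷⟨ e ⟩ within⇒walk p

  ipath⇒within : ∀ {X u v} (P : IPath X u v) k i → i ≤ r P → r P ∸ i ≤ k → Within X v k (w P i)
  ipath⇒within {X} {u} {v} P k i i≤r le with m≤n⇒m<n∨m≡n i≤r
  ... | inj₂ refl = subst (Within X v k) (≡sym (end P)) (done (subst X (end P) (inside P _ ≤-refl)))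
  ipath⇒within P zero i i≤r le | inj₁ lt = ⊥-elim (<⇒≱ (m<n⇒0<n∸m lt) le)
  ipath⇒within P (suc k) i i≤r le | inj₁ lt =
    more (inside P i i≤r) (next P i lt)
      (ipath⇒within P k (suc i) lt (≤-trans (≤-reflexive (≡sym (pred[m∸n]≡m∸[1+n] (r P) i))) (pred-mono-≤ le)))

  -- An induced path has fewer than `n` edges, so a search to depth `n` decides reachability.
  walk? : ∀ {X} → Decidable X → ∀ u v → Dec (Walk X u v)
  walk? {X} X? u v = map′ within⇒walk (λ p → conv (induce p)) (within? X? n u v)
    where
    conv : IPath X u v → Within X v n u
    conv P = subst (Within X v n) (start P) (ipath⇒within P n 0 z≤n (<⇒≤ (IPath-short P)))

  module _ {X : VSet n} (X? : Decidable X) where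

    rep : Fin n → Fin n
    rep u = headOr u (filter (walk? X? u) (allFin n))
      where
      headOr : Fin n → List (Fin n) → Fin n
      headOr d []      = d
      headOr d (x ∷ _) = x

    rep-walk : ∀ {u} → X u → Walk X u (rep u)
    rep-walk {u} x with filter (walk? X? u) (allFin n) in eq
    ... | []    = stop x
    ... | y ∷ _ = proj₂ (∈-filter⁻ (walk? X? u) {xs = allFin n} (subst (y ∈ˡ_) (≡sym eq) (here refl)))

    rep-cong : ∀ {u v} → Walk X u v → rep u ≡ rep v
    rep-cong {u} {v} p
      rewrite List.filter-≐ (walk? X? u) (walk? X? v) ((λ q → reverse p ++ʷ q) , (λ q → p ++ʷ q)) (allFin n)
      with filter (walk? X? v) (allFin n) in eq
    ... | []    = ⊥-elim (absurd (subst (v ∈ˡ_) eq (∈-filter⁺ (walk? X? v) (∈-allFin v) (stop (last∈ p)))))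
      where
      absurd : v ∈ˡ [] → ⊥
      absurd ()
    ... | _ ∷ _ = refl

  Clique : List (Fin n) → Set
  Clique = AllPairs (Adj G)

  clique⇒HasClique : ∀ C → Clique C → HasClique G (length C)
  clique⇒HasClique C cl = lookup C , injective cl , adjacent cl
    where
    adjacent : ∀ {C} → Clique C → ∀ i j → i ≢ j → Adj G (lookup C i) (lookup C j)
    adjacent (h ∷ t) fz fz ne = ⊥-elim (ne refl)
    adjacent (h ∷ t) fz (fs j) ne = All.lookup h (∈-lookup j)
    adjacent (h ∷ t) (fs i) fz ne = Graph.sym G (All.lookup h (∈-lookup i))
    adjacent (h ∷ t) (fs i) (fs j) ne = adjacent t i j (λ e → ne (cong fs e))
    injective : ∀ {C} → Clique C → ∀ i j → lookup C i ≡ lookup C j → i ≡ j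
    injective cl i j e with i Fin.≟ j
    ... | yes eq = eq
    ... | no ne  = ⊥-elim (irrefl G (subst (Adj G _) (≡sym e) (adjacent cl i j ne)))

  pairwise⇒clique : ∀ {X : VSet n} → (∀ {u v} → X u → X v → u ≢ v → Adj G u v) →
                    ∀ {L} → Unique L → All X L → Clique L
  pairwise⇒clique f [] [] = []
  pairwise⇒clique f (x∉ ∷ u) (px ∷ al) =
    All.zipWith (λ { (ne , py) → f px py ne }) (x∉ , al) ∷ pairwise⇒clique f u al

  take-clique : ∀ t C → Clique C → t ≤ length C → ∃[ C′ ] (Clique C′ × length C′ ≡ t × (∀ {P} → All P C → All P C′))
  take-clique zero C cl le = [] , [] , refl , λ _ → []
  take-clique (suc t) (x ∷ C) (h ∷ cl) (s≤s le) with take-clique t C cl le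
  ... | C′ , cl′ , eq , f = x ∷ C′ , f h ∷ cl′ , cong suc eq , λ { (p ∷ ps) → p ∷ f ps }

  clique-bound : ∀ {t} → ¬ HasClique G t → ∀ C → Clique C → length C ≤ t
  clique-bound {t} nc C cl with t ≤? length C
  ... | no t≰ = <⇒≤ (≰⇒> t≰)
  ... | yes t≤ with take-clique t C cl t≤
  ...   | C′ , cl′ , refl , _ = ⊥-elim (nc (clique⇒HasClique C′ cl′))

  StableTriple : Fin n → Fin n → Fin n → Set
  StableTriple x y z = (x ≢ y × ¬ Adj G x y) × (x ≢ z × ¬ Adj G x z) × (y ≢ z × ¬ Adj G y z)

  NoTriple : VSet n → Set
  NoTriple X = ∀ x y z → X x → X y → X z → ¬ StableTriple x y z

  -- R(3,t) ≤ t²: the non-neighbours of a vertex form a clique, its neighbours have no (t-1)-clique.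
  ramsey : ∀ t {X} → NoTriple X → (∀ C → Clique C → All X C → length C ≢ t) →
           ∀ L → Unique L → All X L → length L ≤ t * t
  ramsey t nt nc [] u al = z≤n
  ramsey zero nt nc (v ∷ L) u al = ⊥-elim (nc [] [] [] refl)
  ramsey (suc t) {X} nt nc (v ∷ L) (v∉ ∷ u) (xv ∷ al) = s≤s (begin
    length L                                             ≡⟨ split L ⟩
    length (filter (¬? ∘ A?) L) + length (filter A? L)  ≤⟨ +-mono-≤ nonnbrs nbrs ⟩
    t + t * t                                            ≤⟨ +-monoʳ-≤ t (*-monoʳ-≤ t (n≤1+n t)) ⟩
    t + t * suc t                                        ∎)
    where
    open ≤-Reasoning
    A? : Decidable (Adj G v)
    A? = adj? G v
    split : ∀ L → length L ≡ length (filter (¬? ∘ A?) L) + length (filter A? L)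
    split [] = refl
    split (x ∷ L) with A? x
    ... | yes _ = trans (cong suc (split L)) (≡sym (+-suc _ _))
    ... | no  _ = cong suc (split L)
    nbrs : length (filter A? L) ≤ t * t
    nbrs = ramsey t {λ z → X z × Adj G v z} (λ x y z p q r → nt x y z (proj₁ p) (proj₁ q) (proj₁ r))
      (λ C cl al eq → nc (v ∷ C) (All.map proj₂ al ∷ cl) (xv ∷ All.map proj₁ al) (cong suc eq))
      (filter A? L) (Unique.filter⁺ A? u) (All.zip (All.filter⁺ A? al , All.all-filter A? L))
    nonadj : ∀ L → Unique L → All X L → All (v ≢_) L → All (λ z → ¬ Adj G v z) L → Clique L
    nonadj [] u al ne na = []
    nonadj (x ∷ L) (x∉ ∷ u) (px ∷ al) (nx ∷ ne) (ax ∷ na) =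
      All.tabulate (λ {y} m → adjacent y m) ∷ nonadj L u al ne na
      where
      adjacent : ∀ y → y ∈ˡ L → Adj G x y
      adjacent y m with adj? G x y
      ... | yes e = e
      ... | no ¬e = ⊥-elim (nt v x y xv px (All.lookup al m)
              ((nx , ax) , (All.lookup ne m , All.lookup na m) , (All.lookup x∉ m , ¬e)))
    nonnbrs : length (filter (¬? ∘ A?) L) ≤ t
    nonnbrs with suc t ≤? length (filter (¬? ∘ A?) L)
    ... | no ≰ = ≤-pred (≰⇒> ≰)
    ... | yes le with take-clique (suc t) (filter (¬? ∘ A?) L)
                        (nonadj _ (Unique.filter⁺ (¬? ∘ A?) u) (All.filter⁺ (¬? ∘ A?) al)
                          (All.filter⁺ (¬? ∘ A?) v∉) (All.all-filter (¬? ∘ A?) L)) le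
    ...   | C , cl , eq , f = ⊥-elim (nc C cl (f (All.filter⁺ (¬? ∘ A?) al)) eq)

  enumerate : ∀ {t X} → ¬ HasClique G t → Decidable X → NoTriple X →
              ∃[ S ] (length S ≤ t * t × (∀ c → c ∈ˡ S → X c) × (∀ c → X c → c ∈ˡ S))
  enumerate {t} {X} nc X? nt =
    filter X? (allFin n) ,
    ramsey t nt (λ { C cl _ refl → nc (clique⇒HasClique C cl) }) _
      (Unique.filter⁺ X? (Unique.allFin⁺ n)) (All.all-filter X? (allFin n)) ,
    (λ c m → proj₂ (∈-filter⁻ X? {xs = allFin n} m)) , (λ c x → ∈-filter⁺ X? (∈-allFin c) x)

-- Stars

-- A star around a: the classes of lab are connected, pairwise anticomplete, and cover N(a);
-- the vertices of β attach them to each other.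
module Stars {n : ℕ} (G : Graph n) (tpf : ThetaPrismFree G) (a : Fin n)
             (deg2 : ∀ {z u w} → Adj G a z → Adj G z u → Adj G z w → u ≢ a → w ≢ a → u ≡ w)
             (β : VSet n) (β? : Decidable β) (Mark : Fin n → Fin n → Set) where
  open Walks G
  open Finite G

  Labelling : Set
  Labelling = Fin n → Maybe (Fin n)

  Class : Labelling → Fin n → VSet n
  Class lab i u = lab u ≡ just i

  Att : Labelling → Fin n → Fin n → Set
  Att lab q i = ∃[ u ] (Adj G q u × lab u ≡ just i)

  just-unique : ∀ {i j : Fin n} {x} → x ≡ just i → x ≡ just j → i ≡ j
  just-unique p q = Maybe.just-injective (trans (≡sym p) q)

  nothing≢just : ∀ {i : Fin n} {x} → x ≡ nothing → x ≡ just i → ⊥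
  nothing≢just refl ()

  -- `βadj` lets an exit change from one class to another, and `three` provides a class to change
  -- to. `mark` remembers where the neighbours of `a` came from; it survives extensions, which label
  -- no neighbour of `a`.
  record Star : Set where
    field
      lab    : Labelling
      labAdj : ∀ {u v i j} → Adj G u v → lab u ≡ just i → lab v ≡ just j → i ≡ j
      aOut   : lab a ≡ nothing
      aNbr   : ∀ {z} → Adj G a z → ∃[ i ] lab z ≡ just i
      conn   : ∀ {u v i} → lab u ≡ just i → lab v ≡ just i → Walk (Class lab i) u v
      toA    : ∀ {u i} → lab u ≡ just i → ∃[ z ] (lab z ≡ just i × Adj G a z)
      βout   : ∀ {b} → β b → lab b ≡ nothing
      βa     : ∀ {b} → β b → b ≢ a
      βexcl  : ∀ {b i j} → β b → Att lab b i → Att lab b j → i ≡ j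
      βadj   : ∀ {b c i j} → β b → β c → Att lab b i → Att lab c j → i ≢ j → Adj G b c
      βatt   : ∀ {b} → β b → ∃[ i ] Att lab b i
      βcov   : ∀ {u i} → lab u ≡ just i → ∃[ b ] (β b × Att lab b i)
      three  : ∃[ i ] ∃[ j ] ∃[ k ] (i ≢ j × i ≢ k × j ≢ k
                 × (∃[ u ] lab u ≡ just i) × (∃[ u ] lab u ≡ just j) × (∃[ u ] lab u ≡ just k))
      mark   : ∀ {z i} → Adj G a z → lab z ≡ just i → Mark z i

  module StarLemmas (s : Star) where
    open Star s public

    Cls : Fin n → VSet n
    Cls = Class lab

    Out : VSet n
    Out q = lab q ≡ nothing × q ≢ a

    Attached : Fin n → Fin n → Set
    Attached = Att lab

    Excl : VSet n
    Excl q = ∀ i j → Attached q i → Attached q j → i ≡ j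

    -- The last condition ensures that labelling `q` creates no new attachment of a vertex of `β`,
    -- so `βexcl` and `βadj` remain true.
    Extendable : Fin n → Fin n → Set
    Extendable q i = Out q × ¬ β q × Attached q i × Excl q × (∀ b → β b → Adj G q b → Attached b i)

    cls? : ∀ i → Decidable (Cls i)
    cls? i u = Maybe.≡-dec Fin._≟_ (lab u) (just i)

    unlabelled? : Decidable (λ u → lab u ≡ nothing)
    unlabelled? u = Maybe.≡-dec Fin._≟_ (lab u) nothing

    out? : Decidable Out
    out? q = unlabelled? q ×-dec ¬? (q Fin.≟ a)

    att? : ∀ q i → Dec (Attached q i)
    att? q i = Fin.any? λ u → adj? G q u ×-dec cls? i u

    excl? : Decidable Excl
    excl? q = Fin.all? λ i → Fin.all? λ j → att? q i →-dec (att? q j →-dec (i Fin.≟ j))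

    extendable? : ∀ q i → Dec (Extendable q i)
    extendable? q i = out? q ×-dec (¬? (β? q) ×-dec (att? q i ×-dec (excl? q ×-dec
                        Fin.all? λ b → β? b →-dec (adj? G q b →-dec att? b i))))

    βOut : ∀ {b} → β b → Out b
    βOut p = βout p , βa p

    out≁a : ∀ {q} → Out q → ¬ Adj G q a
    out≁a (un , _) e = nothing≢just un (proj₂ (aNbr (Graph.sym G e)))

    cls≢a : ∀ {i z} → Cls i z → z ≢ a
    cls≢a c refl = nothing≢just aOut c

    exitCls : ∀ {c i} → Attached c i → Exit c a (Cls i)
    exitCls (u , cu , l) with toA l
    ... | z , l′ , az = u , z , cu , conn l l′ , Graph.sym G az

    exitVia : ∀ {c u v i X} → Adj G c u → Walk X u v → Attached v i → Exit c a (X ∪ Cls i)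
    exitVia cu p at with exitCls at
    ... | x , z , vx , q , za =
      _ , z , cu , bridge (mapʷ (λ _ → inj₁) p) vx (mapʷ (λ _ → inj₂) q) , za

    Separated : Fin n → Fin n → Set
    Separated x y = x ≢ y × ¬ Adj G x y

    sep-sym : ∀ {x y} → Separated x y → Separated y x
    sep-sym (ne , na) = (λ e → ne (≡sym e)) , λ e → na (Graph.sym G e)

    cls-cls : ∀ {i j x y} → i ≢ j → Cls i x → Cls j y → Separated x y
    cls-cls ne p q = (λ { refl → ne (just-unique p q) }) , λ e → ne (labAdj e p q)

    out-cls : ∀ {i x y} → lab x ≡ nothing → ¬ Attached x i → Cls i y → Separated x y
    out-cls un na c = (λ { refl → nothing≢just un c }) , λ e → na (_ , e , c)

    apartCls : ∀ {i j} → i ≢ j → Apart (Cls i) (Cls j)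
    apartCls ne x y = cls-cls ne

    apart-∪ʳ : ∀ {X Y Z : VSet n} → Apart X Y → Apart X Z → Apart X (Y ∪ Z)
    apart-∪ʳ f g x y p (inj₁ q) = f x y p q
    apart-∪ʳ f g x y p (inj₂ q) = g x y p q

    apart-∪ˡ : ∀ {X Y Z : VSet n} → Apart X Z → Apart Y Z → Apart (X ∪ Y) Z
    apart-∪ˡ f g x y (inj₁ p) q = f x y p q
    apart-∪ˡ f g x y (inj₂ p) q = g x y p q

    apartOut : ∀ {i b} → lab b ≡ nothing → ¬ Attached b i → Apart (_≡ b) (Cls i)
    apartOut un na _ y refl = out-cls un na

    thirdLabel : ∀ i j → ∃[ k ] (k ≢ i × k ≢ j × ∃[ u ] lab u ≡ just k)
    thirdLabel i j with three
    ... | x , y , z , xy , xz , yz , ux , uy , uz with x Fin.≟ i | x Fin.≟ j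
    ... | no xi | no xj = x , xi , xj , ux
    ... | yes refl | yes refl = y , (λ e → xy (≡sym e)) , (λ e → xy (≡sym e)) , uy
    ... | yes refl | no xj with y Fin.≟ j
    ...   | no yj = y , (λ e → xy (≡sym e)) , yj , uy
    ...   | yes refl = z , (λ e → xz (≡sym e)) , (λ e → yz (≡sym e)) , uz
    thirdLabel i j | x , y , z , xy , xz , yz , ux , uy , uz | no xi | yes refl with y Fin.≟ i
    ...   | no yi = y , yi , (λ e → xy (≡sym e)) , uy
    ...   | yes refl = z , (λ e → yz (≡sym e)) , (λ e → xz (≡sym e)) , uz

    attached≤2 : ∀ {q i j k} → Out q → i ≢ j → i ≢ k → j ≢ k →
                 Attached q i → Attached q j → Attached q k → ⊥
    attached≤2 {q} o ij ik jk ai aj ak =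
      proj₁ tpf (theta q a (proj₂ o) (out≁a o) (exitCls ai) (exitCls aj) (exitCls ak)
        (apartCls ij) (apartCls ik) (apartCls jk))

    -- Otherwise b is the centre of a theta through class j, through c, and through q.
    β-spread : ∀ {q b c i j k} → Out q → Excl q → Attached q i → β b → Attached b j →
               β c → Attached c k → i ≢ j → i ≢ k → j ≢ k → Adj G q b → Adj G q c
    β-spread {q} {b} {c} {i} {j} {k} o ex ai βb bj βc ck ij ik jk qb with adj? G q c
    ... | yes e = e
    ... | no ¬e = ⊥-elim (proj₁ tpf (theta b a (βa βb) (out≁a (βOut βb))
          (exitCls bj)
          (exitVia (βadj βb βc bj ck jk) (stop {X = _≡ c} refl) ck)
          (exitVia (Graph.sym G qb) (stop {X = _≡ q} refl) ai)
          (apart-sym (apart-∪ˡ (apartOut (βout βc) (λ at → jk (βexcl βc at ck))) (apartCls (λ e → jk (≡sym e)))))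
          (apart-sym (apart-∪ˡ (apartOut (proj₁ o) (λ at → ij (ex _ _ ai at))) (apartCls ij)))
          (apart-∪ˡ
            (apart-∪ʳ (λ { _ _ refl refl → (λ { refl → ik (ex _ _ ai ck) }) , λ e → ¬e (Graph.sym G e) })
                      (apartOut (βout βc) (λ at → ik (βexcl βc at ck))))
            (apart-sym (apart-∪ˡ (apartOut (proj₁ o) (λ at → ik (ex _ _ ai at))) (apartCls ik))))))

  module Extend (s : Star) (q i : Fin n) (ext : StarLemmas.Extendable s q i) where
    open StarLemmas s

    private
      o : Out q
      o = proj₁ ext
      qi : Attached q i
      qi = proj₁ (proj₂ (proj₂ ext))
      ex : Excl q
      ex = proj₁ (proj₂ (proj₂ (proj₂ ext)))
      only : ∀ b → β b → Adj G q b → Attached b i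
      only = proj₂ (proj₂ (proj₂ (proj₂ ext)))

    lab′ : Labelling
    lab′ u with u Fin.≟ q
    ... | yes _ = just i
    ... | no  _ = lab u

    lab′-q : lab′ q ≡ just i
    lab′-q with q Fin.≟ q
    ... | yes _ = refl
    ... | no ne = ⊥-elim (ne refl)

    lab′-other : ∀ {u} → u ≢ q → lab′ u ≡ lab u
    lab′-other {u} ne with u Fin.≟ q
    ... | yes e = ⊥-elim (ne e)
    ... | no  _ = refl

    lab′-old : ∀ {u} {j} → lab u ≡ just j → lab′ u ≡ just j
    lab′-old {u} l = trans (lab′-other λ e → nothing≢just (proj₁ o) (subst (λ z → lab z ≡ _) e l)) l

    lab′-inv : ∀ u {j} → lab′ u ≡ just j → (u ≡ q × j ≡ i) ⊎ lab u ≡ just j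
    lab′-inv u l with u Fin.≟ q
    ... | yes e = inj₁ (e , ≡sym (Maybe.just-injective l))
    ... | no  _ = inj₂ l

    β-att : ∀ {b j} → β b → Att lab′ b j → Attached b j
    β-att βb (u , e , l) with lab′-inv u l
    ... | inj₂ l′ = u , e , l′
    ... | inj₁ (refl , refl) = only _ βb (Graph.sym G e)

    att-old : ∀ {b j} → Attached b j → Att lab′ b j
    att-old (u , e , l) = u , e , lab′-old {u} l

    lift : ∀ {u v j} → Walk (Cls j) u v → Walk (Class lab′ j) u v
    lift = mapʷ λ u → lab′-old {u}

    used : ∀ {j} → (∃[ u ] lab u ≡ just j) → ∃[ u ] lab′ u ≡ just j
    used (u , l) = u , lab′-old l

    extended : Star
    extended = record
      { lab = lab′ ; labAdj = λ {u} {v} → labAdj′ {u} {v}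
      ; aOut = trans (lab′-other (λ e → proj₂ o (≡sym e))) aOut
      ; aNbr = λ e → let (j , l) = aNbr e in j , lab′-old l
      ; conn = λ {u} {v} → conn′ {u} {v} ; toA = λ {u} → toA′ {u}
      ; βout = λ βb → trans (lab′-other (λ e → proj₁ (proj₂ ext) (subst β e βb))) (βout βb)
      ; βa = βa
      ; βexcl = λ βb p r → βexcl βb (β-att βb p) (β-att βb r)
      ; βadj = λ βb βc p r → βadj βb βc (β-att βb p) (β-att βc r)
      ; βatt = λ βb → let (j , at) = βatt βb in j , att-old at
      ; βcov = λ {u} → βcov′ {u}
      ; three = let (x , y , z , xy , xz , yz , ux , uy , uz) = three
                in x , y , z , xy , xz , yz , used ux , used uy , used uz
      ; mark = λ {z} → mark′ {z} }
      where
      labAdj′ : ∀ {u v j k} → Adj G u v → lab′ u ≡ just j → lab′ v ≡ just k → j ≡ k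
      labAdj′ {u} {v} e p r with lab′-inv u p | lab′-inv v r
      ... | inj₂ p′ | inj₂ r′ = labAdj e p′ r′
      ... | inj₁ (refl , refl) | inj₁ (refl , refl) = refl
      ... | inj₁ (refl , refl) | inj₂ r′ = ex _ _ qi (_ , e , r′)
      ... | inj₂ p′ | inj₁ (refl , refl) = ex _ _ (_ , Graph.sym G e , p′) qi
      conn′ : ∀ {u v j} → lab′ u ≡ just j → lab′ v ≡ just j → Walk (Class lab′ j) u v
      conn′ {u} {v} p r with lab′-inv u p | lab′-inv v r
      ... | inj₂ p′ | inj₂ r′ = lift (conn p′ r′)
      ... | inj₁ (refl , refl) | inj₁ (refl , refl) = stop p
      ... | inj₁ (refl , refl) | inj₂ r′ = let (x , e , l) = qi in p ∷⟨ e ⟩ lift (conn l r′)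
      ... | inj₂ p′ | inj₁ (refl , refl) = let (x , e , l) = qi in
        bridge (lift (conn p′ l)) (Graph.sym G e) (stop r)
      toA′ : ∀ {u j} → lab′ u ≡ just j → ∃[ z ] (lab′ z ≡ just j × Adj G a z)
      toA′ {u} p with lab′-inv u p
      ... | inj₂ p′ = let (z , l , e) = toA p′ in z , lab′-old l , e
      ... | inj₁ (refl , refl) = let (x , _ , l) = qi ; (z , l′ , e) = toA l in z , lab′-old l′ , e
      βcov′ : ∀ {u j} → lab′ u ≡ just j → ∃[ b ] (β b × Att lab′ b j)
      βcov′ {u} p with lab′-inv u p
      ... | inj₂ p′ = let (b , βb , at) = βcov p′ in b , βb , att-old at
      ... | inj₁ (refl , refl) =
        let (x , _ , l) = qi ; (b , βb , at) = βcov l in b , βb , att-old at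
      mark′ : ∀ {z j} → Adj G a z → lab′ z ≡ just j → Mark z j
      mark′ {z} e p with lab′-inv z p
      ... | inj₂ p′ = mark e p′
      ... | inj₁ (refl , refl) = ⊥-elim (out≁a o (Graph.sym G e))

    shrinks : count (StarLemmas.unlabelled? extended) < count unlabelled?
    shrinks = filter-length-strict (StarLemmas.unlabelled? extended) unlabelled?
      (λ u → sub u) (allFin n) (∈-allFin q) (proj₁ o) (λ e → nothing≢just e lab′-q)
      where
      sub : ∀ u → lab′ u ≡ nothing → lab u ≡ nothing
      sub u e with u Fin.≟ q
      ... | no _ = e

  Maximal : Star → Set
  Maximal s = ∀ q i → ¬ StarLemmas.Extendable s q i

  maximal : Star → ∃[ s ] Maximal s
  maximal s = go s (<-wellFounded _)
    where
    go : ∀ s → Acc _<_ (count (StarLemmas.unlabelled? s)) → ∃[ s′ ] Maximal s′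
    go s (acc rec) with Fin.any? (λ q → Fin.any? λ i → StarLemmas.extendable? s q i)
    ... | yes (q , i , ext) = go (Extend.extended s q i ext) (rec (Extend.shrinks s q i ext))
    ... | no ¬ext = s , λ q i ext → ¬ext (q , i , ext)

  module MaxLemmas (s : Star) (max : Maximal s) where
    open StarLemmas s public

    usedBy : ∀ {q i} → Attached q i → ∃[ u ] lab u ≡ just i
    usedBy (u , _ , l) = u , l

    -- Since `q` cannot be added to class `i`, it has a neighbour `c` in `β` that is not attached to
    -- `i`. From `c`, `β-spread` carries the adjacency to `b`; if `c` and `b` are attached to the
    -- same class, this takes two steps, through a third class. A `q` in `β` is covered by `βadj`.
    excl-β : ∀ {q b i j} → Out q → Excl q → Attached q i → β b → Attached b j → i ≢ j → Adj G q b
    excl-β {q} {b} {i} {j} o ex qi βb bj ij with β? q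
    ... | yes βq = βadj βq βb qi bj ij
    ... | no ¬βq with Fin.any? (λ c → β? c ×-dec (adj? G q c ×-dec ¬? (att? c i)))
    ...   | no none = ⊥-elim (max q i (o , ¬βq , qi , ex , all-i))
      where
      all-i : ∀ c → β c → Adj G q c → Attached c i
      all-i c βc e with att? c i
      ... | yes at = at
      ... | no ¬at = ⊥-elim (none (c , βc , e , ¬at))
    ...   | yes (c , βc , qc , ¬ci) with βatt βc
    ...     | k , ck with j Fin.≟ k
    ...       | no jk = β-spread o ex qi βc ck βb bj (λ { refl → ¬ci ck }) ij (λ e → jk (≡sym e)) qc
    ...       | yes refl with thirdLabel i j
    ...         | m , mi , mj , _ , um with βcov um
    ...           | d , βd , dm =
      β-spread o ex qi βd dm βb bj (λ e → mi (≡sym e)) ij mj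
        (β-spread o ex qi βc ck βd dm ij (λ e → mi (≡sym e)) (λ e → mj (≡sym e)) qc)

    -- By `excl-β` both are adjacent to a vertex `b` of `β` attached to a third class. If `p` and
    -- `q` were non-adjacent, `b` would be the centre of a theta through that class, through `p` and
    -- through `q`.
    excl-excl : ∀ {p q i j} → Out p → Excl p → Attached p i → Out q → Excl q → Attached q j →
                i ≢ j → Adj G p q
    excl-excl {p} {q} {i} {j} op ep pi oq eq qj ij with adj? G p q
    ... | yes e = e
    ... | no ¬e with thirdLabel i j
    ...   | k , ki , kj , _ , uk with βcov uk
    ...     | b , βb , bk =
      ⊥-elim (proj₁ tpf (theta b a (βa βb) (out≁a (βOut βb))
        (exitCls bk)
        (exitVia (Graph.sym G (excl-β op ep pi βb bk (λ e → ki (≡sym e)))) (stop {X = _≡ p} refl) pi)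
        (exitVia (Graph.sym G (excl-β oq eq qj βb bk (λ e → kj (≡sym e)))) (stop {X = _≡ q} refl) qj)
        (apart-sym (apart-∪ˡ (apartOut (proj₁ op) (λ at → ki (ep _ _ at pi))) (apartCls (λ e → ki (≡sym e)))))
        (apart-sym (apart-∪ˡ (apartOut (proj₁ oq) (λ at → kj (eq _ _ at qj))) (apartCls (λ e → kj (≡sym e)))))
        (apart-∪ˡ
          (apart-∪ʳ (λ { _ _ refl refl → (λ { refl → ij (ep _ _ pi qj) }) , ¬e })
                    (apartOut (proj₁ op) (λ at → ij (ep _ _ pi at))))
          (apart-sym (apart-∪ˡ (apartOut (proj₁ oq) (λ at → ij (eq _ _ at qj)))
                               (apartCls (λ e → ij (≡sym e))))))))

-- Vertices attached to two classes

module Jewels {n : ℕ} (G : Graph n) (tpf : ThetaPrismFree G) (a : Fin n)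
              (deg2 : ∀ {z u w} → Adj G a z → Adj G z u → Adj G z w → u ≢ a → w ≢ a → u ≡ w)
              (β : VSet n) (β? : Decidable β) (Mark : Fin n → Fin n → Set)
              (s : Stars.Star G tpf a deg2 β β? Mark) where
  open Walks G
  open IPath
  open Finite G
  open Stars G tpf a deg2 β β? Mark
  open StarLemmas s

  -- Without N(a), paths through a class are anticomplete to `a`, which will lie on another path of
  -- the same prism.
  In : Fin n → VSet n
  In i z = Cls i z × ¬ Adj G a z

  Spine : Fin n → Fin n → Set
  Spine b i = IPath (λ z → z ≡ b ⊎ z ≡ a ⊎ Cls i z) b a

  spine : ∀ {b i} → Attached b i → Spine b i
  spine (u , bu , l) with toA l
  ... | z , l′ , az = induce (inj₁ refl ∷⟨ bu ⟩
          bridge (mapʷ (λ _ c → inj₂ (inj₂ c)) (conn l l′)) (Graph.sym G az) (stop (inj₂ (inj₁ refl))))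

  -- The interior of an induced path avoids N(a), whose vertices have degree two.
  connIn : ∀ {p q i} → Out p → Out q → Attached p i → Attached q i →
           IPath (λ z → z ≡ p ⊎ z ≡ q ⊎ In i z) p q
  connIn {p} {q} {i} op oq (u , pu , lu) (v , qv , lv) = record
    { r = r P ; w = w P ; start = start P ; end = end P ; inside = inside′
    ; next = next P ; far = far P }
    where
    P : IPath (λ z → z ≡ p ⊎ z ≡ q ⊎ Cls i z) p q
    P = induce (inj₁ refl ∷⟨ pu ⟩ bridge (mapʷ (λ _ c → inj₂ (inj₂ c)) (conn lu lv))
                                         (Graph.sym G qv) (stop (inj₂ (inj₁ refl))))
    ≢a : ∀ k → k ≤ r P → w P k ≢ a
    ≢a k le with inside P k le
    ... | inj₁ e        = λ e′ → proj₂ op (trans (≡sym e) e′)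
    ... | inj₂ (inj₁ e) = λ e′ → proj₂ oq (trans (≡sym e) e′)
    ... | inj₂ (inj₂ c) = cls≢a c
    inside′ : ∀ k → k ≤ r P → w P k ≡ p ⊎ w P k ≡ q ⊎ In i (w P k)
    inside′ zero    le = inj₁ (start P)
    inside′ (suc k) le with m≤n⇒m<n∨m≡n le
    ... | inj₂ e  = inj₂ (inj₁ (trans (cong (w P) e) (end P)))
    ... | inj₁ lt with inside P (suc k) le
    ...   | inj₁ e        = inj₁ e
    ...   | inj₂ (inj₁ e) = inj₂ (inj₁ e)
    ...   | inj₂ (inj₂ c) = inj₂ (inj₂ (c , λ az →
              proj₁ (far P k (suc (suc k)) (s≤s (n≤1+n k)) lt)
                (deg2 az (Graph.sym G (next P k le)) (next P (suc k) lt)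
                      (≢a k (<⇒≤ le)) (≢a (suc (suc k)) lt))))

  -- An edge from `p` to `b` would give a third exit from `p`, through class `k`, beside those
  -- through `i` and `j`.
  jewel-β : ∀ {p b i j k} → Out p → Attached p i → Attached p j → i ≢ j →
            β b → Attached b k → i ≢ k → j ≢ k → Separated p b
  jewel-β {p} {b} {i} {j} {k} op pi pj ij βb bk ik jk =
    (λ { refl → ij (βexcl βb pi pj) }) , λ pb →
      proj₁ tpf (theta p a (proj₂ op) (out≁a op) (exitCls pi) (exitCls pj)
        (exitVia pb (stop {X = _≡ b} refl) bk)
        (apartCls ij)
        (apart-sym (apart-∪ˡ (apartOut (βout βb) (λ at → ik (βexcl βb at bk))) (apartCls (λ e → ik (≡sym e)))))
        (apart-sym (apart-∪ˡ (apartOut (βout βb) (λ at → jk (βexcl βb at bk))) (apartCls (λ e → jk (≡sym e))))))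

  module SpineLemmas {b i} (βb : β b) (bi : Attached b i) (P : Spine b i) where

    long : 2 ≤ r P
    long = go (r P) refl
      where
      go : ∀ m → r P ≡ m → 2 ≤ m
      go 0 eq = ⊥-elim (βa βb (trans (≡sym (start P)) (trans (cong (w P) (≡sym eq)) (end P))))
      go 1 eq = ⊥-elim (out≁a (βOut βb) (subst₂ (Adj G) (start P) (trans (cong (w P) (≡sym eq)) (end P))
                                  (next P 0 (subst (0 <_) (≡sym eq) (s≤s z≤n)))))
      go (suc (suc m)) eq = s≤s (s≤s z≤n)

    spineCls : ∀ {m} → 0 < m → m < r P → Cls i (w P m)
    spineCls {m} 0<m m<r with inside P m (<⇒≤ m<r)
    ... | inj₁ e        = ⊥-elim (proj₁ (far P 0 m 0<m (<⇒≤ m<r)) (trans (start P) (≡sym e)))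
    ... | inj₂ (inj₁ e) = ⊥-elim (proj₁ (far P m (r P) m<r ≤-refl) (trans e (≡sym (end P))))
    ... | inj₂ (inj₂ c) = c

    spine≢a : ∀ {m} → m < r P → w P m ≢ a
    spine≢a {m} m<r e = proj₁ (far P m (r P) m<r ≤-refl) (trans e (≡sym (end P)))

    spine-cls : ∀ {m l z} → m < r P → i ≢ l → Cls l z → Separated (w P m) z
    spine-cls {zero} {l} {z} m<r il c =
      subst (λ u → Separated u z) (≡sym (start P)) (out-cls (βout βb) (λ at → il (βexcl βb bi at)) c)
    spine-cls {suc m} m<r il c = cls-cls il (spineCls (s≤s z≤n) m<r) c

    spine-β : ∀ {m l c} → 0 < m → m < r P → i ≢ l → β c → Attached c l → Separated (w P m) c
    spine-β 0<m m<r il βc cl =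
      sep-sym (out-cls (βout βc) (λ at → il (βexcl βc at cl)) (spineCls 0<m m<r))

    spine-spine : ∀ {m l} → suc m < l → l ≤ r P → Separated (w P m) (w P l)
    spine-spine {m} {l} lt le = let (ne , f) = far P m l (<-trans (n<1+n m) lt) le
                                in ne , λ e → <-irrefl (≡sym (f e)) lt

  -- W leads from p through class i to a vertex y, the only one of W with neighbours on the spine;
  -- these are the first two vertices of the spine.
  record Hook {b i} (P : Spine b i) (p : Fin n) : Set₁ where
    field
      y     : Fin n
      W     : VSet n
      walk  : Walk W p y
      within : ∀ {z} → W z → z ≡ p ⊎ In i z
      touch : ∀ {z l} → W z → l < r P → Adj G z (w P l) → z ≡ y × (l ≡ 0 ⊎ l ≡ 1)
      off   : ∀ {z l} → W z → l < r P → z ≢ w P l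
      y0    : Adj G y (w P 0)
      y1    : Adj G y (w P 1)

  module _ {i j k b₁ b₂ b₃ p} (ij : i ≢ j) (ik : i ≢ k) (jk : j ≢ k)
           (β₁ : β b₁) (b₁i : Attached b₁ i) (β₂ : β b₂) (b₂j : Attached b₂ j)
           (β₃ : β b₃) (b₃k : Attached b₃ k)
           (op : Out p) (pi : Attached p i) (pj : Attached p j) (P : Spine b₁ i) where
    open SpineLemmas β₁ b₁i P

    private
      pb₃ : Separated p b₃
      pb₃ = jewel-β op pi pj ij β₃ b₃k ik jk

      p≢b₁ : p ≢ b₁
      p≢b₁ refl = ij (βexcl β₁ pi pj)

      Π : IPath (λ z → z ≡ p ⊎ z ≡ b₁ ⊎ In i z) p b₁
      Π = connIn op (βOut β₁) pi b₁i

      Touches : ℕ → Set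
      Touches m = ∃[ l ] (l < r P × Adj G (w Π m) (w P l))

    -- The path `Π` is cut at its first vertex `y` with a neighbour on the spine. With `e` and `f`
    -- the least and the greatest index of such a neighbour, the three lemmas of `Ends` leave only
    -- `e` = 0 and `f` = 1.
    module AtFirst (Π : IPath (λ z → z ≡ p ⊎ z ≡ b₁ ⊎ In i z) p b₁) (t : ℕ) (t<s : t < r Π)
                   (least : ∀ m → m < t → ¬ (∃[ l ] (l < r P × Adj G (w Π m) (w P l)))) where
      y : Fin n
      y = w Π t

      W : VSet n
      W z = ∃[ m ] (0 ≤ m × m ≤ t × z ≡ w Π m)

      walkW : Walk W p y
      walkW = subst (λ z → Walk W z y) (start Π) (between Π 0 t z≤n (<⇒≤ t<s))

      within : ∀ {z} → W z → z ≡ p ⊎ In i z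
      within (m , _ , m≤t , refl) with inside Π m (≤-trans m≤t (<⇒≤ t<s))
      ... | inj₁ e        = inj₁ e
      ... | inj₂ (inj₁ e) = ⊥-elim (proj₁ (far Π m (r Π) (≤-<-trans m≤t t<s) ≤-refl) (trans e (≡sym (end Π))))
      ... | inj₂ (inj₂ c) = inj₂ c

      onlyY : ∀ {z l} → W z → l < r P → Adj G z (w P l) → z ≡ y
      onlyY (m , _ , m≤t , refl) l<r e with m≤n⇒m<n∨m≡n m≤t
      ... | inj₁ m<t  = ⊥-elim (least m m<t (_ , l<r , e))
      ... | inj₂ refl = refl

      spineNbr : ∀ l → l < r P → ∃[ l′ ] (l′ < r P × Adj G (w P l) (w P l′))
      spineNbr zero    l<r = 1 , long , next P 0 l<r
      spineNbr (suc l) l<r = l , <-trans (n<1+n l) l<r , Graph.sym G (next P l (<-trans (n<1+n l) l<r))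

      -- A vertex before `y` that lies on the spine has a neighbour there, and if `y` lies on the
      -- spine, its predecessor on `Π` has one; both contradict the choice of `y`. If `y` is `p`, it
      -- is neither `b₁` nor labelled.
      off : ∀ {z l} → W z → l < r P → z ≢ w P l
      off {l = l} (m , _ , m≤t , refl) l<r e with m≤n⇒m<n∨m≡n m≤t
      ... | inj₁ m<t = let (l′ , lt , ad) = spineNbr l l<r
                       in least m m<t (l′ , lt , subst (λ u → Adj G u (w P l′)) (≡sym e) ad)
      off {l = zero} (zero , _ , m≤t , refl) l<r e | inj₂ refl =
        p≢b₁ (trans (≡sym (start Π)) (trans e (start P)))
      off {l = suc l} (zero , _ , m≤t , refl) l<r e | inj₂ refl =
        nothing≢just (proj₁ op) (subst (Cls i) (trans (≡sym e) (start Π)) (spineCls (s≤s z≤n) l<r))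
      off {l = l} (suc m , _ , m≤t , refl) l<r e | inj₂ refl =
        least m ≤-refl (l , l<r , subst (Adj G (w Π m)) e (next Π m (<-trans ≤-refl t<s)))

      wa : ∀ {z} → W z → ¬ Adj G z a
      wa wz e with within wz
      ... | inj₁ refl    = out≁a op e
      ... | inj₂ (_ , f) = f (Graph.sym G e)

      w-cls : ∀ {z l u} → i ≢ l → ¬ Attached p l → W z → Cls l u → Separated z u
      w-cls il na wz c with within wz
      ... | inj₁ refl    = out-cls (proj₁ op) na c
      ... | inj₂ (d , _) = cls-cls il d c

      w-k : ∀ {z u} → W z → Cls k u → Separated z u
      w-k = w-cls ik (λ pk → attached≤2 op ij ik jk pi pj pk)

      w-β : ∀ {z l b} → i ≢ l → β b → Attached b l → Separated p b → W z → Separated z b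
      w-β il βb bl pb wz with within wz
      ... | inj₁ refl    = pb
      ... | inj₂ (d , _) = sep-sym (out-cls (βout βb) (λ at → il (βexcl βb at bl)) d)

      w-b₃ : ∀ {z} → W z → Separated z b₃
      w-b₃ = w-β ik β₃ b₃k pb₃

      wy : W y
      wy = t , z≤n , ≤-refl , refl

      ≢a′ : ∀ {z} → W z → z ≢ a
      ≢a′ wz with within wz
      ... | inj₁ refl = proj₂ op
      ... | inj₂ (c , _) = cls≢a c

      b₁b₃ : Adj G (w P 0) b₃
      b₁b₃ = subst (λ u → Adj G u b₃) (≡sym (start P)) (βadj β₁ β₃ b₁i b₃k ik)

      B₃ : VSet n
      B₃ = (_≡ b₃) ∪ Cls k

      Front : ℕ → VSet n
      Front e z = ∃[ m ] (m < e × z ≡ w P m)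

      Back : ℕ → VSet n
      Back f z = ∃[ m ] (f ≤ m × m < r P × z ≡ w P m)

      -- Down the spine to `b₁`, across to `b₃`, and on to `a` through class `k`.
      front-exit : ∀ c e → suc e ≤ r P → Adj G c (w P e) → Exit c a (Front (suc e) ∪ B₃)
      front-exit c e le ce =
        let (x , z , b₃x , q , za) = exitCls b₃k in
        w P e , z , ce ,
        bridge (mapʷ (λ { _ (m , _ , m≤e , refl) → inj₁ (m , s≤s m≤e , refl) })
                     (reverse (between P 0 e z≤n (<⇒≤ le))))
               b₁b₃ (inj₂ (inj₁ refl) ∷⟨ b₃x ⟩ mapʷ (λ _ c → inj₂ (inj₂ c)) q) , za

      lastIndex : ∃[ R ] r P ≡ suc R
      lastIndex with r P | long
      ... | suc R | _ = R , refl

      R : ℕ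
      R = proj₁ lastIndex

      R<r : R < r P
      R<r = subst (R <_) (≡sym (proj₂ lastIndex)) ≤-refl

      R~a : Adj G (w P R) a
      R~a = subst (Adj G (w P R)) (trans (cong (w P) (≡sym (proj₂ lastIndex))) (end P)) (next P R R<r)

      <r⇒≤R : ∀ {m} → m < r P → m ≤ R
      <r⇒≤R lt = ≤-pred (subst (_ <_) (proj₂ lastIndex) lt)

      back-exit : ∀ c f → f < r P → Adj G c (w P f) → Exit c a (Back f)
      back-exit c f f<r cf =
        w P f , w P R , cf ,
        mapʷ (λ { _ (m , a , b , e) → m , a , ≤-<-trans b R<r , e }) (between P f R (<r⇒≤R f<r) (<⇒≤ R<r)) , R~a

      front-back : ∀ {e f} → e < f → Apart (Front e) (Back f)
      front-back e<f _ _ (m , m<e , refl) (l , f≤l , l<r , refl) =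
        spine-spine (<-≤-trans (≤-<-trans m<e e<f) f≤l) (<⇒≤ l<r)

      b₃-back : ∀ {f} → 0 < f → Apart B₃ (Back f)
      b₃-back 0<f _ _ (inj₁ refl) (l , f≤l , l<r , refl) =
        sep-sym (spine-β (<-≤-trans 0<f f≤l) l<r ik β₃ b₃k)
      b₃-back 0<f _ _ (inj₂ c) (l , f≤l , l<r , refl) = sep-sym (spine-cls l<r ik c)

      back-j : ∀ {f} → Apart (Back f) (Cls j)
      back-j _ _ (l , f≤l , l<r , refl) c = spine-cls l<r ij c

      front-j : ∀ {e} → e ≤ r P → Apart (Front e) (Cls j)
      front-j e≤r _ _ (m , m<e , refl) c = spine-cls (<-≤-trans m<e e≤r) ij c

      b₃-j : Apart B₃ (Cls j)
      b₃-j = apart-∪ˡ (apartOut (βout β₃) (λ at → jk (βexcl β₃ at b₃k))) (apartCls (λ e → jk (≡sym e)))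

      b₃-W : ∀ {X} → (∀ {z} → X z → W z) → Apart B₃ X
      b₃-W f _ z (inj₁ refl) x = sep-sym (w-b₃ (f x))
      b₃-W f _ z (inj₂ c)    x = sep-sym (w-k (f x) c)

      module Ends (e f : ℕ) (e≤f : e ≤ f) (f<r : f < r P) (ye : Adj G y (w P e)) (yf : Adj G y (w P f))
                  (below : ∀ l → l < e → ¬ (l < r P × Adj G y (w P l)))
                  (above : ∀ l → f < l → l ≤ r P → ¬ (l < r P × Adj G y (w P l))) where

        e<r : e < r P
        e<r = ≤-<-trans e≤f f<r

        w-front : Apart (Front e) W
        w-front _ z (m , m<e , refl) wz =
          (λ eq → off wz (<-trans m<e e<r) (≡sym eq)) ,
          λ ad → below m m<e (<-trans m<e e<r ,
                   subst (λ u → Adj G u (w P m)) (onlyY wz (<-trans m<e e<r) (Graph.sym G ad)) (Graph.sym G ad))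

        w-back : Apart (Back (suc f)) W
        w-back _ z (m , f<m , m<r , refl) wz =
          (λ eq → off wz m<r (≡sym eq)) ,
          λ ad → above m f<m (<⇒≤ m<r) (m<r ,
                   subst (λ u → Adj G u (w P m)) (onlyY wz m<r (Graph.sym G ad)) (Graph.sym G ad))

        -- Otherwise w e is the centre of a theta.
        not-single : e ≢ f
        not-single refl = proj₁ tpf (theta (w P e) a (spine≢a e<r) c≁a
            (back-exit _ (suc e) e+1<r (next P e e<r))
            (head-exit e e<r refl)
            (exitVia (Graph.sym G ye) (reverse walkW) pj)
            (apart-sym (apart-∪ˡ (front-back ≤-refl) (b₃-back (s≤s z≤n))))
            (apart-∪ʳ w-back back-j)
            (apart-∪ˡ (apart-∪ʳ w-front (front-j (<⇒≤ e<r))) (apart-∪ʳ (b₃-W (λ x → x)) b₃-j)))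
          where
          -- A spine vertex next to `a` has only one other neighbour, its predecessor on the spine,
          -- so it cannot see `y`.
          c≁a : ¬ Adj G (w P e) a
          c≁a ad = go e e<r ad ye refl
            where
            go : ∀ m → m < r P → Adj G (w P m) a → Adj G y (w P m) → m ≡ e → ⊥
            go zero m<r ad ym eq = out≁a (βOut β₁) (subst (λ u → Adj G u a) (start P) ad)
            go (suc m) m<r ad ym eq = off wy (<-trans ≤-refl m<r)
              (deg2 (Graph.sym G ad) (Graph.sym G ym) (Graph.sym G (next P m (<-trans ≤-refl m<r)))
                    (≢a′ wy) (spine≢a (<-trans ≤-refl m<r)))
          e+1<r : suc e < r P
          e+1<r with m≤n⇒m<n∨m≡n e<r
          ... | inj₁ lt = lt
          ... | inj₂ eq = ⊥-elim (c≁a (subst (Adj G (w P e)) (trans (cong (w P) eq) (end P)) (next P e e<r)))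
          head-exit : ∀ m → m < r P → m ≡ e → Exit (w P m) a (Front m ∪ B₃)
          -- Here the centre is `b₁` itself, and no part of the spine lies in front of it.
          head-exit zero m<r eq =
            let (x , z , b₃x , q , za) = exitCls b₃k in
            b₃ , z , b₁b₃ , (inj₂ (inj₁ refl) ∷⟨ b₃x ⟩ mapʷ (λ _ c → inj₂ (inj₂ c)) q) , za
          head-exit (suc m) m<r eq = front-exit _ m (<⇒≤ m<r) (Graph.sym G (next P m (<-trans ≤-refl m<r)))

        W< : VSet n
        W< z = ∃[ m ] (m < t × z ≡ w Π m)

        W<⊆W : ∀ {z} → W< z → W z
        W<⊆W (m , m<t , eq) = m , z≤n , <⇒≤ m<t , eq

        W<-touch : ∀ {z l} → W< z → l < r P → ¬ Adj G z (w P l)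
        W<-touch (m , m<t , refl) l<r ad = least m m<t (_ , l<r , ad)

        p-exit : ∀ m → m ≤ r Π → m ≡ t → Exit (w Π m) a (W< ∪ Cls j)
        p-exit zero le eq =
          let (u , z , pu , q , za) = exitCls pj in
          u , z , subst (λ v → Adj G v u) (≡sym (start Π)) pu , mapʷ (λ _ → inj₂) q , za
        p-exit (suc m) le refl =
          exitVia (Graph.sym G (next Π m le))
            (mapʷ (λ { _ (l , _ , l≤m , eq) → l , s≤s l≤m , eq }) (reverse (between Π 0 m z≤n (<⇒≤ le))))
            (subst (λ v → Attached v j) (≡sym (start Π)) pj)

        -- Otherwise y is the centre of a theta.
        consecutive : f ≤ suc e
        consecutive with f ≤? suc e
        ... | yes le = le
        ... | no  nle = ⊥-elim (proj₁ tpf (theta y a (≢a′ wy) (wa wy)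
            (back-exit y f f<r yf) (front-exit y e e<r ye) (p-exit t (<⇒≤ t<s) refl)
            (apart-sym (apart-∪ˡ (front-back (≰⇒> nle)) (b₃-back (<-≤-trans (s≤s z≤n) (<⇒≤ (≰⇒> nle))))))
            (apart-∪ʳ (λ { _ z (m , _ , m<r , refl) wz → (λ eq → off (W<⊆W wz) m<r (≡sym eq)) ,
                            λ ad → W<-touch wz m<r (Graph.sym G ad) }) back-j)
            (apart-∪ˡ (apart-∪ʳ (λ { _ z (m , m≤e , refl) wz →
                                       (λ eq → off (W<⊆W wz) (<-≤-trans m≤e e<r) (≡sym eq)) ,
                                       λ ad → W<-touch wz (<-≤-trans m≤e e<r) (Graph.sym G ad) })
                                 (front-j e<r))
                      (apart-∪ʳ (b₃-W W<⊆W) b₃-j))))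

        -- Otherwise y, w e, w (suc e) and b₂, b₁, b₃ are the triangles of a prism.
        at-start : f ≡ suc e → e ≡ 0
        at-start refl with m≤n⇒m<n∨m≡n (z≤n {e})
        ... | inj₂ eq  = ≡sym eq
        ... | inj₁ 0<e = ⊥-elim (proj₂ tpf (prism {X = X} {Y = Front (suc e)} {Z = Z}
            walkX walkY walkZ
            (λ eq → y≢b₂ eq)
            (λ eq → proj₁ (far P 0 e 0<e (<⇒≤ e<r)) (trans (start P) (≡sym eq)))
            (λ eq → proj₁ (spine-β (s≤s z≤n) f<r ik β₃ b₃k) eq)
            ye yf (next P e e<r)
            (βadj β₂ β₁ b₂j b₁i (λ e → ij (≡sym e))) (βadj β₂ β₃ b₂j b₃k jk) (βadj β₁ β₃ b₁i b₃k ik)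
            jXY jXZ jYZ))
          where
          Tail : VSet n
          Tail z = z ≡ p ⊎ z ≡ b₂ ⊎ In j z
          X Z : VSet n
          X = W ∪ Tail
          Z z = (∃[ m ] (suc e ≤ m × m ≤ r P × z ≡ w P m)) ⊎ B₃ z
          y≢b₂ : y ≢ b₂
          y≢b₂ eq with within wy
          ... | inj₁ e′ = ij (βexcl β₂ (subst (λ v → Attached v i) (trans (≡sym e′) eq) pi) b₂j)
          ... | inj₂ (c , _) = nothing≢just (βout β₂) (subst (Cls i) eq c)
          walkX : Walk X y b₂
          walkX = mapʷ (λ _ → inj₁) (reverse walkW) ++ʷ
                  mapʷ (λ _ → inj₂) (subst₂ (Walk Tail) (start Q) (end Q) (between′ Q))
            where
            Q : IPath Tail p b₂
            Q = connIn op (βOut β₂) pj b₂j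
            between′ : (Q : IPath Tail p b₂) → Walk Tail (w Q 0) (w Q (r Q))
            between′ Q = mapʷ (λ { _ (m , _ , m≤r , refl) → inside Q m m≤r }) (between Q 0 (r Q) z≤n ≤-refl)
          walkY : Walk (Front (suc e)) (w P e) b₁
          walkY = subst (Walk (Front (suc e)) (w P e)) (start P)
            (mapʷ (λ { _ (m , _ , m≤e , eq) → m , s≤s m≤e , eq }) (reverse (between P 0 e z≤n (<⇒≤ e<r))))
          -- The third path climbs the spine to `a` and descends through class `k`; hence the care
          -- that the first path be anticomplete to `a`.
          walkZ : Walk Z (w P (suc e)) b₃
          walkZ = let (x , z , b₃x , q , za) = exitCls b₃k in
            bridge (subst (Walk Z (w P (suc e))) (end P)
                      (mapʷ (λ _ → inj₁) (between P (suc e) (r P) (<⇒≤ f<r) ≤-refl)))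
                   (Graph.sym G za)
                   (bridge (mapʷ (λ _ c → inj₂ (inj₂ c)) (reverse q)) (Graph.sym G b₃x) (stop (inj₂ (inj₁ refl))))
          none : ∀ {A : Set} {x y} → Separated x y → x ≢ y × (Adj G x y → A)
          none (ne , na) = ne , λ e → ⊥-elim (na e)
          b₂b₁ : ∀ {m} → m ≤ e → w P m ≢ b₂ × (Adj G b₂ (w P m) → m ≡ 0)
          b₂b₁ {zero} le = (λ eq → ij (βexcl β₂ (subst (λ v → Attached v i) (trans (≡sym (start P)) eq) b₁i) b₂j)) ,
                           λ _ → refl
          b₂b₁ {suc m} le = let (ne , na) = spine-β (s≤s z≤n) (≤-<-trans le e<r) ij β₂ b₂j
                            in ne , λ ad → ⊥-elim (na (Graph.sym G ad))
          jXY : Joined X (Front (suc e)) y (w P e) b₂ b₁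
          wXY : ∀ {x} m → W x → m ≤ e → x ≢ w P m × (Adj G x (w P m) → (x ≡ y × w P m ≡ w P e) ⊎ (x ≡ b₂ × w P m ≡ b₁))
          wXY m wx m≤e = off wx m<r , λ ad → let eq = onlyY wx m<r ad in inj₁ (eq , at eq ad)
            where
            m<r = ≤-<-trans m≤e e<r
            at : ∀ {x} → x ≡ y → Adj G x (w P m) → w P m ≡ w P e
            at refl ad = [ (λ lt → ⊥-elim (below m lt (m<r , ad))) , cong (w P) ]′ (m≤n⇒m<n∨m≡n m≤e)
          jXY x _ (inj₁ wx) (m , s≤s m≤e , refl) = wXY m wx m≤e
          jXY x _ (inj₂ (inj₁ refl)) (m , s≤s m≤e , refl) = wXY m (0 , z≤n , z≤n , ≡sym (start Π)) m≤e
          jXY x _ (inj₂ (inj₂ (inj₁ refl))) (m , s≤s m≤e , refl) =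
            let (ne , f) = b₂b₁ m≤e in (λ eq → ne (≡sym eq)) ,
              λ ad → inj₂ (refl , trans (cong (w P) (f ad)) (start P))
          jXY x _ (inj₂ (inj₂ (inj₂ (c , _)))) (m , s≤s m≤e , refl) =
            none (sep-sym (spine-cls (≤-<-trans m≤e e<r) ij c))
          jXZ : Joined X Z y (w P (suc e)) b₂ b₃
          a-sep : ∀ {x} m → W x ⊎ x ≡ b₂ ⊎ In j x → m ≡ r P → Separated x (w P m)
          a-sep {x} m h refl = subst (Separated x) (≡sym (end P)) (x-a h)
            where
            x-a : W x ⊎ x ≡ b₂ ⊎ In j x → Separated x a
            x-a (inj₁ wx) = ≢a′ wx , wa wx
            x-a (inj₂ (inj₁ refl)) = βa β₂ , out≁a (βOut β₂)
            x-a (inj₂ (inj₂ (c , na))) = cls≢a c , λ ad → na (Graph.sym G ad)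
          wXZ : ∀ {x} m → W x → suc e ≤ m → m < r P →
                x ≢ w P m × (Adj G x (w P m) → (x ≡ y × w P m ≡ w P (suc e)) ⊎ (x ≡ b₂ × w P m ≡ b₃))
          wXZ m wx e<m m<r = off wx m<r , λ ad → let eq = onlyY wx m<r ad in inj₁ (eq , at eq ad)
            where
            at : ∀ {x} → x ≡ y → Adj G x (w P m) → w P m ≡ w P (suc e)
            at refl ad = [ (λ lt → ⊥-elim (above m lt (<⇒≤ m<r) (m<r , ad))) , (λ eq → cong (w P) (≡sym eq)) ]′ (m≤n⇒m<n∨m≡n e<m)
          wXB : ∀ {x z} → W x → B₃ z → Separated x z
          wXB wx (inj₁ refl) = w-b₃ wx
          wXB wx (inj₂ c)    = w-k wx c
          -- The vertex `p` lies in both parts of `X` and is counted with `W`.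
          splitX : ∀ {x} → X x → W x ⊎ x ≡ b₂ ⊎ In j x
          splitX (inj₁ wx) = inj₁ wx
          splitX (inj₂ (inj₁ refl)) = inj₁ (0 , z≤n , z≤n , ≡sym (start Π))
          splitX (inj₂ (inj₂ h)) = inj₂ h
          JXZ : Fin n → Fin n → Set
          JXZ x z = x ≢ z × (Adj G x z → (x ≡ y × z ≡ w P (suc e)) ⊎ (x ≡ b₂ × z ≡ b₃))
          spineXZ : ∀ {x} m → W x ⊎ x ≡ b₂ ⊎ In j x → suc e ≤ m → m < r P → JXZ x (w P m)
          spineXZ m (inj₁ wx) e<m m<r = wXZ m wx e<m m<r
          spineXZ m (inj₂ (inj₁ refl)) e<m m<r =
            none (sep-sym (spine-β (≤-<-trans z≤n e<m) m<r ij β₂ b₂j))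
          spineXZ m (inj₂ (inj₂ (c , _))) e<m m<r = none (sep-sym (spine-cls m<r ij c))
          bXZ : ∀ {x z} → W x ⊎ x ≡ b₂ ⊎ In j x → B₃ z → JXZ x z
          bXZ (inj₁ wx) bz = none (wXB wx bz)
          bXZ (inj₂ (inj₁ refl)) (inj₁ refl) =
            (λ eq → jk (βexcl β₂ b₂j (subst (λ v → Attached v k) (≡sym eq) b₃k))) , λ _ → inj₂ (refl , refl)
          bXZ (inj₂ (inj₁ refl)) (inj₂ c) =
            none (out-cls (βout β₂) (λ at → jk (βexcl β₂ b₂j at)) c)
          bXZ (inj₂ (inj₂ (c , _))) bz = none (sep-sym (b₃-j _ _ bz c))
          jXZ x z hx (inj₁ (m , e<m , m≤r , refl)) =
            [ spineXZ m (splitX hx) e<m , (λ eq → none (a-sep m (splitX hx) eq)) ]′ (m≤n⇒m<n∨m≡n m≤r)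
          jXZ x z hx (inj₂ bz) = bXZ (splitX hx) bz
          jYZ : Joined (Front (suc e)) Z (w P e) (w P (suc e)) b₁ b₃
          jYZ _ _ (m , s≤s m≤e , refl) (inj₁ (l , e<l , l≤r , refl)) =
            proj₁ (far P m l (≤-<-trans m≤e e<l) l≤r) , λ ad →
              let eq = proj₂ (far P m l (≤-<-trans m≤e e<l) l≤r) ad
                  me = ≤-antisym m≤e (≤-pred (subst (suc e ≤_) eq e<l))
              in inj₁ (cong (w P) me , cong (w P) (trans eq (cong suc me)))
          jYZ _ _ (zero , s≤s m≤e , refl) (inj₂ (inj₁ refl)) =
            (λ eq → ik (βexcl β₃ (subst (λ v → Attached v i) (trans (≡sym (start P)) eq) b₁i) b₃k)) ,
            λ _ → inj₂ (start P , refl)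
          jYZ _ _ (suc m , s≤s m≤e , refl) (inj₂ (inj₁ refl)) =
            none (spine-β (s≤s z≤n) (≤-<-trans m≤e e<r) ik β₃ b₃k)
          jYZ _ _ (m , s≤s m≤e , refl) (inj₂ (inj₂ c)) = none (spine-cls (≤-<-trans m≤e e<r) ik c)

        hookHere : Hook P p
        hookHere = record
          { y = y ; W = W ; walk = walkW ; within = within
          ; touch = λ {z} {l} wz l<r ad → let eq = onlyY wz l<r ad in eq , index l l<r (subst (λ u → Adj G u (w P l)) eq ad)
          ; off = off
          ; y0 = subst (λ m → Adj G y (w P m)) e≡0 ye ; y1 = subst (λ m → Adj G y (w P m)) f≡1 yf }
          where
          f≡1+e : f ≡ suc e
          f≡1+e = ≤-antisym consecutive (≤∧≢⇒< e≤f not-single)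
          e≡0 : e ≡ 0
          e≡0 = at-start f≡1+e
          f≡1 : f ≡ 1
          f≡1 = trans f≡1+e (cong suc e≡0)
          index : ∀ l → l < r P → Adj G y (w P l) → l ≡ 0 ⊎ l ≡ 1
          index 0 _ _ = inj₁ refl
          index 1 _ _ = inj₂ refl
          index (suc (suc l)) l<r ad =
            ⊥-elim (above (suc (suc l)) (subst (_< suc (suc l)) (≡sym f≡1) (s≤s (s≤s z≤n))) (<⇒≤ l<r) (l<r , ad))

    private
      prev : ∃[ m ] r Π ≡ suc m
      prev with r Π in eq
      ... | zero  = ⊥-elim (p≢b₁ (trans (≡sym (start Π)) (trans (cong (w Π) (≡sym eq)) (end Π))))
      ... | suc m = m , refl
      touching : ∀ m → r Π ≡ suc m → Touches m
      touching m eq = 0 , <-trans (s≤s z≤n) long ,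
        subst (Adj G (w Π m)) (trans (trans (cong (w Π) (≡sym eq)) (end Π)) (≡sym (start P)))
              (next Π m (subst (m <_) (≡sym eq) ≤-refl))

    -- The last vertex of `Π` before `b₁` sees the spine at `b₁`, so a first such vertex exists and
    -- comes before `b₁`.
    hook : Hook P p
    hook with least≤ (λ m → anyUpTo? (λ l → adj? G (w Π m) (w P l)) (r P)) (proj₁ prev) (touching (proj₁ prev) (proj₂ prev))
    ... | t , t≤ , (l₀ , l₀<r , yl₀) , least
      with greatest≤ (λ l → (suc l ≤? r P) ×-dec adj? G (w Π t) (w P l)) (r P) l₀ (<⇒≤ l₀<r) (l₀<r , yl₀)
         | least≤ (λ l → (suc l ≤? r P) ×-dec adj? G (w Π t) (w P l)) l₀ (l₀<r , yl₀)
    ...   | f , l₀≤f , _ , (f<r , yf) , above | e , e≤l₀ , (e<r , ye) , below =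
      AtFirst.Ends.hookHere Π t t<s least e f (≤-trans e≤l₀ l₀≤f) f<r ye yf below above
      where
      t<s : t < r Π
      t<s = subst (t <_) (≡sym (proj₂ prev)) (s≤s t≤)

-- The first summand is for vertices that see one class only. The second allows `t * t` vertices for
-- each ordered pair of the at most `t` classes.
cutBound : ℕ → ℕ
cutBound t = (t * t + t) + t * (t * (t * t))

-- The cut of a maximal star

module Cuts {n : ℕ} (G : Graph n) (tpf : ThetaPrismFree G) (a : Fin n)
            (deg2 : ∀ {z u w} → Adj G a z → Adj G z u → Adj G z w → u ≢ a → w ≢ a → u ≡ w)
            (β : VSet n) (β? : Decidable β) (Mark : Fin n → Fin n → Set)
            (s : Stars.Star G tpf a deg2 β β? Mark)
            (max : Stars.Maximal G tpf a deg2 β β? Mark s) where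
  open Walks G
  open IPath
  open Finite G
  open Stars G tpf a deg2 β β? Mark
  open MaxLemmas s max
  open Jewels G tpf a deg2 β β? Mark s

  -- Facts about one hook relative to its own spine and to the spine in the other class; `twoHooks`
  -- uses them twice, with the classes exchanged.
  module Half {b i p} (βb : β b) (bi : Attached b i) (P : Spine b i) (op : Out p) (h : Hook P p) where
    open SpineLemmas βb bi P
    open Hook h public

    Wp : W p
    Wp = head∈ walk

    0<r : 0 < r P
    0<r = <-trans (s≤s z≤n) long

    own-b : ∀ {x} → W x → x ≢ b × (Adj G x b → x ≡ y)
    own-b wx = (λ e → off wx 0<r (trans e (≡sym (start P)))) ,
               λ ad → proj₁ (touch wx 0<r (subst (Adj G _) (≡sym (start P)) ad))

    W≁a : ∀ {x} → W x → Separated x a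
    W≁a wx = [ (λ { refl → proj₂ op , out≁a op }) ,
               (λ { (c , na) → cls≢a c , λ ad → na (Graph.sym G ad) }) ]′ (within wx)

    own-spine : ∀ {x} m → W x → 1 ≤ m → m ≤ r P → x ≢ w P m × (Adj G x (w P m) → x ≡ y × w P m ≡ w P 1)
    own-spine {x} m wx 1≤m m≤r = [ inner , atEnd ]′ (m≤n⇒m<n∨m≡n m≤r)
      where
      Goal : Set
      Goal = x ≢ w P m × (Adj G x (w P m) → x ≡ y × w P m ≡ w P 1)
      inner : m < r P → Goal
      inner m<r = off wx m<r , λ ad → let (e , h) = touch wx m<r ad in
        e , [ (λ { refl → ⊥-elim (<⇒≱ 1≤m z≤n) }) , cong (w P) ]′ h
      atEnd : m ≡ r P → Goal
      atEnd refl = let (ne , na) = subst (Separated x) (≡sym (end P)) (W≁a wx) in ne , λ ad → ⊥-elim (na ad)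

    other-b : ∀ {x c l} → W x → β c → Attached c l → i ≢ l → x ≡ p ⊎ Separated x c
    other-b wx βc cl il = [ inj₁ , (λ { (d , _) → inj₂ (sep-sym
      (out-cls (βout βc) (λ at → il (βexcl βc at cl)) d)) }) ]′ (within wx)

    b-spine : ∀ m → 1 ≤ m → m ≤ r P → b ≢ w P m × (Adj G b (w P m) → w P m ≡ w P 1)
    b-spine m 1≤m m≤r = let (ne , f) = far P 0 m 1≤m m≤r in
      (λ e → ne (trans (start P) e)) , λ ad → cong (w P) (f (subst (λ u → Adj G u (w P m)) (≡sym (start P)) ad))

    other-spine : ∀ {l c} (βc : β c) (cl : Attached c l) (Q : Spine c l) → i ≢ l →
                  ∀ {x} m → W x → 1 ≤ m → m ≤ r Q → x ≡ p ⊎ Separated x (w Q m)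
    other-spine βc cl Q il {x} m wx 1≤m m≤r = [ inner , atEnd ]′ (m≤n⇒m<n∨m≡n m≤r)
      where
      inner : m < r Q → x ≡ p ⊎ Separated x (w Q m)
      inner m<r = [ inj₁ , (λ { (d , _) → inj₂ (cls-cls il d (SpineLemmas.spineCls βc cl Q 1≤m m<r)) }) ]′ (within wx)
      atEnd : m ≡ r Q → x ≡ p ⊎ Separated x (w Q m)
      atEnd refl = inj₂ (subst (Separated x) (≡sym (end Q)) (W≁a wx))

    b-other-spine : ∀ {l c} (βc : β c) (cl : Attached c l) (Q : Spine c l) → i ≢ l →
                    ∀ m → 1 ≤ m → m ≤ r Q → Separated b (w Q m)
    b-other-spine βc cl Q il m 1≤m m≤r = [ inner , atEnd ]′ (m≤n⇒m<n∨m≡n m≤r)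
      where
      inner : m < r Q → Separated b (w Q m)
      inner m<r = out-cls (βout βb) (λ at → il (βexcl βb bi at)) (SpineLemmas.spineCls βc cl Q 1≤m m<r)
      atEnd : m ≡ r Q → Separated b (w Q m)
      atEnd refl = subst (Separated b) (≡sym (end Q)) (βa βb , out≁a (βOut βb))

    y1′ : Adj G y (w P 1)
    y1′ = y1

    yb : Adj G y b
    yb = subst (Adj G y) (start P) y0

    b1 : Adj G b (w P 1)
    b1 = subst (λ u → Adj G u (w P 1)) (start P) (next P 0 0<r)

    Tail : VSet n
    Tail z = ∃[ m ] (1 ≤ m × m ≤ r P × z ≡ w P m)

    tailWalk : Walk Tail (w P 1) a
    tailWalk = subst (Walk Tail (w P 1)) (end P) (between P 1 (r P) (<⇒≤ long) ≤-refl)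

  module _ {i j k b₁ b₂ b₃ p} (ij : i ≢ j) (ik : i ≢ k) (jk : j ≢ k)
           (β₁ : β b₁) (b₁i : Attached b₁ i) (β₂ : β b₂) (b₂j : Attached b₂ j)
           (β₃ : β b₃) (b₃k : Attached b₃ k)
           (op : Out p) (pi : Attached p i) (pj : Attached p j) (P : Spine b₁ i) (Q : Spine b₂ j) where

    private
      h₁ : Hook P p
      h₁ = hook ij ik jk β₁ b₁i β₂ b₂j β₃ b₃k op pi pj P
      h₂ : Hook Q p
      h₂ = hook (λ e → ij (≡sym e)) jk ik β₂ b₂j β₁ b₁i β₃ b₃k op pj pi Q

    -- The triangles y b c at the ends of the two hooks would be joined by a prism.
    twoHooks : (h₁ : Hook P p) (h₂ : Hook Q p) → Hook.y h₁ ≢ Hook.y h₂ → ⊥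
    twoHooks h₁ h₂ y₁≢y₂ = proj₂ tpf (prism {X = H₁.W ∪ H₂.W} {Y = λ z → z ≡ b₁ ⊎ z ≡ b₂} {Z = H₁.Tail ∪ H₂.Tail}
      (mapʷ (λ _ → inj₁) (reverse H₁.walk) ++ʷ mapʷ (λ _ → inj₂) H₂.walk)
      (inj₁ refl ∷⟨ βadj β₁ β₂ b₁i b₂j ij ⟩ stop (inj₂ refl))
      -- This path runs from one spine to the other through `a`.
      (mapʷ (λ _ → inj₁) H₁.tailWalk ++ʷ mapʷ (λ _ → inj₂) (reverse H₂.tailWalk))
      y₁≢y₂
      (λ e → ij (βexcl β₂ (subst (λ v → Attached v i) e b₁i) b₂j))
      (proj₁ (cls-cls ij (SpineLemmas.spineCls β₁ b₁i P (s≤s z≤n) (SpineLemmas.long β₁ b₁i P))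
                         (SpineLemmas.spineCls β₂ b₂j Q (s≤s z≤n) (SpineLemmas.long β₂ b₂j Q))))
      H₁.yb H₁.y1′ H₁.b1 H₂.yb H₂.y1′ H₂.b1
      jXY jXZ jYZ)
      where
      module H₁ = Half β₁ b₁i P op h₁
      module H₂ = Half β₂ b₂j Q op h₂
      ji : j ≢ i
      ji e = ij (≡sym e)
      jXY : Joined (H₁.W ∪ H₂.W) (λ z → z ≡ b₁ ⊎ z ≡ b₂) H₁.y b₁ H₂.y b₂
      XY : Fin n → Fin n → Set
      XY x z = x ≢ z × (Adj G x z → (x ≡ H₁.y × z ≡ b₁) ⊎ (x ≡ H₂.y × z ≡ b₂))
      own₁ : ∀ {x} → H₁.W x → XY x b₁
      own₁ wx = let (ne , f) = H₁.own-b wx in ne , λ ad → inj₁ (f ad , refl)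
      own₂ : ∀ {x} → H₂.W x → XY x b₂
      own₂ wx = let (ne , f) = H₂.own-b wx in ne , λ ad → inj₂ (f ad , refl)
      none : ∀ {A : Set} {x y} → Separated x y → x ≢ y × (Adj G x y → A)
      none (ne , na) = ne , λ e → ⊥-elim (na e)
      jXY x _ (inj₁ wx) (inj₁ refl) = own₁ wx
      jXY x _ (inj₁ wx) (inj₂ refl) = [ (λ { refl → own₂ H₂.Wp }) , none ]′ (H₁.other-b wx β₂ b₂j ij)
      jXY x _ (inj₂ wx) (inj₁ refl) = [ (λ { refl → own₁ H₁.Wp }) , none ]′ (H₂.other-b wx β₁ b₁i ji)
      jXY x _ (inj₂ wx) (inj₂ refl) = own₂ wx
      jXZ : Joined (H₁.W ∪ H₂.W) (H₁.Tail ∪ H₂.Tail) H₁.y (w P 1) H₂.y (w Q 1)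
      XZ : Fin n → Fin n → Set
      XZ x z = x ≢ z × (Adj G x z → (x ≡ H₁.y × z ≡ w P 1) ⊎ (x ≡ H₂.y × z ≡ w Q 1))
      spine₁ : ∀ {x} m → H₁.W x → 1 ≤ m → m ≤ r P → XZ x (w P m)
      spine₁ m wx a b = let (ne , f) = H₁.own-spine m wx a b in ne , λ ad → inj₁ (f ad)
      spine₂ : ∀ {x} m → H₂.W x → 1 ≤ m → m ≤ r Q → XZ x (w Q m)
      spine₂ m wx a b = let (ne , f) = H₂.own-spine m wx a b in ne , λ ad → inj₂ (f ad)
      jXZ x _ (inj₁ wx) (inj₁ (m , 1≤m , m≤r , refl)) = spine₁ m wx 1≤m m≤r
      jXZ x _ (inj₁ wx) (inj₂ (m , 1≤m , m≤r , refl)) =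
        [ (λ { refl → spine₂ m H₂.Wp 1≤m m≤r }) , none ]′ (H₁.other-spine β₂ b₂j Q ij m wx 1≤m m≤r)
      jXZ x _ (inj₂ wx) (inj₁ (m , 1≤m , m≤r , refl)) =
        [ (λ { refl → spine₁ m H₁.Wp 1≤m m≤r }) , none ]′ (H₂.other-spine β₁ b₁i P ji m wx 1≤m m≤r)
      jXZ x _ (inj₂ wx) (inj₂ (m , 1≤m , m≤r , refl)) = spine₂ m wx 1≤m m≤r
      jYZ : Joined (λ z → z ≡ b₁ ⊎ z ≡ b₂) (H₁.Tail ∪ H₂.Tail) b₁ (w P 1) b₂ (w Q 1)
      jYZ _ _ (inj₁ refl) (inj₁ (m , 1≤m , m≤r , refl)) =
        let (ne , f) = H₁.b-spine m 1≤m m≤r in ne , λ ad → inj₁ (refl , f ad)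
      jYZ _ _ (inj₁ refl) (inj₂ (m , 1≤m , m≤r , refl)) = none (H₁.b-other-spine β₂ b₂j Q ij m 1≤m m≤r)
      jYZ _ _ (inj₂ refl) (inj₁ (m , 1≤m , m≤r , refl)) = none (H₂.b-other-spine β₁ b₁i P ji m 1≤m m≤r)
      jYZ _ _ (inj₂ refl) (inj₂ (m , 1≤m , m≤r , refl)) =
        let (ne , f) = H₂.b-spine m 1≤m m≤r in ne , λ ad → inj₂ (refl , f ad)

    -- The two hooks end in the same vertex by `twoHooks`. One of them stays in class `i` and the
    -- other in class `j`, apart from `p`; so this vertex is `p`.
    jewel-adj : Adj G p b₁ × Adj G p (w P 1) × Adj G p (w Q 1)
    jewel-adj = go (H₁.y Fin.≟ H₂.y)
      where
      module H₁ = Half β₁ b₁i P op h₁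
      module H₂ = Half β₂ b₂j Q op h₂
      go : Dec (H₁.y ≡ H₂.y) → Adj G p b₁ × Adj G p (w P 1) × Adj G p (w Q 1)
      go (no ne) = ⊥-elim (twoHooks h₁ h₂ ne)
      go (yes e) = subst (λ v → Adj G v b₁) y₁≡p H₁.yb , subst (λ v → Adj G v (w P 1)) y₁≡p H₁.y1′ ,
                   subst (λ v → Adj G v (w Q 1)) (trans (≡sym e) y₁≡p) H₂.y1′
        where
        y₁≡p : H₁.y ≡ p
        y₁≡p = [ (λ eq → eq) , (λ { (c , _) → [ (λ eq → trans e eq) ,
                 (λ { (d , _) → ⊥-elim (ij (just-unique c (subst (λ v → lab v ≡ just j) (≡sym e) d))) }) ]′
                 (H₂.within (last∈ H₂.walk)) }) ]′ (H₁.within (last∈ H₁.walk))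

  -- Defined through the classes of the star, not through pyramids as in `Jζ`.
  IsJewel : Fin n → Fin n → VSet n
  IsJewel i j p = Out p × Attached p i × Attached p j

  isJewel? : ∀ i j → Decidable (IsJewel i j)
  isJewel? i j p = out? p ×-dec (att? p i ×-dec att? p j)

  module _ {i j} (ij : i ≢ j) (ui : ∃[ u ] lab u ≡ just i) (uj : ∃[ u ] lab u ≡ just j) where

    -- The spines depend on the two classes only, so the same three neighbours serve every `p`.
    -- Three stable jewels would therefore form a K₂,₃ with `c` and `d`.
    jewels-common : ∃[ b ] ∃[ c ] ∃[ d ] (β b × Separated c d
                      × (∀ p → IsJewel i j p → Adj G p b × Adj G p c × Adj G p d))
    jewels-common =
      let (k , ki , kj , _ , uk) = thirdLabel i j
          (b₁ , β₁ , b₁i) = βcov (proj₂ ui)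
          (b₂ , β₂ , b₂j) = βcov (proj₂ uj)
          (b₃ , β₃ , b₃k) = βcov uk
          P = spine b₁i
          Q = spine b₂j
      in b₁ , w P 1 , w Q 1 , β₁ ,
         cls-cls ij (SpineLemmas.spineCls β₁ b₁i P (s≤s z≤n) (SpineLemmas.long β₁ b₁i P))
                    (SpineLemmas.spineCls β₂ b₂j Q (s≤s z≤n) (SpineLemmas.long β₂ b₂j Q)) ,
         λ { p (op , pi , pj) → jewel-adj ij (λ e → ki (≡sym e)) (λ e → kj (≡sym e)) β₁ b₁i β₂ b₂j β₃ b₃k op pi pj P Q }

    jewels-noTriple : NoTriple (IsJewel i j)
    jewels-noTriple x y z jx jy jz ((xy , xy′) , (xz , xz′) , (yz , yz′)) =
      let (b , c , d , _ , (c≢d , c≁d) , f) = jewels-common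
          (_ , xc , xd) = f x jx
          (_ , yc , yd) = f y jy
          (_ , zc , zd) = f z jz
      in proj₁ tpf (K23⇒theta c≢d c≁d xy xz yz xy′ xz′ yz′
           (Graph.sym G xc) (Graph.sym G yc) (Graph.sym G zc) xd yd zd)

  jewel⇒β : ∀ {i j p} → i ≢ j → IsJewel i j p → ∃[ b ] (β b × Adj G p b)
  jewel⇒β {p = p} ij jp@(_ , pi , pj) =
    let (b , _ , _ , βb , _ , f) = jewels-common ij (usedBy pi) (usedBy pj) in b , βb , proj₁ (f p jp)

  IsExcl : VSet n
  IsExcl q = Out q × Excl q × ∃[ i ] Attached q i

  isExcl? : Decidable IsExcl
  isExcl? q = out? q ×-dec (excl? q ×-dec Fin.any? (att? q))

  excl⇒β : ∀ {q} → IsExcl q → ∃[ b ] (β b × Adj G q b)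
  excl⇒β (o , ex , i , qi) =
    let (k , ki , _ , _ , uk) = thirdLabel i i
        (b , βb , bk) = βcov uk
    in b , βb , excl-β o ex qi βb bk (λ e → ki (≡sym e))

  module _ {t} (nc : ¬ HasClique G t) where

    Used : Fin n → Set
    Used i = ∃[ u ] lab u ≡ just i

    -- By `βadj`, choosing a vertex of `β` for each class yields a clique; this bounds the number of
    -- classes.
    transversal : ∀ L → Unique L → All Used L →
      ∃[ C ] (length C ≡ length L × Clique C × All (λ c → ∃[ i ] (i ∈ˡ L × β c × Attached c i)) C)
    transversal [] u al = [] , refl , [] , []
    transversal (i ∷ L) (i∉ ∷ u) (ui ∷ al) =
      let (C , eq , cl , f) = transversal L u al
          (b , βb , bi) = βcov (proj₂ ui)
      in b ∷ C , cong suc eq ,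
         All.map (λ { (j , j∈ , βc , cj) → βadj βb βc bi cj (All.lookup i∉ j∈) }) f ∷ cl ,
         (i , here refl , βb , bi) ∷ All.map (λ { (j , j∈ , rest) → j , there j∈ , rest }) f

    labels : List (Fin n)
    labels = filter (λ i → Fin.any? (cls? i)) (allFin n)

    labels-complete : ∀ {i} → Used i → i ∈ˡ labels
    labels-complete ui = ∈-filter⁺ (λ i → Fin.any? (cls? i)) (∈-allFin _) ui

    labels-bound : length labels ≤ t
    labels-bound =
      let (C , eq , cl , _) = transversal labels (Unique.filter⁺ _ (Unique.allFin⁺ n)) (All.all-filter _ (allFin n))
      in subst (_≤ t) eq (clique-bound nc C cl)

    AnyJewel : VSet n
    AnyJewel p = ∃[ i ] ∃[ j ] (i ≢ j × IsJewel i j p)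

    jewelList : ∃[ S ] (length S ≤ t * (t * (t * t)) × (∀ c → c ∈ˡ S → AnyJewel c) × (∀ c → AnyJewel c → c ∈ˡ S))
    jewelList =
      let (S , le , q , φ) = unions (λ i S → ∀ j p → i ≢ j → IsJewel i j p → p ∈ˡ S) AnyJewel
                               (λ i sub f j p ij jp → sub p (f j p ij jp)) (t * (t * t)) labels row
      in S , ≤-trans le (*-monoˡ-≤ (t * (t * t)) labels-bound) , q ,
         λ { c (i , j , ij , jp) → φ i (labels-complete (usedBy (proj₁ (proj₂ jp)))) j c ij jp }
      where
      cell : ∀ i j → ∃[ S ] (length S ≤ t * t × (∀ c → c ∈ˡ S → AnyJewel c) × (∀ p → i ≢ j → IsJewel i j p → p ∈ˡ S))
      cell i j with i Fin.≟ j | Fin.any? (cls? i) | Fin.any? (cls? j)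
      ... | yes e | _      | _      = [] , z≤n , (λ _ ()) , λ p ij → ⊥-elim (ij e)
      ... | no _  | no ¬ui | _      = [] , z≤n , (λ _ ()) , λ p _ jp → ⊥-elim (¬ui (usedBy (proj₁ (proj₂ jp))))
      ... | no _  | yes _  | no ¬uj = [] , z≤n , (λ _ ()) , λ p _ jp → ⊥-elim (¬uj (usedBy (proj₂ (proj₂ jp))))
      ... | no ij | yes ui | yes uj =
        let (S , le , f , g) = enumerate nc (isJewel? i j) (jewels-noTriple ij ui uj)
        in S , le , (λ c m → i , j , ij , f c m) , λ p _ → g p
      row : ∀ i → i ∈ˡ labels → ∃[ S ] (length S ≤ t * (t * t) × (∀ c → c ∈ˡ S → AnyJewel c)
              × (∀ j p → i ≢ j → IsJewel i j p → p ∈ˡ S))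
      row i _ =
        let (S , le , q , φ) = unions (λ j S → ∀ p → i ≢ j → IsJewel i j p → p ∈ˡ S) AnyJewel
                                 (λ j sub f p ij jp → sub p (f p ij jp)) (t * t) labels (λ j _ → cell i j)
        in S , ≤-trans le (*-monoˡ-≤ (t * t) labels-bound) , q ,
           λ j p ij jp → φ j (labels-complete (usedBy (proj₂ (proj₂ jp)))) p ij jp

    -- At most one class can have a stable triple among the vertices exclusively attached to it,
    -- and then those exclusively attached to the other classes form a clique.
    exclList : ∃[ S ] (length S ≤ t * t + t × (∀ c → c ∈ˡ S → IsExcl c)
                 × ∃[ i₀ ] (∀ q → IsExcl q → ¬ Attached q i₀ → q ∈ˡ S))
    exclList with Fin.any? (λ x → Fin.any? λ y → Fin.any? λ z →
                    isExcl? x ×-dec (isExcl? y ×-dec (isExcl? z ×-dec stable? x y z)))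
      where
      sep? : ∀ x y → Dec (Separated x y)
      sep? x y = ¬? (x Fin.≟ y) ×-dec ¬? (adj? G x y)
      stable? : ∀ x y z → Dec (StableTriple x y z)
      stable? x y z = sep? x y ×-dec (sep? x z ×-dec sep? y z)
    ... | no none =
      let (S , le , f , g) = enumerate nc isExcl? (λ x y z ex ey ez st → none (x , y , z , ex , ey , ez , st))
      -- The list misses nothing, so the exceptional label is arbitrary.
      in S , ≤-trans le (m≤m+n _ _) , f , a , λ q eq _ → g q eq
    ... | yes (x , y , z , (ox , ex , i , xi) , (oy , ey , iy , yi) , (oz , ez , iz , zi) , st@((xy , xy′) , (xz , xz′) , (yz , yz′))) =
      filter Thin? (allFin n) ,
      ≤-trans (clique-bound nc _ (pairwise⇒clique adjacent (Unique.filter⁺ Thin? (Unique.allFin⁺ n)) (All.all-filter Thin? (allFin n)))) (m≤n+m t (t * t)) ,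
      (λ c m → proj₁ (proj₂ (∈-filter⁻ Thin? {xs = allFin n} m))) ,
      i , λ q eq na → ∈-filter⁺ Thin? (∈-allFin q) (eq , na)
      where
      Thin : VSet n
      Thin q = IsExcl q × ¬ Attached q i
      Thin? : Decidable Thin
      Thin? q = isExcl? q ×-dec ¬? (att? q i)
      -- Exclusive vertices of different classes are adjacent, so the whole stable triple belongs to
      -- class `i`.
      same : ∀ {u l} → Out u → Excl u → Attached u l → ¬ Adj G x u → i ≡ l
      same {u} {l} ou eu ul na with i Fin.≟ l
      ... | yes e = e
      ... | no ne = ⊥-elim (na (excl-excl ox ex xi ou eu ul ne))
      toThin : ∀ {u l q} → Out u → Excl u → Attached u l → i ≡ l → Thin q → Adj G u q
      toThin ou eu ul refl ((oq , eq , j , qj) , na) = excl-excl ou eu ul oq eq qj (λ { refl → na qj })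
      adjacent : ∀ {u v} → Thin u → Thin v → u ≢ v → Adj G u v
      adjacent {u} {v} tu tv ne with adj? G u v
      ... | yes e = e
      ... | no ¬e = ⊥-elim (proj₁ tpf (K23⇒theta ne ¬e xy xz yz xy′ xz′ yz′
          (Graph.sym G (toThin ox ex xi refl tu)) (Graph.sym G (toThin oy ey yi (same oy ey yi xy′) tu))
          (Graph.sym G (toThin oz ez zi (same oz ez zi xz′) tu))
          (toThin ox ex xi refl tv) (toThin oy ey yi (same oy ey yi xy′) tv) (toThin oz ez zi (same oz ez zi xz′) tv)))

    Avoids : List (Fin n) → VSet n
    Avoids K z = z ≢ a × z ∉ˡ K

    starCut : ∃[ K ] (length K ≤ cutBound t × (∀ c → c ∈ˡ K → c ≢ a × ∃[ b ] (β b × Adj G c b))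
                × (∀ {u v} → Walk (Avoids K) u v → Adj G a u → Adj G a v → ∃[ i ] (Mark u i × Mark v i)))
    starCut =
      let (J , J≤ , Jsound , Jcomplete) = jewelList
          (N , N≤ , Nsound , i₀ , Ncomplete) = exclList
      in N ++ J , subst (_≤ cutBound t) (≡sym (List.length-++ N)) (+-mono-≤ N≤ J≤) ,
         (λ c m → [ (λ m′ → proj₂ (proj₁ (Nsound c m′)) , excl⇒β (Nsound c m′)) ,
                    (λ m′ → let (i , j , ij , jp) = Jsound c m′ in proj₂ (proj₁ jp) , jewel⇒β ij jp) ]′ (∈-++⁻ N m)) ,
         conclude (λ c jc m → m (∈-++⁺ʳ N (Jcomplete c jc))) (λ q eq na m → m (∈-++⁺ˡ (Ncomplete q eq na)))
      where
      module _ {K i₀} (jewel∉ : ∀ c → AnyJewel c → c ∉ˡ K → ⊥)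
               (excl∉ : ∀ q → IsExcl q → ¬ Attached q i₀ → q ∉ˡ K → ⊥) where
        -- The first vertex outside the class would be unlabelled and attached to `i`. If it sees no
        -- other class, it is in `K` because `i` is not the exceptional label; otherwise it is a
        -- jewel, hence also in `K`.
        stays : ∀ {u v i} → Walk (Avoids K) u v → lab u ≡ just i → i ≢ i₀ → lab v ≡ just i
        stays (stop _) lu ne = lu
        stays {i = i} (_∷⟨_⟩_ {v = v} _ e p) lu ne with lab v in eq
        ... | just j  = stays p (trans eq (cong just (labAdj (Graph.sym G e) eq lu))) ne
        ... | nothing with excl? v
        ...   | yes ex = ⊥-elim (excl∉ v ((eq , proj₁ (head∈ p)) , ex , i , vi) (λ at → ne (ex _ _ vi at)) (proj₂ (head∈ p)))
          where
          vi : Attached v i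
          vi = _ , Graph.sym G e , lu
        ...   | no ¬ex with Fin.any? (λ j → ¬? (i Fin.≟ j) ×-dec att? v j)
        ...     | yes (j , ij , vj) = ⊥-elim (jewel∉ v (i , j , ij , (eq , proj₁ (head∈ p)) , (_ , Graph.sym G e , lu) , vj) (proj₂ (head∈ p)))
        ...     | no none = ⊥-elim (¬ex λ j j′ vj vj′ → trans (≡sym (only j vj)) (only j′ vj′))
          where
          only : ∀ j → Attached v j → i ≡ j
          only j vj with i Fin.≟ j
          ... | yes e′ = e′
          ... | no ne′ = ⊥-elim (none (j , ne′ , vj))
        conclude : ∀ {u v} → Walk (Avoids K) u v → Adj G a u → Adj G a v → ∃[ i ] (Mark u i × Mark v i)
        conclude {u} {v} p au av with aNbr au | aNbr av
        ... | i , lu | j , lv with i Fin.≟ j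
        ...   | yes refl = i , mark au lu , mark av lv
        -- Only one of the two classes can be the exceptional one; the walk is read from its end in
        -- the other.
        ...   | no ij with i Fin.≟ i₀
        ...     | no ne = ⊥-elim (ij (just-unique (stays p lu ne) lv))
        ...     | yes refl = ⊥-elim (ij (just-unique lu (stays (reverse p) lv (λ e → ij (≡sym e)))))

-- Paths as walks, leaves and branch vertices

module _ {n : ℕ} (G : Graph n) where
  open Walks G

  pathWalk : (P : Path G) → Walk (on P) (first P) (last P)
  pathWalk P = subst (λ i → Walk (on P) (first P) (vert P i)) (≡sym (Fin.fromℕ-def (len P))) (go (len P) ≤-refl)
    where
    go : ∀ k (k≤ : k ≤ len P) → Walk (on P) (first P) (vert P (fromℕ< (s≤s k≤)))
    go zero    k≤ = stop (fz , refl)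
    go (suc k) k≤ = bridge (go k (<⇒≤ k≤)) e (stop (_ , refl))
      where
      e : Adj G (vert P (fromℕ< (s≤s (<⇒≤ k≤)))) (vert P (fromℕ< (s≤s k≤)))
      e = Equivalence.from (adjIff P _ _)
            (inj₁ (trans (Fin.toℕ-fromℕ< (s≤s k≤)) (cong suc (≡sym (Fin.toℕ-fromℕ< (s≤s (<⇒≤ k≤)))))))

  -- Equips each vertex of a walk with the part leading to it, so that what holds for vertices
  -- reachable from the start can be applied all along.
  prefixes : ∀ {X u v} → Walk X u v → Walk (λ z → X z × Walk X u z) u v
  prefixes (stop x)     = stop (x , stop x)
  prefixes (x ∷⟨ e ⟩ p) = (x , stop x) ∷⟨ e ⟩ mapʷ (λ { z (y , q) → y , (x ∷⟨ e ⟩ q) }) (prefixes p)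

  nbrs : Fin n → List (Fin n)
  nbrs v = filter (adj? G v) (allFin n)

  leaf-unique : ∀ {v u w} → IsLeaf G v → Adj G v u → Adj G v w → u ≡ w
  leaf-unique {v} {u} {w} leaf vu vw = single (nbrs v) leaf (∈-filter⁺ (adj? G v) (∈-allFin u) vu) (∈-filter⁺ (adj? G v) (∈-allFin w) vw)
    where
    single : ∀ L → length L ≡ 1 → u ∈ˡ L → w ∈ˡ L → u ≡ w
    single (_ ∷ []) _ (here refl) (here refl) = refl

  branch-other : ∀ {v} → IsBranch G v → ∀ x y → ∃[ z ] (Adj G v z × z ≢ x × z ≢ y)
  branch-other {v} big x y =
    let (z , z∈ , zx , zy) = search (nbrs v) (Unique.filter⁺ (adj? G v) (Unique.allFin⁺ n)) big
    in z , proj₂ (∈-filter⁻ (adj? G v) {xs = allFin n} z∈) , zx , zy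
    where
    search : ∀ L → Unique L → 2 < length L → ∃[ z ] (z ∈ˡ L × z ≢ x × z ≢ y)
    search (_ ∷ []) _ (s≤s ())
    search (_ ∷ _ ∷ []) _ (s≤s (s≤s ()))
    search (p ∷ q ∷ r ∷ L) ((pq ∷ pr ∷ _) ∷ (qr ∷ _) ∷ _) _
      with p Fin.≟ x | p Fin.≟ y | q Fin.≟ x | q Fin.≟ y | r Fin.≟ x | r Fin.≟ y
    ... | no a | no b | _ | _ | _ | _ = p , here refl , a , b
    ... | _ | _ | no a | no b | _ | _ = q , there (here refl) , a , b
    ... | _ | _ | _ | _ | no a | no b = r , there (there (here refl)) , a , b
    ... | yes refl | _ | yes refl | _ | _ | _ = ⊥-elim (pq refl)
    ... | yes refl | _ | _ | _ | yes refl | _ = ⊥-elim (pr refl)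
    ... | _ | _ | yes refl | _ | yes refl | _ = ⊥-elim (qr refl)
    ... | _ | yes refl | _ | yes refl | _ | _ = ⊥-elim (pq refl)
    ... | _ | yes refl | _ | _ | _ | yes refl = ⊥-elim (pr refl)
    ... | _ | _ | _ | yes refl | _ | yes refl = ⊥-elim (qr refl)

-- Sides of a tree

module Tree {m : ℕ} (T : Graph m) (tree : IsTree T) where
  open Walks T
  open IPath
  open Finite T

  private
    AdjT : Fin m → Fin m → Set
    AdjT = Adj T

  Side : Fin m → Fin m → VSet m
  Side v w u = Walk (_≢ v) w u

  side? : ∀ v w → Decidable (Side v w)
  side? v w u = walk? (λ z → ¬? (z Fin.≟ v)) w u

  adj⇒≢ : ∀ {v w} → AdjT v w → w ≢ v
  adj⇒≢ e refl = irrefl T e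

  here-side : ∀ {v w} → AdjT v w → Side v w w
  here-side e = stop (adj⇒≢ e)

  side-step : ∀ {v w u u′} → Side v w u → AdjT u u′ → u′ ≢ v → Side v w u′
  side-step p e ne = bridge p e (stop ne)

  cycle : ∀ {v w w′} → AdjT v w → AdjT v w′ → w ≢ w′ → Side v w w′ → HasCycle T
  cycle {v} {w₁} {w₂} e₁ e₂ ne p = build (r P) refl
    where
    P : IPath (_≢ v) w₁ w₂
    P = induce p
    build : ∀ k → r P ≡ k → HasCycle T
    build zero eq = ⊥-elim (ne (trans (≡sym (start P)) (trans (cong (w P) (≡sym eq)) (end P))))
    build (suc k) eq = k , c , inj′ , steps , closing
      where
      c : Fin (3 + k) → Fin m
      c fz     = v
      c (fs i) = w P (toℕ i)
      bd : (i : Fin (2 + k)) → toℕ i ≤ r P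
      bd i = subst (toℕ i ≤_) (≡sym eq) (≤-pred (Fin.toℕ<n i))
      inj′ : ∀ i j → c i ≡ c j → i ≡ j
      inj′ fz fz e = refl
      inj′ fz (fs j) e = ⊥-elim (inside P _ (bd j) (≡sym e))
      inj′ (fs i) fz e = ⊥-elim (inside P _ (bd i) e)
      inj′ (fs i) (fs j) e with <-cmp (toℕ i) (toℕ j)
      ... | tri< lt _ _ = ⊥-elim (proj₁ (far P _ _ lt (bd j)) e)
      ... | tri≈ _ ij _ = cong fs (Fin.toℕ-injective ij)
      ... | tri> _ _ gt = ⊥-elim (proj₁ (far P _ _ gt (bd i)) (≡sym e))
      steps : ∀ (i : Fin (2 + k)) → AdjT (c (inject₁ i)) (c (fs i))
      steps fz = subst (AdjT v) (≡sym (start P)) e₁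
      steps (fs i) = subst (λ l → AdjT (w P l) (w P (suc (toℕ i)))) (≡sym (Fin.toℕ-inject₁ i))
                       (next P (toℕ i) (subst (toℕ i <_) (≡sym eq) (Fin.toℕ<n i)))
      closing : AdjT (c (fromℕ (2 + k))) v
      closing = Graph.sym T (subst (AdjT v)
        (≡sym (trans (cong (w P) (trans (Fin.toℕ-fromℕ (1 + k)) (≡sym eq))) (end P))) e₂)

  side-unique : ∀ {v w w′ u} → AdjT v w → AdjT v w′ → Side v w u → Side v w′ u → w ≡ w′
  side-unique {w = w} {w′} e e′ p q with w Fin.≟ w′
  ... | yes eq = eq
  ... | no ne  = ⊥-elim (proj₂ tree (cycle e e′ ne (p ++ʷ reverse q)))

  connected : ∀ u v → Walk (λ _ → ⊤) u v
  connected u v with proj₁ tree u v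
  ... | P , refl , refl = mapʷ _ (pathWalk T P)

  side-cover : ∀ {u} v → u ≢ v → ∃[ w ] (AdjT v w × Side v w u)
  side-cover {u} v ne with lastIn (λ z → z Fin.≟ v) (connected v u) refl ne
  ... | .v , w , _ , refl , e , p = w , e , mapʷ (λ _ → proj₂) p

  -- A walk from `u` that avoids `w` cannot meet `v`, which lies on another side of `w`.
  side-nested : ∀ {v w u s} → AdjT v w → AdjT w u → u ≢ v → Side w u s → Side v w s
  side-nested {v} {w} {u} vw wu ne p = adj⇒≢ vw ∷⟨ wu ⟩ mapʷ avoid (prefixes T p)
    where
    avoid : ∀ z → z ≢ w × Side w u z → z ≢ v
    avoid z (z≢w , q) refl = ne (side-unique wu (Graph.sym T vw) q (stop z≢w))

  -- Moving on from `w` to `u` gives a side contained in the old one and missing `w`, so sides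
  -- shrink.
  side-induction : (P : Fin m → Fin m → Set) →
    (∀ v w → AdjT v w → (∀ u → AdjT w u → u ≢ v → P w u) → P v w) → ∀ v w → AdjT v w → P v w
  side-induction P f v w e = go v w e (<-wellFounded _)
    where
    go : ∀ v w → AdjT v w → Acc _<_ (count (side? v w)) → P v w
    go v w e (acc rec) = f v w e λ u e′ ne → go w u e′
      (rec (filter-length-strict (side? w u) (side? v w) (λ s → side-nested e e′ ne)
              (allFin m) (∈-allFin w) (here-side e) (λ p → last∈ p refl)))

  side-away : ∀ {v w l} → AdjT v w → Side v w l → l ≢ w → ∃[ u ] (AdjT w u × u ≢ v × Side w u l)
  side-away {w = w} e p ne with lastIn (λ z → z Fin.≟ w) p refl ne
  ... | .w , u , _ , refl , wu , q = u , wu , proj₁ (head∈ q) , mapʷ (λ _ → proj₂) q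

  leaf-side : ∀ {v w l} → IsLeaf T w → AdjT v w → Side v w l → l ≡ w
  leaf-side {v} {w} {l} leaf e sd with l Fin.≟ w
  ... | yes eq = eq
  ... | no ne  = let (u , wu , uv , _) = side-away e sd ne
                 in ⊥-elim (uv (leaf-unique T leaf wu (Graph.sym T e)))

  -- If a leaf and its neighbour were both leaves, they would be the whole tree.
  some-branch : 3 ≤ m → (∀ v → IsLeaf T v ⊎ IsBranch T v) → ∃[ v ] IsBranch T v
  some-branch 3≤m kind = let (x , y , z , yx , zx , yz) = distinct₃ 3≤m in go x y z yx zx yz (kind x)
    where
    distinct₃ : ∀ {m} → 3 ≤ m → ∃[ x ] ∃[ y ] ∃[ z ] (y ≢ x × z ≢ x × _≢_ {A = Fin m} y z)
    distinct₃ (s≤s (s≤s (s≤s _))) = fz , fs fz , fs (fs fz) , (λ ()) , (λ ()) , λ ()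
    go : ∀ x y z → y ≢ x → z ≢ x → y ≢ z → IsLeaf T x ⊎ IsBranch T x → ∃[ v ] IsBranch T v
    go x y z yx zx yz (inj₂ br)   = x , br
    go x y z yx zx yz (inj₁ leaf) with side-cover x yx | side-cover x zx
    ... | w , xw , sy | w′ , xw′ , sz with leaf-unique T leaf xw xw′ | kind w
    ...   | _    | inj₂ br    = w , br
    ...   | refl | inj₁ leaf′ = ⊥-elim (yz (trans (leaf-side leaf′ xw sy) (≡sym (leaf-side leaf′ xw sz))))

-- The frame of a strip structure

module Strip {n m : ℕ} (G : Graph n) (a : Fin n) (T : Graph m) (smooth : IsSmoothTree T)
             (ζ : ZetaData n m) (strip : IsStripStructure G a T ζ) (rich : IsRich G a T ζ) where
  open Walks G
  module WT = Walks T
  open Tree T (proj₁ smooth)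
  open IsStripStructure strip

  private
    AdjT : Fin m → Fin m → Set
    AdjT = Adj T

  SameEdge : Fin m → Fin m → Fin m → Fin m → Set
  SameEdge p q p′ q′ = (p ≡ p′ × q ≡ q′) ⊎ (p ≡ q′ × q ≡ p′)

  sameEdge? : ∀ p q p′ q′ → Dec (SameEdge p q p′ q′)
  sameEdge? p q p′ q′ = ((p Fin.≟ p′) ×-dec (q Fin.≟ q′)) ⊎-dec ((p Fin.≟ q′) ×-dec (q Fin.≟ p′))

  Frame : VSet n
  Frame z = ∃[ p ] ∃[ q ] (AdjT p q × ζE ζ p q z)

  -- The vertices of the frame beyond the directed edge (v , w), including those of ζ(vw).
  Beyond : Fin m → Fin m → VSet n
  Beyond v w z = ∃[ p ] ∃[ q ] (AdjT p q × Side v w q × ζE ζ p q z)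

  B : Fin m → VSet n
  B = Bv G a T ζ

  same-edge : ∀ {p q p′ q′ z} → AdjT p q → AdjT p′ q′ → ζE ζ p q z → ζE ζ p′ q′ z → SameEdge p q p′ q′
  same-edge {p} {q} {p′} {q′} e e′ x x′ with sameEdge? p q p′ q′
  ... | yes s = s
  ... | no ds = ⊥-elim (S1ee p q p′ q′ e e′ ds _ x x′)

  end-cases : ∀ {p q s z} → AdjT p q → ζEV ζ p q s z → s ≡ p ⊎ s ≡ q
  end-cases {p} {q} {s} e x = Equivalence.to (S3ne p q e s) (_ , x)

  common-end : ∀ {p q p′ q′ x y} → AdjT p q → AdjT p′ q′ → ζE ζ p q x → ζE ζ p′ q′ y → Adj G x y →
    SameEdge p q p′ q′ ⊎ (∃[ s ] (ζEV ζ p q s x × ζEV ζ p′ q′ s y × (s ≡ p ⊎ s ≡ q) × (s ≡ p′ ⊎ s ≡ q′)))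
  common-end {p} {q} {p′} {q′} e e′ x y xy with sameEdge? p q p′ q′
  ... | yes s = inj₁ s
  ... | no ds with S4only p q p′ q′ e e′ ds _ _ x y xy
  ...   | s , xs , ys = inj₂ (s , xs , ys , end-cases e xs , end-cases e′ ys)

  ends-B : ∀ {v w v′ z} → AdjT v w → ζEV ζ v w v′ z → ζE ζ v w z
  ends-B e = S3sub _ _ e _ _

  beyond-here : ∀ {v w z} → AdjT v w → ζE ζ v w z → Beyond v w z
  beyond-here e x = _ , _ , e , here-side e , x

  -- The sets ζ(e) are disjoint, so any edge whose strip contains `z` is the one that witnesses
  -- `Beyond`, up to orientation.
  beyond-end : ∀ {v w z p q} → Beyond v w z → AdjT p q → ζE ζ p q z → ∀ {s} → s ≡ p ⊎ s ≡ q → s ≢ v → Side v w s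
  beyond-end (p′ , q′ , e′ , sd , x′) e x se ne with same-edge e′ e x′ x
  beyond-end (p′ , q′ , e′ , sd , x′) e x (inj₁ refl) ne | inj₁ (refl , refl) = side-step sd (Graph.sym T e′) ne
  beyond-end (p′ , q′ , e′ , sd , x′) e x (inj₂ refl) ne | inj₁ (refl , refl) = sd
  beyond-end (p′ , q′ , e′ , sd , x′) e x (inj₁ refl) ne | inj₂ (refl , refl) = sd
  beyond-end (p′ , q′ , e′ , sd , x′) e x (inj₂ refl) ne | inj₂ (refl , refl) = side-step sd (Graph.sym T e′) ne

  beyond-unique : ∀ {v w w′ z} → AdjT v w → AdjT v w′ → Beyond v w z → Beyond v w′ z → w ≡ w′
  beyond-unique e e′ b (p , q , pq , sd , x) = side-unique e e′ (beyond-end b pq x (inj₂ refl) (WT.last∈ sd)) sd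

  beyond-cover : ∀ {z} v → Frame z → ∃[ w ] (AdjT v w × Beyond v w z)
  beyond-cover v (p , q , e , x) with q Fin.≟ v
  ... | no ne    = let (w , vw , sd) = side-cover v ne in w , vw , p , q , e , sd , x
  ... | yes refl = let (w , vw , sd) = side-cover v (λ { refl → irrefl T e })
                   in w , vw , q , p , Graph.sym T e , sd , symE p q e _ x

  beyond-frame : ∀ {v w z} → Beyond v w z → Frame z
  beyond-frame (p , q , e , _ , x) = p , q , e , x

  B-frame : ∀ {v z} → B v z → Frame z
  B-frame (w , e , x) = _ , w , e , ends-B e x

  beyond-B : ∀ {v w z} → AdjT v w → Beyond v w z → B v z → ζEV ζ v w v z
  beyond-B e b (w′ , e′ , x) with beyond-unique e e′ b (beyond-here e′ (ends-B e′ x))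
  ... | refl = x

  end-at : ∀ {v w z p q} → AdjT v w → Beyond v w z → AdjT p q → ζEV ζ p q v z → ζEV ζ v w v z
  end-at {v} {w} {z} {p} {q} e b pq x with end-cases pq x
  ... | inj₁ refl = beyond-B e b (q , pq , x)
  ... | inj₂ refl = beyond-B e b (p , Graph.sym T pq , symEV p q pq v z x)

  -- Adjacent vertices of different strips meet at a common end of the two tree edges, and distinct
  -- sides of `v` have no common tree vertex. Hence B(v) is the only passage of the frame between
  -- them.
  beyond-adj : ∀ {v w w′ x y} → AdjT v w → AdjT v w′ → w ≢ w′ → Beyond v w x → Beyond v w′ y → Adj G x y →
               ζEV ζ v w v x × ζEV ζ v w′ v y
  beyond-adj {v} e e′ ne bx@(p , q , pq , sd , x) by@(p′ , q′ , pq′ , sd′ , y) xy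
    with common-end pq pq′ x y xy
  ... | inj₁ (inj₁ (refl , refl)) = ⊥-elim (ne (side-unique e e′ sd sd′))
  ... | inj₁ (inj₂ (refl , refl)) = ⊥-elim (ne (side-unique e e′ sd (side-step sd′ (Graph.sym T pq′) (WT.last∈ sd))))
  ... | inj₂ (s , xs , ys , sp , sp′) with s Fin.≟ v
  ...   | yes refl = end-at e bx pq xs , end-at e′ by pq′ ys
  ...   | no sv    = ⊥-elim (ne (side-unique e e′ (beyond-end bx pq x sp sv) (beyond-end by pq′ y sp′ sv)))

  distinct : ∀ {v w w′} → AdjT v w → w ≢ w′ → DistinctEdges G a T ζ v w v w′
  distinct e ne (inj₁ (_ , eq))      = ne eq
  distinct e ne (inj₂ (_ , refl))    = irrefl T e

  B-complete : ∀ {v w w′ x y} → AdjT v w → AdjT v w′ → w ≢ w′ → ζEV ζ v w v x → ζEV ζ v w′ v y → Adj G x y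
  B-complete {v} e e′ ne x y = S4complete _ _ _ _ e e′ (distinct e ne) v _ _ x y

  B-nonempty : ∀ {v w} → AdjT v w → ∃[ x ] ζEV ζ v w v x
  B-nonempty {v} {w} e = Equivalence.from (S3ne v w e v) (inj₁ refl)

  beyond-nested : ∀ {v w u z} → AdjT v w → AdjT w u → u ≢ v → Beyond w u z → Beyond v w z
  beyond-nested e e′ ne (p , q , pq , sd , x) = p , q , pq , side-nested e e′ ne sd , x

  toEnd : ∀ {p q u} → AdjT p q → ζE ζ p q u → ∃[ u′ ] (Walk (ζE ζ p q) u u′ × ζEV ζ p q q u′)
  toEnd {p} {q} {u} e x with S5 q p (Graph.sym T e) u (symE p q e u x)
  ... | P , refl , l , sub , _ =
    last P , mapʷ (λ z on → symE q p (Graph.sym T e) z (sub z on)) (pathWalk G P) ,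
    symEV q p (Graph.sym T e) q _ l

  leaf-or-branch : ∀ v → IsLeaf T v ⊎ IsBranch T v
  leaf-or-branch = proj₂ (proj₂ smooth)

  -- Cross the strip to its end at `w`. If `w` is a leaf, this end is adjacent to `a`; otherwise it
  -- is complete to the end at `w` of a further strip, where the walk goes on by induction on sides.
  outward : ∀ v w → AdjT v w → ∀ u → ζE ζ v w u → ∃[ z ] (Walk (Beyond v w) u z × Adj G z a)
  outward v w e = side-induction P step v w e
    where
    P : Fin m → Fin m → Set
    P v w = ∀ u → ζE ζ v w u → ∃[ z ] (Walk (Beyond v w) u z × Adj G z a)
    step : ∀ v w → AdjT v w → (∀ u → AdjT w u → u ≢ v → P w u) → P v w
    step v w e rec u x =
      let (u′ , p , l) = toEnd e x in finish u u′ (mapʷ (λ _ → beyond-here e) p) l (leaf-or-branch w)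
      where
      finish : ∀ u u′ → Walk (Beyond v w) u u′ → ζEV ζ v w w u′ → IsLeaf T w ⊎ IsBranch T w →
               ∃[ z ] (Walk (Beyond v w) u z × Adj G z a)
      finish u u′ p l (inj₁ leaf) =
        u′ , p , Graph.sym G (S8complete w v leaf (Graph.sym T e) u′ (symEV v w e w u′ l))
      finish u u′ p l (inj₂ br) =
        let (t , wt , tv , _) = branch-other T br v v
            (y , yl) = B-nonempty wt
            u′y = B-complete (Graph.sym T e) wt (λ eq → tv (≡sym eq)) (symEV v w e w u′ l) yl
            (z , q , za) = rec t wt tv y (ends-B wt yl)
        in z , bridge p u′y (mapʷ (λ _ → beyond-nested e wt tv) q) , za

  inward : ∀ {p q v u} → WT.Walk (λ _ → ⊤) q v → AdjT p q → ζE ζ p q u → ∃[ b ] (Walk Frame u b × B v b)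
  inward {p} {q} (WT.stop _) e x =
    let (u′ , W , l) = toEnd e x
    in u′ , mapʷ (λ _ y → p , q , e , y) W , p , Graph.sym T e , symEV p q e q u′ l
  inward {p} {q} (WT._∷⟨_⟩_ {v = r} _ qr t) e x with toEnd e x | r Fin.≟ p
  -- The walk in `T` need not be a path and turns back here: the strip is unchanged, with its ends
  -- exchanged.
  ... | u′ , W , l | yes refl =
    let (b , W′ , bv) = inward t qr (symE p q e u′ (ends-B e l))
    in b , mapʷ (λ _ y → p , q , e , y) W ++ʷ W′ , bv
  ... | u′ , W , l | no rp =
    let (y , yl) = B-nonempty qr
        (b , W′ , bv) = inward t qr (ends-B qr yl)
    in b , bridge (mapʷ (λ _ y → p , q , e , y) W)
                  (B-complete (Graph.sym T e) qr (λ eq → rp (≡sym eq)) (symEV p q e q u′ l) yl) W′ , bv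

  frame≢a : ∀ {z} → Frame z → z ≢ a
  frame≢a (p , q , e , x) refl = noAE p q e x

  aNbr-leaf : ∀ {z} → Adj G a z → ∃[ l ] ∃[ w ] (IsLeaf T l × AdjT l w × ζEV ζ l w l z)
  aNbr-leaf {z} az with proj₁ (proj₁ rich) z (inj₂ (inj₁ az))
  ... | inj₂ refl = ⊥-elim (irrefl G az)
  ... | inj₁ t    = S8only z t az

  aNbr-frame : ∀ {z} → Adj G a z → Frame z
  aNbr-frame az = let (l , w , _ , e , x) = aNbr-leaf az in l , w , e , ends-B e x

  two-of-three : ∀ {y₁ y₂ x y z : Fin n} → x ≡ y₁ ⊎ x ≡ y₂ → y ≡ y₁ ⊎ y ≡ y₂ → z ≡ y₁ ⊎ z ≡ y₂ →
                 y ≢ x → z ≢ x → y ≡ z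
  two-of-three (inj₁ refl) (inj₁ refl) _ yx zx = ⊥-elim (yx refl)
  two-of-three (inj₂ refl) (inj₂ refl) _ yx zx = ⊥-elim (yx refl)
  two-of-three (inj₁ refl) _ (inj₁ refl) yx zx = ⊥-elim (zx refl)
  two-of-three (inj₂ refl) _ (inj₂ refl) yx zx = ⊥-elim (zx refl)
  two-of-three (inj₁ refl) (inj₂ refl) (inj₂ refl) yx zx = refl
  two-of-three (inj₂ refl) (inj₁ refl) (inj₁ refl) yx zx = refl

  -- Since `a` is trapped, all neighbours of `z` lie in ζ⁺(T), where `z` has just two, one of them
  -- `a`.
  deg2 : ∀ {z u w} → Adj G a z → Adj G z u → Adj G z w → u ≢ a → w ≢ a → u ≡ w
  deg2 {z} {u} {w} az zu zw ua wa with proj₂ (proj₁ rich) z az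
  ... | y₁ , y₂ , _ , _ , _ , _ , _ , only =
    two-of-three (only a (inj₂ refl) (Graph.sym G az)) (near zu) (near zw) ua wa
    where
    near : ∀ {v} → Adj G z v → v ≡ y₁ ⊎ v ≡ y₂
    near {v} zv = only v (proj₁ (proj₁ rich) v (inj₂ (inj₂ (z , az , zv)))) zv

  -- In B(v) such a vertex would see members of two further strips. These are adjacent to each
  -- other, hence distinct, against `deg2`.
  aNbr∉B : ∀ {v z} → IsBranch T v → Adj G a z → ¬ B v z
  aNbr∉B {v} {z} br az (w , vw , x) =
    let (f , vf , fw , _)  = branch-other T br w w
        (g , vg , gw , gf) = branch-other T br w f
        (y , yf) = B-nonempty vf
        (y′ , yg) = B-nonempty vg
        zy = B-complete vw vf (λ e → fw (≡sym e)) x yf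
        zy′ = B-complete vw vg (λ e → gw (≡sym e)) x yg
        eq = deg2 az zy zy′ (frame≢a (B-frame (f , vf , yf))) (frame≢a (B-frame (g , vg , yg)))
    in irrefl G (subst (Adj G y) (≡sym eq) (B-complete vf vg (λ e → gf (≡sym e)) yf yg))

-- The initial star at a branch vertex

module Node {n m : ℕ} (G : Graph n) (tpf : ThetaPrismFree G) (a : Fin n) (T : Graph m)
            (smooth : IsSmoothTree T) (ζ : ZetaData n m) (strip : IsStripStructure G a T ζ)
            (rich : IsRich G a T ζ) (ζE? : ∀ u w x → Dec (ζE ζ u w x))
            (ζEV? : ∀ u w v x → Dec (ζEV ζ u w v x)) (v : Fin m) (branch : IsBranch T v) where
  open Walks G
  open Finite G
  open Tree T (proj₁ smooth)
  open Strip G a T smooth ζ strip rich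

  private
    AdjT : Fin m → Fin m → Set
    AdjT = Adj T

  frame? : Decidable Frame
  frame? z = Fin.any? λ p → Fin.any? λ q → adj? T p q ×-dec ζE? p q z

  B? : Decidable (B v)
  B? z = Fin.any? λ w → adj? T v w ×-dec ζEV? v w v z

  -- The classes of the initial star at v are the components of G[Y] that meet N(a).
  Y : VSet n
  Y z = Frame z × ¬ B v z

  Y? : Decidable Y
  Y? z = frame? z ×-dec ¬? (B? z)

  Anchored : VSet n
  Anchored u = ∃[ z ] (Adj G a z × Walk Y u z)

  anchored? : Decidable Anchored
  anchored? u = Fin.any? λ z → adj? G a z ×-dec walk? Y? u z

  label : Fin n → Maybe (Fin n)
  label u with anchored? u
  ... | yes _ = just (rep Y? u)
  ... | no  _ = nothing

  label-just : ∀ {u} → Anchored u → label u ≡ just (rep Y? u)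
  label-just {u} an with anchored? u
  ... | yes _  = refl
  ... | no ¬an = ⊥-elim (¬an an)

  label-anchored : ∀ u {i} → label u ≡ just i → Anchored u × rep Y? u ≡ i
  label-anchored u e with anchored? u
  ... | yes an = an , Maybe.just-injective e

  label-nothing : ∀ {u} → ¬ Anchored u → label u ≡ nothing
  label-nothing {u} ¬an with anchored? u
  ... | yes an = ⊥-elim (¬an an)
  ... | no  _  = refl

  anchored-Y : ∀ {u} → Anchored u → Y u
  anchored-Y (_ , _ , p) = head∈ p

  anchored-walk : ∀ {u u′} → Walk Y u u′ → Anchored u → Anchored u′
  anchored-walk p (z , az , q) = z , az , reverse p ++ʷ q

  -- Restricted to vertices of B(v) with an anchored neighbour, since a star requires each vertex of
  -- `β` to be attached to a class.
  β : VSet n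
  β b = B v b × ∃[ u ] (Adj G b u × Anchored u)

  β? : Decidable β
  β? b = B? b ×-dec Fin.any? (λ u → adj? G b u ×-dec anchored? u)

  Mark : Fin n → Fin n → Set
  Mark z i = Y z × rep Y? z ≡ i

  same-rep : ∀ {u u′} → Y u → Y u′ → rep Y? u ≡ rep Y? u′ → Walk Y u u′
  same-rep y y′ e = subst (Walk Y _) e (rep-walk Y? y) ++ʷ reverse (rep-walk Y? y′)

  -- Passing from one side of `v` to another uses vertices of B(v), which `Y` omits.
  Y-side : ∀ {u u′ w} → AdjT v w → Walk Y u u′ → Beyond v w u → Beyond v w u′
  Y-side e (stop _) b = b
  Y-side {w = w} e (_∷⟨_⟩_ {v = u₁} y ad p) b with beyond-cover v (proj₁ (head∈ p))
  ... | w′ , e′ , b′ with w Fin.≟ w′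
  ...   | yes refl = Y-side e p b′
  ...   | no ne    = ⊥-elim (proj₂ y (w , e , proj₁ (beyond-adj e e′ ne b b′ ad)))

  B-side : ∀ {b u w} → AdjT v w → ζEV ζ v w v b → Adj G b u → Y u → Beyond v w u
  B-side {w = w} e x ad y with beyond-cover v (proj₁ y)
  ... | w′ , e′ , b′ with w Fin.≟ w′
  ...   | yes refl = b′
  ...   | no ne    = ⊥-elim (proj₂ y (w′ , e′ , proj₂ (beyond-adj e e′ ne (beyond-here e (ends-B e x)) b′ ad)))

  -- Take `b` as the last vertex in B(v) of an outward walk; the rest of the walk shows that its
  -- successor `c` is anchored.
  gate : ∀ {w} → AdjT v w → ∃[ b ] ∃[ c ] (ζEV ζ v w v b × Adj G b c × Anchored c × Beyond v w c)
  gate {w} e =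
    let (y , yv) = B-nonempty e
        (z , p , za) = outward v w e y (ends-B e yv)
        (b , c , bb , bv , bc , q) = lastIn B? p (w , e , yv) (aNbr∉B branch (Graph.sym G za))
    in b , c , beyond-B e bb bv , bc ,
       (z , Graph.sym G za , mapʷ (λ { _ (x , nb) → beyond-frame x , nb }) q) , proj₁ (head∈ q)

  Class : Fin n → VSet n
  Class i u = label u ≡ just i

  Att : Fin n → Fin n → Set
  Att b i = ∃[ u ] (Adj G b u × Class i u)

  class-Y : ∀ {i u} → Class i u → Y u
  class-Y {u = u} l = anchored-Y (proj₁ (label-anchored u l))

  class-walk : ∀ {i u u′} → Class i u → Walk Y u u′ → Walk (Class i) u u′
  class-walk {i} {u} l p = mapʷ (λ { z (y , q) →
      trans (label-just (anchored-walk q (proj₁ (label-anchored u l))))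
            (cong just (trans (≡sym (rep-cong Y? q)) (proj₂ (label-anchored u l)))) }) (prefixes G p)

  class-conn : ∀ {i u u′} → Class i u → Class i u′ → Walk (Class i) u u′
  class-conn {i} {u} {u′} l l′ = class-walk l (same-rep (class-Y l) (class-Y l′)
    (trans (proj₂ (label-anchored u l)) (≡sym (proj₂ (label-anchored u′ l′)))))

  class-exit : ∀ {c i X} (u : Fin n) → Class i u → (∀ z → Class i z → X z) → ∀ {u₀} → Adj G c u₀ → Walk X u₀ u → Exit c a X
  class-exit u l f cu p =
    let (z , az , q) = proj₁ (label-anchored u l)
    in _ , z , cu , p ++ʷ mapʷ f (class-walk l q) , Graph.sym G az

  label-adj : ∀ {u u′ i j} → Adj G u u′ → Class i u → Class j u′ → i ≡ j
  label-adj {u} {u′} e l l′ = trans (≡sym (proj₂ (label-anchored u l)))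
    (trans (rep-cong Y? (class-Y l ∷⟨ e ⟩ stop (class-Y l′))) (proj₂ (label-anchored u′ l′)))

  class-apart : ∀ {i j} → i ≢ j → Apart (Class i) (Class j)
  class-apart ne x y l l′ = (λ { refl → ne (Maybe.just-injective (trans (≡sym l) l′)) }) , λ e → ne (label-adj e l l′)

  class-side : ∀ {i w u u′} → AdjT v w → Class i u → Class i u′ → Beyond v w u → Beyond v w u′
  class-side e l l′ b = Y-side e (mapʷ (λ _ → class-Y) (class-conn l l′)) b

  B-out : ∀ {b} → B v b → label b ≡ nothing
  B-out bv = label-nothing λ an → proj₂ (anchored-Y an) bv

  B≁a : ∀ {b} → B v b → ¬ Adj G b a
  B≁a bv e = aNbr∉B branch (Graph.sym G e) bv

  B-att-side : ∀ {b i w u} → AdjT v w → ζEV ζ v w v b → Att b i → Class i u → Beyond v w u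
  B-att-side e x (u₀ , bu , l) l′ = class-side e l l′ (B-side e x bu (class-Y l))

  -- A gate beyond a second edge at `v`. Its class `k` lies on another side than the classes seen
  -- from ζ(vw,v), and so supplies the missing exit in the thetas of the next two lemmas.
  module Opposite {w} (e : AdjT v w) where
    private
      other : ∃[ w′ ] (AdjT v w′ × w′ ≢ w × w′ ≢ w)
      other = branch-other T branch w w
    w′ : Fin m
    w′ = proj₁ other
    e′ : AdjT v w′
    e′ = proj₁ (proj₂ other)
    w≢w′ : w ≢ w′
    w≢w′ eq = proj₁ (proj₂ (proj₂ other)) (≡sym eq)
    b′ c′ : Fin n
    b′ = proj₁ (gate e′)
    c′ = proj₁ (proj₂ (gate e′))
    b′v : ζEV ζ v w′ v b′
    b′v = proj₁ (proj₂ (proj₂ (gate e′)))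
    b′c′ : Adj G b′ c′
    b′c′ = proj₁ (proj₂ (proj₂ (proj₂ (gate e′))))
    k : Fin n
    k = rep Y? c′
    c′k : Class k c′
    c′k = label-just (proj₁ (proj₂ (proj₂ (proj₂ (proj₂ (gate e′))))))
    c′side : Beyond v w′ c′
    c′side = proj₂ (proj₂ (proj₂ (proj₂ (proj₂ (gate e′)))))

    module _ {b i} (bv : ζEV ζ v w v b) (bi : Att b i) where

      i≢k : i ≢ k
      i≢k refl = w≢w′ (beyond-unique e e′ (B-att-side e bv bi c′k) c′side)

      b′-class : Apart (_≡ b′) (Class i)
      b′-class _ y refl l =
        (λ { refl → proj₂ (class-Y l) (w′ , e′ , b′v) }) ,
        λ ad → w≢w′ (beyond-unique e e′ (B-att-side e bv bi l) (B-side e′ b′v ad (class-Y l)))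

      b-class-k : Apart (_≡ b) (Class k)
      b-class-k _ y refl l =
        (λ { refl → proj₂ (class-Y l) (w , e , bv) }) ,
        λ ad → w≢w′ (beyond-unique e e′ (B-side e bv ad (class-Y l)) (class-side e′ c′k l c′side))

  -- Otherwise `b` is the centre of a theta through class `i`, through class `j`, and through `b′`
  -- and class `k`.
  β-exclusive : ∀ {b i j} → B v b → Att b i → Att b j → i ≡ j
  β-exclusive {b} {i} {j} (w , e , bv) bi@(u , bu , ui) bj@(u′ , bu′ , uj) with i Fin.≟ j
  ... | yes eq = eq
  ... | no ne  = ⊥-elim (proj₁ tpf (theta b a (frame≢a (B-frame (w , e , bv))) (B≁a (w , e , bv))
      (class-exit u ui (λ _ l → l) bu (stop ui)) (class-exit u′ uj (λ _ l → l) bu′ (stop uj))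
      (class-exit {X = (_≡ b′) ∪ Class k} c′ c′k (λ _ → inj₂) (B-complete e e′ w≢w′ bv b′v) (inj₁ refl ∷⟨ b′c′ ⟩ stop (inj₂ c′k)))
      (class-apart ne) (far bv bi) (far bv bj)))
    where
    open Opposite e
    far : ∀ {b i} → ζEV ζ v w v b → Att b i → Apart (Class i) ((_≡ b′) ∪ Class k)
    far bv bi x y l (inj₁ refl) = apart-sym (b′-class bv bi) x y l refl
    far bv bi x y l (inj₂ l′)   = class-apart (i≢k bv bi) x y l l′

  -- For different strips this is `B-complete`. Within one strip, non-adjacent `b` and `c` would
  -- give a theta centred at `b′`, with exits through class `k`, through `b` and through `c`.
  β-adjacent : ∀ {b c i j} → B v b → B v c → Att b i → Att c j → i ≢ j → Adj G b c
  β-adjacent {b} {c} {i} {j} (w , e , bv) (w₁ , e₁ , cv) bi cj ij with w Fin.≟ w₁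
  ... | no ne = B-complete e e₁ ne bv cv
  ... | yes refl with adj? G b c
  ...   | yes ad = ad
  ...   | no ¬ad = ⊥-elim (proj₁ tpf (theta b′ a (frame≢a (B-frame B′)) (B≁a B′)
      (class-exit c′ c′k (λ _ l → l) b′c′ (stop c′k)) (via bv bi) (via cv cj)
      (apart-sym (λ { x y (inj₁ refl) l → b-class-k bv bi x y refl l ; x y (inj₂ l) l′ → class-apart (i≢k bv bi) x y l l′ }))
      (apart-sym (λ { x y (inj₁ refl) l → b-class-k cv cj x y refl l ; x y (inj₂ l) l′ → class-apart (i≢k cv cj) x y l l′ }))
      λ { x y (inj₁ refl) (inj₁ refl) → (λ { refl → ij (β-exclusive (w , e , bv) bi cj) }) , ¬ad
        ; x y (inj₁ refl) (inj₂ l) → unattached (w , e , bv) l (λ at → ij (β-exclusive (w , e , bv) bi at))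
        ; x y (inj₂ l) (inj₁ refl) → let (p , q) = unattached (w , e , cv) l (λ at → ij (β-exclusive (w , e , cv) at cj))
                                     in (λ eq → p (≡sym eq)) , λ ad → q (Graph.sym G ad)
        ; x y (inj₂ l) (inj₂ l′) → class-apart ij x y l l′ }))
    where
    open Opposite e
    B′ : B v b′
    B′ = w′ , e′ , b′v
    via : ∀ {b i} → ζEV ζ v w v b → Att b i → Exit b′ a ((_≡ b) ∪ Class i)
    via bv (u , bu , ui) =
      class-exit u ui (λ _ → inj₂) (Graph.sym G (B-complete e e′ w≢w′ bv b′v)) (inj₁ refl ∷⟨ bu ⟩ stop (inj₂ ui))
    unattached : ∀ {b y i} → B v b → Class i y → ¬ Att b i → b ≢ y × ¬ Adj G b y
    unattached bv l na = (λ { refl → proj₂ (class-Y l) bv }) , λ ad → na (_ , ad , l)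

  open Stars G tpf a deg2 β β? Mark using (Star; Maximal; maximal)

  initial : Star
  initial = record
    { lab = label
    ; labAdj = label-adj
    ; aOut = label-nothing (λ an → frame≢a (proj₁ (anchored-Y an)) refl)
    ; aNbr = λ {z} az → rep Y? z , label-just (z , az , stop (aNbr-frame az , aNbr∉B branch az))
    ; conn = class-conn
    ; toA = λ {u} l → let (z , az , q) = proj₁ (label-anchored u l) in z , last∈ (class-walk l q) , az
    ; βout = λ { (bv , _) → B-out bv }
    ; βa = λ { (bv , _) → frame≢a (B-frame bv) }
    ; βexcl = λ { (bv , _) → β-exclusive bv }
    ; βadj = λ { (bv , _) (cv , _) → β-adjacent bv cv }
    ; βatt = λ { (_ , u , bu , an) → rep Y? u , u , bu , label-just an }
    ; βcov = cov
    ; three = threeLabels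
    ; mark = λ {z} az l → class-Y l , proj₂ (label-anchored z l)
    }
    where
    cov : ∀ {u i} → Class i u → ∃[ b ] (β b × Att b i)
    cov {u} {i} l =
      let (p , q , pq , x) = proj₁ (class-Y l)
          (b , W , bv) = inward (connected q v) pq x
          (c , b′ , q , cb , _ , bv′) = firstIn B? W (proj₂ (class-Y l)) bv
          lc = last∈ (class-walk l q)
      in b′ , (bv′ , c , Graph.sym G cb , proj₁ (label-anchored c lc)) , c , Graph.sym G cb , lc
    threeLabels : ∃[ i ] ∃[ j ] ∃[ k ] (i ≢ j × i ≢ k × j ≢ k
                    × (∃[ u ] Class i u) × (∃[ u ] Class j u) × (∃[ u ] Class k u))
    threeLabels =
      let (w₁ , e₁ , _) = branch-other T branch v v
          (w₂ , e₂ , n₂ , _) = branch-other T branch w₁ w₁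
          (w₃ , e₃ , n₃ , n₃′) = branch-other T branch w₁ w₂
          (_ , c₁ , _ , _ , an₁ , s₁) = gate e₁
          (_ , c₂ , _ , _ , an₂ , s₂) = gate e₂
          (_ , c₃ , _ , _ , an₃ , s₃) = gate e₃
      in rep Y? c₁ , rep Y? c₂ , rep Y? c₃ ,
         (λ eq → n₂ (≡sym (differ e₁ e₂ an₁ an₂ s₁ s₂ eq))) ,
         (λ eq → n₃ (≡sym (differ e₁ e₃ an₁ an₃ s₁ s₃ eq))) ,
         (λ eq → n₃′ (≡sym (differ e₂ e₃ an₂ an₃ s₂ s₃ eq))) ,
         (c₁ , label-just an₁) , (c₂ , label-just an₂) , (c₃ , label-just an₃)
      where
      differ : ∀ {w w′ c c′} → AdjT v w → AdjT v w′ → Anchored c → Anchored c′ →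
               Beyond v w c → Beyond v w′ c′ → rep Y? c ≡ rep Y? c′ → w ≡ w′
      differ e e′ an an′ s s′ eq = beyond-unique e e′ (Y-side e (same-rep (anchored-Y an) (anchored-Y an′) eq) s) s′

  -- The star yields a common `Mark`, that is, a common component of the initial star, and by
  -- `Y-side` this lies beyond a single edge at `v`.
  nodeCut : ∀ {t} → ¬ HasClique G t →
    ∃[ K ] (length K ≤ cutBound t × (∀ c → c ∈ˡ K → c ≢ a × ∃[ b ] (B v b × Adj G c b))
      × (∀ {u u′ w w′} → Walk (λ z → z ≢ a × z ∉ˡ K) u u′ → Adj G a u → Adj G a u′ →
           AdjT v w → AdjT v w′ → Beyond v w u → Beyond v w′ u′ → w ≡ w′))
  nodeCut nc =
    let (s , mx) = maximal initial
        (K , le , sound , sep) = Cuts.starCut G tpf a deg2 β β? Mark s mx nc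
    in K , le , (λ c m → let (ca , b , (bv , _) , cb) = sound c m in ca , b , bv , cb) ,
       λ p au au′ e e′ s s′ →
         let (i , (y , ri) , (y′ , ri′)) = sep p au au′
         in beyond-unique e e′ (Y-side e (same-rep y y′ (trans ri (≡sym ri′))) s) s′

-- Assembling the separator

-- The last argument counts the bad vertices that a run may still meet. The `suc` covers a leaf,
-- `cutBound t` a cut that can be used, and the product a bad vertex, where all further edges are
-- tried. At 0 nothing is paid, as the case is impossible.
runBound : ℕ → ℕ → ℕ → ℕ
runBound t δ zero    = 0
runBound t δ (suc c) = suc (cutBound t) + δ * runBound t δ c

module Separation {n m : ℕ} (G : Graph n) (tpf : ThetaPrismFree G) (a : Fin n) (T : Graph m)
            (smooth : IsSmoothTree T) (ζ : ZetaData n m) (strip : IsStripStructure G a T ζ)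
            (rich : IsRich G a T ζ) (ζE? : ∀ u w x → Dec (ζE ζ u w x))
            (ζEV? : ∀ u w v x → Dec (ζEV ζ u w v x)) (t δ : ℕ) (nc : ¬ HasClique G t)
            (maxdeg : ∀ v → deg T v ≤ δ) (x : Fin n) (x≢a : x ≢ a) (a≁x : ¬ Adj G a x) where
  open Walks G
  open Finite G
  open Tree T (proj₁ smooth)
  open Strip G a T smooth ζ strip rich
  open IsStripStructure strip using (symE; symEV; S8complete)

  private
    AdjT : Fin m → Fin m → Set
    AdjT = Adj T
    flip : ∀ {u v} → AdjT u v → AdjT v u
    flip = Graph.sym T

  Bad : Fin m → Set
  Bad w = IsBranch T w × ∃[ b ] (B w b × Adj G x b)

  -- Run k v w: the directed edge (v , w) ends a non-backtracking walk whose last k vertices before w are bad.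
  data Run : ℕ → Fin m → Fin m → Set where
    start  : ∀ {v w} → AdjT v w → Run 0 v w
    extend : ∀ {k v w u} → Run k v w → Bad w → AdjT w u → u ≢ v → Run (suc k) w u

  Over : (Fin m → Set) → VSet n
  Over R z = ∃[ p ] ∃[ q ] (AdjT p q × R p × R q × ζE ζ p q z)

  -- Strips that coincide or have an edge between them share a tree vertex, and `Over` asks for both
  -- ends of a strip.
  over-apart : ∀ {R R′ : Fin m → Set} → (∀ s → R s → R′ s → ⊥) → Apart (Over R) (Over R′)
  over-apart dis y z (p , q , e , Rp , Rq , yE) (p′ , q′ , e′ , Rp′ , Rq′ , zE) =
    (λ { refl → shared (same-edge e e′ yE zE) }) , λ yz → meet (common-end e e′ yE zE yz)
    where
    shared : SameEdge p q p′ q′ → ⊥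
    shared (inj₁ (refl , _)) = dis _ Rp Rp′
    shared (inj₂ (refl , _)) = dis _ Rp Rq′
    meet : SameEdge p q p′ q′ ⊎ (∃[ s ] (ζEV ζ p q s y × ζEV ζ p′ q′ s z × (s ≡ p ⊎ s ≡ q) × (s ≡ p′ ⊎ s ≡ q′))) → ⊥
    meet (inj₁ se) = shared se
    meet (inj₂ (s , _ , _ , inj₁ refl , inj₁ refl)) = dis s Rp Rp′
    meet (inj₂ (s , _ , _ , inj₁ refl , inj₂ refl)) = dis s Rp Rq′
    meet (inj₂ (s , _ , _ , inj₂ refl , inj₁ refl)) = dis s Rq Rp′
    meet (inj₂ (s , _ , _ , inj₂ refl , inj₂ refl)) = dis s Rq Rq′

  -- The exit leaves along an edge `wf` other than the two directions `c`, `c′` of the run. The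
  -- neighbour `y` of `x` may lie in the strip of any edge at `w`, from where the exit crosses
  -- inside B(w); so `R` must contain all neighbours of `w`.
  bad-exit : ∀ {w} (R : Fin m → Set) → Bad w → ∀ c c′ → R w → (∀ h → AdjT w h → R h) →
             (∀ f q → AdjT w f → f ≢ c → f ≢ c′ → Side w f q → R q) → Exit x a (Over R)
  bad-exit {w} R (br , y , (h , wh , yv) , xy) c c′ Rw Rn Rs =
    let (f , wf , fc , fc′) = branch-other T br c c′ in go f wf fc fc′ (h Fin.≟ f)
    where
    toOver : ∀ {f} → AdjT w f → f ≢ c → f ≢ c′ → ∀ z → Beyond w f z → Over R z
    toOver {f} wf fc fc′ z (p , q , e , sd , zE) = p , q , e , Rp (p Fin.≟ w) , Rs f q wf fc fc′ sd , zE
      where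
      Rp : Dec (p ≡ w) → R p
      Rp (yes refl) = Rw
      Rp (no ne)    = Rs f p wf fc fc′ (side-step sd (flip e) ne)
    go : ∀ f → AdjT w f → f ≢ c → f ≢ c′ → Dec (h ≡ f) → Exit x a (Over R)
    go f wf fc fc′ (yes refl) =
      let (z , p , za) = outward w f wf y (ends-B wf yv)
      in y , z , xy , mapʷ (toOver wf fc fc′) p , za
    go f wf fc fc′ (no hf) =
      let (b , bv) = B-nonempty wf
          (z , p , za) = outward w f wf b (ends-B wf bv)
      in y , z , xy ,
         ((w , h , wh , Rw , Rn h wh , ends-B wh yv) ∷⟨ B-complete wh wf hf yv bv ⟩ mapʷ (toOver wf fc fc′) p) , za

  -- The vertex `c` is included because the exit may start in the strip of `cw`.
  Halfspace : Fin m → Fin m → Fin m → Set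
  Halfspace c w s = s ≡ c ⊎ Side c w s

  bad-exit-end : ∀ {c w} → AdjT c w → Bad w → Exit x a (Over (Halfspace c w))
  bad-exit-end {c} {w} cw bad = bad-exit (Halfspace c w) bad c c (inj₂ (here-side cw)) nbr
    (λ f q wf fc _ sd → inj₂ (side-nested cw wf fc sd))
    where
    nbr : ∀ h → AdjT w h → Halfspace c w h
    nbr h wh with h Fin.≟ c
    ... | yes e = inj₁ e
    ... | no ne = inj₂ (side-step (here-side cw) wh ne)

  -- For a bad vertex between `d` and `e`: these two belong to the region, as the exit may start in
  -- the strips leading to them, while `c` and `f` are left to the exits on either side.
  Between : (c d e f : Fin m) → Fin m → Set
  Between c d e f s = Side c d s × Side f e s

  bad-exit-middle : ∀ {c d w e f} → AdjT c d → AdjT d w → AdjT w e → AdjT e f → w ≢ c → f ≢ w →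
                    Bad w → Exit x a (Over (Between c d e f))
  bad-exit-middle {c} {d} {w} {e} {f} cd dw we ef wc fw bad = bad-exit (Between c d e f) bad d e
      (left-w , right-w) (λ h wh → left h wh , right h wh)
      (λ g q wg gd ge sd → side-nested cd dw wc (side-nested dw wg gd sd) ,
                           side-nested (flip ef) (flip we) (λ eq → fw (≡sym eq)) (side-nested (flip we) wg ge sd))
    where
    left-w : Side c d w
    left-w = side-step (here-side cd) dw wc
    right-w : Side f e w
    right-w = side-step (here-side (flip ef)) (flip we) (λ eq → fw (≡sym eq))
    left : ∀ h → AdjT w h → Side c d h
    left h wh with h Fin.≟ d
    ... | yes refl = here-side cd
    ... | no ne    = side-nested cd dw wc (side-nested dw wh ne (here-side wh))
    right : ∀ h → AdjT w h → Side f e h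
    right h wh with h Fin.≟ e
    ... | yes refl = here-side (flip ef)
    ... | no ne    = side-nested (flip ef) (flip we) (λ eq → fw (≡sym eq)) (side-nested (flip we) wh ne (here-side wh))

  -- The first, fourth and seventh bad vertices give three exits of x.
  no-long-run : ∀ {v w} → ¬ Run 7 v w
  no-long-run (extend {v = w₆} {w = w₇} (extend {v = w₅} (extend {v = w₄} (extend {v = w₃} (extend {v = w₂} (extend {v = w₁}
      (extend _ bad₁ e₁₂ _) bad₂ e₂₃ n₁₃) bad₃ e₃₄ n₂₄) bad₄ e₄₅ n₃₅) bad₅ e₅₆ n₄₆) bad₆ e₆₇ n₅₇) bad₇ _ _) =
    proj₁ tpf (theta x a x≢a (λ xa → a≁x (Graph.sym G xa))
      (bad-exit-end (flip e₁₂) bad₁) (bad-exit-middle e₂₃ e₃₄ e₄₅ e₅₆ n₂₄ n₄₆ bad₄) (bad-exit-end e₆₇ bad₇)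
      (over-apart d₁₄)
      (over-apart λ s h₁ h₇ → d₆ s (push s h₁) h₇)
      (over-apart λ { s (_ , sd) h₇ → d₆ s sd h₇ }))
    where
    d₁₄ : ∀ s → Halfspace w₂ w₁ s → Between w₂ w₃ w₅ w₆ s → ⊥
    d₁₄ s (inj₁ refl) (sd , _) = Walks.last∈ T sd refl
    d₁₄ s (inj₂ sd′) (sd , _) = n₁₃ (side-unique e₂₃ (flip e₁₂) sd sd′)
    d₆ : ∀ s → Side w₆ w₅ s → Halfspace w₆ w₇ s → ⊥
    d₆ s sd (inj₁ refl) = Walks.last∈ T sd refl
    d₆ s sd (inj₂ sd′)  = n₅₇ (side-unique e₆₇ (flip e₅₆) sd′ sd)
    push : ∀ s → Halfspace w₂ w₁ s → Side w₆ w₅ s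
    push s h = side-nested (flip e₅₆) (flip e₄₅) (λ eq → n₄₆ (≡sym eq))
                 (side-nested (flip e₄₅) (flip e₃₄) (λ eq → n₃₅ (≡sym eq))
                   (side-nested (flip e₃₄) (flip e₂₃) (λ eq → n₂₄ (≡sym eq)) (root h)))
      where
      root : Halfspace w₂ w₁ s → Side w₃ w₂ s
      root (inj₁ refl) = here-side (flip e₂₃)
      root (inj₂ sd)   = side-nested (flip e₂₃) (flip e₁₂) (λ eq → n₁₃ (≡sym eq)) sd

  Avoids : List (Fin n) → VSet n
  Avoids S z = z ≢ a × z ∉ˡ S

  Reach : List (Fin n) → VSet n
  Reach S z = Walk (Avoids S) x z

  reach-mono : ∀ {S S′} → (∀ c → c ∈ˡ S → c ∈ˡ S′) → ∀ {u v} → Walk (Avoids S′) u v → Walk (Avoids S) u v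
  reach-mono sub = mapʷ λ { _ (za , z∉) → za , λ m → z∉ (sub _ m) }

  Fine : Fin n → Set
  Fine c = c ≢ a × c ≢ x

  -- The outcome that ends the entire search: all of N(a) is cut off from `x`, not only the part
  -- beyond one edge as in `ShutBy`.
  Done : ℕ → Set
  Done b = ∃[ S ] (length S ≤ b × (∀ c → c ∈ˡ S → Fine c) × (∀ z → Adj G a z → ¬ Reach S z))

  Shut : Fin m → Fin m → List (Fin n) → Set
  Shut v w S = ∀ z → Adj G a z → Beyond v w z → ¬ Reach S z

  ShutBy : ℕ → Fin m → Fin m → Set
  ShutBy b v w = ∃[ S ] (length S ≤ b × (∀ c → c ∈ˡ S → Fine c) × Shut v w S)

  private
    k₀ : ℕ
    k₀ = cutBound t
    g : ℕ → ℕ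
    g = runBound t δ
    -- One cut, and a set found with a fresh budget that shuts the only edge beyond which `x` still
    -- reaches N(a).
    D : ℕ
    D = k₀ + g 7

  leaf≢branch : ∀ {l v} → IsLeaf T l → IsBranch T v → l ≢ v
  leaf≢branch leaf br refl with subst (2 <_) leaf br
  ... | s≤s ()

  -- A neighbour of `a` lies in the strip at some leaf, and this leaf is neither of the branch
  -- vertices `v` and `w`.
  beyond-away : ∀ {v w z} → IsBranch T v → IsBranch T w → AdjT v w → Adj G a z → Beyond v w z →
                ∃[ u ] (AdjT w u × u ≢ v × Beyond w u z)
  beyond-away {v} {w} {z} brv brw e az bz =
    let (l , w′ , leaf , e′ , zl) = aNbr-leaf az
        sd = beyond-end bz e′ (ends-B e′ zl) (inj₁ refl) (leaf≢branch leaf brv)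
        (u , wu , uv , sd′) = side-away e sd (leaf≢branch leaf brw)
    in u , wu , uv , w′ , l , flip e′ , sd′ , symE l w′ e′ z (ends-B e′ zl)

  -- Richness leaves a single neighbour of `a` to delete here, and it differs from `x`, which is not
  -- adjacent to `a`.
  shut-leaf : ∀ {v w} → IsBranch T v → IsLeaf T w → AdjT v w → ShutBy 1 v w
  shut-leaf {v} {w} brv leaf e =
    x₀ , ≤-refl , fine , λ z az bz p → proj₂ (last∈ p) (here (only z az bz))
    where
    entry : ∃[ y ] (∀ z → ζEV ζ w v w z ⇔ z ≡ y)
    entry = proj₂ rich w v leaf (flip e)
    x₀ : List (Fin n)
    x₀ = proj₁ entry ∷ []
    fine : ∀ c → c ∈ˡ x₀ → Fine c
    fine c (here refl) = frame≢a (v , w , e , symE w v (flip e) c (ends-B (flip e) here-x₀)) ,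
                         λ { refl → a≁x (S8complete w v leaf (flip e) c here-x₀) }
      where
      here-x₀ : ζEV ζ w v w c
      here-x₀ = Equivalence.from (proj₂ entry c) refl
    only : ∀ z → Adj G a z → Beyond v w z → z ≡ proj₁ entry
    only z az bz@(p , q , pq , sd , zE) =
      let (l , w′ , leaf′ , e′ , zl) = aNbr-leaf az
          l≡w = leaf-side leaf e (beyond-end bz e′ (ends-B e′ zl) (inj₁ refl) (leaf≢branch leaf′ brv))
      in finish l w′ e′ zl l≡w
      where
      finish : ∀ l w′ → AdjT l w′ → ζEV ζ l w′ l z → l ≡ w → z ≡ proj₁ entry
      finish l w′ e′ zl refl with leaf-unique T leaf e′ (flip e)
      ... | refl = Equivalence.to (proj₂ entry z) zl

  all-or-done : ∀ {A : Set} {E : Fin m → Set} L → (∀ u → u ∈ˡ L → A ⊎ E u) → A ⊎ (∀ u → u ∈ˡ L → E u)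
  all-or-done [] f = inj₂ λ _ ()
  all-or-done (u ∷ L) f with f u (here refl) | all-or-done L (λ u m → f u (there m))
  ... | inj₁ d | _      = inj₁ d
  ... | inj₂ _ | inj₁ d = inj₁ d
  ... | inj₂ h | inj₂ k = inj₂ λ { _ (here refl) → h ; u (there m) → k u m }

  Avoided : Fin m → Fin m → Fin m → List (Fin n) → Set
  Avoided v w u S = u ≢ v → Shut w u S

  shut-all : ∀ {b} v w → (∀ u → AdjT w u → u ≢ v → Done D ⊎ ShutBy b w u) →
    Done D ⊎ (∃[ S ] (length S ≤ δ * b × (∀ c → c ∈ˡ S → Fine c) × (∀ u → AdjT w u → Avoided v w u S)))
  shut-all {b} v w f = combine (all-or-done (nbrs T w) each)
    where
    E : Fin m → Set
    E u = ∃[ S ] (length S ≤ b × (∀ c → c ∈ˡ S → Fine c) × Avoided v w u S)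
    each : ∀ u → u ∈ˡ nbrs T w → Done D ⊎ E u
    each u m with u Fin.≟ v
    ... | yes eq = inj₂ ([] , z≤n , (λ _ ()) , λ ne → ⊥-elim (ne eq))
    ... | no ne with f u (proj₂ (∈-filter⁻ (adj? T w) {xs = allFin _} m)) ne
    ...   | inj₁ d = inj₁ d
    ...   | inj₂ (S , le , fine , sh) = inj₂ (S , le , fine , λ _ → sh)
    combine : Done D ⊎ (∀ u → u ∈ˡ nbrs T w → E u) →
      Done D ⊎ (∃[ S ] (length S ≤ δ * b × (∀ c → c ∈ˡ S → Fine c) × (∀ u → AdjT w u → Avoided v w u S)))
    combine (inj₁ d) = inj₁ d
    combine (inj₂ h) =
      let (S , le , fine , sh) = unions (Avoided v w) Fine
            (λ u sub av ne z az bz p → av ne z az bz (reach-mono sub p)) b (nbrs T w) h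
      in inj₂ (S , ≤-trans le (*-monoˡ-≤ b (maxdeg w)) , fine ,
               λ u wu → sh u (∈-filter⁺ (adj? T w) (∈-allFin u) wu))

  -- `k` bad vertices have been passed and `c` more are allowed; with sum seven, `no-long-run`
  -- excludes `c` = 0. The induction is on sides and not on `c`, since `c` is sometimes reset.
  shut-or-done : ∀ v w → AdjT v w → IsBranch T v → ∀ c k → c + k ≡ 7 → Run k v w → Done D ⊎ ShutBy (g c) v w
  shut-or-done = side-induction P step
    where
    P : Fin m → Fin m → Set
    P v w = IsBranch T v → ∀ c k → c + k ≡ 7 → Run k v w → Done D ⊎ ShutBy (g c) v w
    step : ∀ v w → AdjT v w → (∀ u → AdjT w u → u ≢ v → P w u) → P v w
    step v w e rec brv zero    .7 refl run = ⊥-elim (no-long-run run)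
    step v w e rec brv (suc c) k  eq   run = decide (leaf-or-branch w)
      where
      Goal : Set
      Goal = Done D ⊎ ShutBy (g (suc c)) v w
      decide : IsLeaf T w ⊎ IsBranch T w → Goal
      decide (inj₁ leaf) = let (S , le , fine , sh) = shut-leaf brv leaf e
                           in inj₂ (S , ≤-trans le (s≤s z≤n) , fine , sh)
      decide (inj₂ brw) = byCut (Node.nodeCut G tpf a T smooth ζ strip rich ζE? ζEV? w brw nc)
        where
        byCut : ∃[ K ] (length K ≤ k₀ × (∀ c → c ∈ˡ K → c ≢ a × ∃[ b ] (B w b × Adj G c b))
                  × (∀ {u u′ w₁ w₂} → Walk (Avoids K) u u′ → Adj G a u → Adj G a u′ →
                       AdjT w w₁ → AdjT w w₂ → Beyond w w₁ u → Beyond w w₂ u′ → w₁ ≡ w₂)) → Goal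
        byCut (K , K≤ , sound , sep) with Any.any? (x Fin.≟_) K
        -- The cut is unusable, but it shows that `w` is bad, so the run grows while every further
        -- edge is tried.
        ... | yes x∈K = conclude (shut-all v w λ u wu uv → rec u wu uv brw c (suc k) (trans (+-suc c k) eq)
                                                    (extend run (brw , proj₂ (sound x x∈K)) wu uv))
          where
          conclude : Done D ⊎ (∃[ S ] (length S ≤ δ * g c × (∀ c → c ∈ˡ S → Fine c)
                       × (∀ u → AdjT w u → Avoided v w u S))) → Goal
          conclude (inj₁ d) = inj₁ d
          conclude (inj₂ (S , le , fine , sh)) = inj₂ (S , ≤-trans le (m≤n+m _ _) , fine ,
            λ z az bz p → let (u , wu , uv , bu) = beyond-away brv brw e az bz in sh u wu uv z az bu p)
        -- The cut is usable, and it leaves N(a) within reach of `x` beyond at most one edge at `w`.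
        ... | no x∉K = pointer (Fin.any? λ z → adj? G a z ×-dec walk? (λ u → ¬? (u Fin.≟ a) ×-dec ¬? (Any.any? (u Fin.≟_) K)) x z)
          where
          fineK : ∀ c → c ∈ˡ K → Fine c
          fineK c m = proj₁ (sound c m) , λ { refl → x∉K m }
          pointer : Dec (∃[ z ] (Adj G a z × Reach K z)) → Goal
          pointer (no none) = inj₁ (K , ≤-trans K≤ (m≤m+n _ _) , fineK , λ z az p → none (z , az , p))
          pointer (yes (z₀ , az₀ , p₀)) = towards (beyond-cover w (aNbr-frame az₀))
            where
            towards : ∃[ u ] (AdjT w u × Beyond w u z₀) → Goal
            towards (u₀ , wu₀ , b₀) with u₀ Fin.≟ v
            -- That edge leads back to `v`, so `K` alone shuts the edge from `v` to `w`.
            ... | yes refl = inj₂ (K , ≤-trans K≤ (≤-trans (n≤1+n _) (m≤m+n _ _)) , fineK , λ z az bz p →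
                    let (u , wu , uv , bu) = beyond-away brv brw e az bz
                    in uv (≡sym (sep (reverse p₀ ++ʷ p) az₀ az wu₀ wu b₀ bu)))
            -- The run restarts with the full budget. Success here is `Done`, so restarts are never
            -- added up.
            ... | no uv = further (rec u₀ wu₀ uv brw 7 0 refl (start wu₀))
              where
              further : Done D ⊎ ShutBy (g 7) w u₀ → Goal
              further (inj₁ d) = inj₁ d
              further (inj₂ (S , le , fine , sh)) = inj₁ (K ++ S ,
                subst (_≤ D) (≡sym (List.length-++ K)) (+-mono-≤ K≤ le) ,
                (λ c m → [ fineK c , fine c ]′ (∈-++⁻ K m)) ,
                λ z az p →
                  let p₁ = reach-mono (λ _ → ∈-++⁺ˡ) p
                      (u , wu , bu) = beyond-cover w (aNbr-frame az)
                      u₀≡u = sep (reverse p₀ ++ʷ p₁) az₀ az wu₀ wu b₀ bu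
                  in sh z az (subst (λ u → Beyond w u z) (≡sym u₀≡u) bu) (reach-mono (λ _ → ∈-++⁺ʳ K) p))

  separator : Done (D + δ * g 7)
  separator =
    let (v , br) = some-branch (proj₁ (proj₂ smooth)) leaf-or-branch in
    [ (λ { (S , le , rest) → S , ≤-trans le (m≤m+n _ _) , rest }) ,
      (λ { (S , le , fine , sh) → S , ≤-trans le (m≤n+m _ D) , fine ,
           λ z az p → let (w , vw , bz) = beyond-cover v (aNbr-frame az)
                      in sh w vw (adj⇒≢ vw) z az bz p }) ]′
    -- At the initial vertex no direction is to be skipped; `v`, which is not its own neighbour,
    -- fills the place.
    (shut-all v v λ u vu _ → shut-or-done v u vu br 7 0 refl (start vu))

-- Separators as subsets, and deciding whether a small one exists

∣p∪q∣≤∣p∣+∣q∣ : ∀ {n} (p q : Subset n) → ∣ p ∪ˢ q ∣ ≤ ∣ p ∣ + ∣ q ∣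
∣p∪q∣≤∣p∣+∣q∣ [] [] = z≤n
∣p∪q∣≤∣p∣+∣q∣ (true  ∷ p) (true  ∷ q) =
  s≤s (≤-trans (∣p∪q∣≤∣p∣+∣q∣ p q) (+-monoʳ-≤ ∣ p ∣ (n≤1+n ∣ q ∣)))
∣p∪q∣≤∣p∣+∣q∣ (true  ∷ p) (false ∷ q) = s≤s (∣p∪q∣≤∣p∣+∣q∣ p q)
∣p∪q∣≤∣p∣+∣q∣ (false ∷ p) (true  ∷ q) =
  ≤-trans (s≤s (∣p∪q∣≤∣p∣+∣q∣ p q)) (≤-reflexive (≡sym (+-suc ∣ p ∣ ∣ q ∣)))
∣p∪q∣≤∣p∣+∣q∣ (false ∷ p) (false ∷ q) = ∣p∪q∣≤∣p∣+∣q∣ p q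

module _ {n : ℕ} where

  fromList : List (Fin n) → Subset n
  fromList []      = ∅
  fromList (c ∷ S) = ⁅ c ⁆ ∪ˢ fromList S

  ∣fromList∣≤ : ∀ S → ∣ fromList S ∣ ≤ length S
  ∣fromList∣≤ []      = ≤-reflexive (Subset.∣⊥∣≡0 n)
  ∣fromList∣≤ (c ∷ S) = ≤-trans (∣p∪q∣≤∣p∣+∣q∣ ⁅ c ⁆ (fromList S))
                          (+-mono-≤ (≤-reflexive (Subset.∣⁅x⁆∣≡1 c)) (∣fromList∣≤ S))

  ∈-fromList⁻ : ∀ S {c} → c ∈ fromList S → c ∈ˡ S
  ∈-fromList⁻ []      c∈ = ⊥-elim (Subset.∉⊥ c∈)
  ∈-fromList⁻ (d ∷ S) c∈ = [ (λ h → here (Subset.x∈⁅y⁆⇒x≡y d h)) , (λ h → there (∈-fromList⁻ S h)) ]′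
                             (Subset.x∈p∪q⁻ ⁅ d ⁆ (fromList S) c∈)

  ∈-fromList⁺ : ∀ {S c} → c ∈ˡ S → c ∈ fromList S
  ∈-fromList⁺ (here refl) = Subset.x∈p∪q⁺ (inj₁ (Subset.x∈⁅x⁆ _))
  ∈-fromList⁺ (there m)   = Subset.x∈p∪q⁺ (inj₂ (∈-fromList⁺ m))

¬¬-dec : ∀ {k} (P : Fin k → Set) → ¬ ¬ (∀ i → Dec (P i))
¬¬-dec P = Fin.sequence (RawMonad.rawApplicative ¬¬-Monad) λ i → ¬¬-excluded-middle

¬¬-dec₃ : ∀ {k l o} (P : Fin k → Fin l → Fin o → Set) → ¬ ¬ (∀ i j x → Dec (P i j x))
¬¬-dec₃ P = Fin.sequence ap λ i → Fin.sequence ap λ j → ¬¬-dec (P i j)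
  where ap = RawMonad.rawApplicative ¬¬-Monad

module _ {n : ℕ} (G : Graph n) (a x : Fin n) where
  open Walks G
  open Finite G

  Avoiding : Subset n → VSet n
  Avoiding S z = z ≢ a × z ∉ S

  -- A decidable substitute for `Separates`, which quantifies over arbitrary sets of vertices.
  Cutting : ℕ → Subset n → Set
  Cutting σ S = ∣ S ∣ < σ × ¬ (a ∈ S) × ¬ (x ∈ S) × (∀ z → Adj G a z → ¬ Walk (Avoiding S) x z)

  avoiding? : ∀ S → Decidable (Avoiding S)
  avoiding? S z = ¬? (z Fin.≟ a) ×-dec ¬? (z Subset.∈? S)

  cutting? : ∀ σ → Decidable (Cutting σ)
  cutting? σ S = (suc ∣ S ∣ ≤? σ) ×-dec (¬? (a Subset.∈? S) ×-dec (¬? (x Subset.∈? S) ×-dec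
                   Fin.all? λ z → adj? G a z →-dec ¬? (walk? (avoiding? S) x z)))

  -- Let `R` be what `x` reaches without `a` and `S`, and `L` the remainder. An edge from `a` to `R`
  -- would end in a neighbour of `a` within reach; any other edge between `L` and `R` would enlarge
  -- `R`.
  cutting⇒separates : ∀ {σ} S → x ≢ a → Cutting σ S → Separates G S a x
  cutting⇒separates S x≢a (_ , a∉S , x∉S , none) =
    a∉S , x∉S , L , R , cover , (λ _ → proj₁) , (λ _ l → proj₂ l) , (λ _ v∈S r → proj₂ (last∈ r) v∈S) ,
    (a∉S , λ r → proj₁ (last∈ r) refl) , stop (x≢a , x∉S) , anti
    where
    L R : VSet n
    R v = Walk (Avoiding S) x v
    L v = ¬ (v ∈ S) × ¬ R v
    cover : ∀ v → L v ⊎ (v ∈ S) ⊎ R v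
    cover v with v Subset.∈? S | walk? (avoiding? S) x v
    ... | yes v∈S | _     = inj₂ (inj₁ v∈S)
    ... | no _    | yes r = inj₂ (inj₂ r)
    ... | no v∉S  | no ¬r = inj₁ (v∉S , ¬r)
    anti : Anticomplete G L R
    anti u v (u∉S , ¬r) r uv with u Fin.≟ a
    ... | yes refl = none v uv r
    ... | no u≢a   = ¬r (bridge r (Graph.sym G uv) (stop (u≢a , u∉S)))

theorem6p1 : (t δ : ℕ) → 1 ≤ t → 1 ≤ δ →
    Σ ℕ λ σ → 1 ≤ σ ×
    ((n : ℕ) (G : Graph n) → ThetaPrismFree G → ¬ HasClique G t →
    (a : Fin n) (m : ℕ) (T : Graph m) → IsSmoothTree T → MaxDegree T δ →
    (ζ : ZetaData n m) → IsStripStructure G a T ζ → IsRich G a T ζ →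
    (∀ x y → ¬ ζT⁺ G a T ζ x → ¬ Jζ G a T ζ x → ζT⁺ G a T ζ y → ¬ Adj G x y) →
    (x : Fin n) → x ≢ a → ¬ Adj G a x →
    Σ (Subset n) λ S → ∣ S ∣ < σ × ¬ (a ∈ S) × ¬ (x ∈ S) × Separates G S a x)
-- Having a small cut is decidable, so ζ may be assumed to have decidable membership.
theorem6p1 t δ _ _ = suc bound , s≤s z≤n ,
  λ n G tpf nc a m T smooth (maxdeg , _) ζ strip rich _ x x≢a a≁x →
    let exists : ¬ ¬ (∃[ S ] Cutting G a x (suc bound) S)
        exists no-cut = ¬¬-dec₃ (ζE ζ) λ ζE? → Fin.sequence (RawMonad.rawApplicative ¬¬-Monad)
          (λ u → ¬¬-dec₃ (ζEV ζ u)) λ ζEV? →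
          let (S , le , fine , none) =
                Separation.separator G tpf a T smooth ζ strip rich ζE? ζEV? t δ nc maxdeg x x≢a a≁x
          in no-cut (fromList S , s≤s (≤-trans (∣fromList∣≤ S) le) ,
                     (λ a∈ → proj₁ (fine a (∈-fromList⁻ S a∈)) refl) ,
                     (λ x∈ → proj₂ (fine x (∈-fromList⁻ S x∈)) refl) ,
                     λ z az p → none z az (Walks.mapʷ G (λ { _ (za , z∉) → za , λ m → z∉ (∈-fromList⁺ m) }) p))
        (S , cut@(small , a∉S , x∉S , _)) = decidable-stable (Subset.anySubset? (cutting? G a x (suc bound))) exists
    in S , small , a∉S , x∉S , cutting⇒separates G a x S x≢a cut
  where
  bound : ℕ
  bound = cutBound t + runBound t δ 7 + δ * runBound t δ 7
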